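{- For every integer $k\ge 3$ and every $\varepsilon>0$ there exists a constant $K'=K'(k,\varepsilon)$ such that for every integer $\ell$ with $2\le\ell<k$ and all sufficiently large $n$ with $(k-\ell)\mid n$ the following holds. If the edges of the random hypergraph $G^{(k)}(n,p)$, where $p=K'n^{\ell-k}$, are colored independently and uniformly at random with $q\ge n/(k-\ell)$ colors, then with probability at least $1-\varepsilon$ the resulting hypergraph contains a rainbow Hamilton $\ell$-cycle.
   Context: $G^{(k)}(n,p)$ is the binomial random $k$-uniform hypergraph on $n$ vertices in which each $k$-subset of the vertex set is an edge independently with probability $p$. A $k$-uniform $\ell$-cycle of length $t$ is a $k$-uniform hypergraph with $t(k-\ell)$ vertices and $t$ edges whose vertices admit a cyclic order $v_1,\dots,v_{t(k-\ell)}$ such that the edges are $\{v_{i(k-\ell)+1},\dots,v_{i(k-\ell)+k}\}$ for $i=1,\dots,t$ (indices modulo $t(k-\ell)$). A Hamilton $\ell$-cycle in an $n$-vertex hypergraph is a subhypergraph that is an $\ell$-cycle containing all $n$ vertices (hence with $n/(k-\ell)$ edges). It is rainbow if its edges have pairwise distinct colors. -}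

module Defs where

open import Data.Bool using (Bool; true; false; if_then_else_)
import Data.Bool.Properties as Bool
open import Data.Fin using (Fin; toℕ)
import Data.Fin.Properties as Fin
open import Data.Fin.Subset using (Subset; inside; outside; ⁅_⁆; ⋃; ⊤; ∣_∣)
open import Data.Integer using (+_)
open import Data.List using (List; []; _∷_; _++_; map; concatMap; filter; foldr; length; tabulate; allFin)
open import Data.List.Relation.Binary.Sublist.Propositional using ([]; _∷ʳ_; _∷_) renaming (_⊆_ to _⊑_)
open import Data.List.Relation.Binary.Subset.Propositional using (_⊆_)
import Data.List.Relation.Binary.Subset.DecPropositional as SubsetDec
open import Data.List.Relation.Unary.All using (All; all?)
open import Data.List.Relation.Unary.AllPairs using (allPairs?)
open import Data.List.Relation.Unary.Unique.Propositional using (Unique)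
open import Data.Nat using (ℕ; zero; suc; _+_; _*_; _∸_; _^_; NonZero)
open import Data.Nat.DivMod using (_mod_)
open import Data.Nat.Properties using (_≟_; nonZero?; m^n≢0)
open import Data.Product using (Σ; ∃; ∃-syntax; _×_; _,_; proj₁; proj₂)
open import Data.Rational as ℚ using (ℚ; 0ℚ; 1ℚ)
open import Data.Sum using (inj₁; inj₂; [_,_])
open import Data.Vec using (Vec; []; _∷_; lookup; toList)
import Data.Vec.Properties as Vec
open import Level using (Level)
open import Relation.Binary.Definitions using (DecidableEquality)
open import Relation.Binary.PropositionalEquality using (_≡_; refl)
open import Relation.Nullary using (Dec; yes; no)
open import Relation.Nullary.Decidable using (map′; _×-dec_; _⊎-dec_; ¬?)
open import Relation.Unary using (Pred; Decidable)

private
  variable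
    a b p : Level
    A : Set a
    B : Set b
    m n q : ℕ

-- A list of outcomes with their weights; an outcome may be listed more
-- than once, its weights then add up.
Dist : Set a → Set a
Dist A = List (A × ℚ)

return : A → Dist A
return x = (x , 1ℚ) ∷ []

infixl 1 _>>=_

_>>=_ : Dist A → (A → Dist B) → Dist B
d >>= f = concatMap (λ (x , w) → map (λ (y , w′) → (y , w ℚ.* w′)) (f x)) d

-- A genuine distribution only for 0 ≤ p ≤ 1.
bernoulli : ℚ → Dist Bool
bernoulli p = (true , p) ∷ (false , 1ℚ ℚ.- p) ∷ []

uniform : (q : ℕ) .{{_ : NonZero q}} → Dist (Fin q)
uniform q = map (λ c → (c , + 1 ℚ./ q)) (allFin q)

Pr : {P : Pred A p} → Decidable P → Dist A → ℚ
Pr P? d = foldr (λ (_ , w) s → w ℚ.+ s) 0ℚ (filter (λ (x , _) → P? x) d)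

-- A hypergraph on the vertex set Fin n is given by its list of edges, and
-- a coloured one by its list of edges paired with their colours.  The
-- lists produced by the random models below have no repeated edges.
Hypergraph : ℕ → Set
Hypergraph n = List (Subset n)

ColouredHypergraph : ℕ → ℕ → Set
ColouredHypergraph n q = List (Subset n × Fin q)

allSubsets : (n : ℕ) → List (Subset n)
allSubsets zero    = [] ∷ []
allSubsets (suc n) = map (inside ∷_) (allSubsets n) ++ map (outside ∷_) (allSubsets n)

kSubsets : (k n : ℕ) → List (Subset n)
kSubsets k n = filter (λ e → ∣ e ∣ ≟ k) (allSubsets n)

randomSubset : ℚ → List A → Dist (List A)
randomSubset p []       = return []
randomSubset p (x ∷ xs) =
  bernoulli p       >>= λ b →
  randomSubset p xs >>= λ ys →
  return (if b then x ∷ ys else ys)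

-- G⁽ᵏ⁾(n,p)
binomialHypergraph : (k n : ℕ) → ℚ → Dist (Hypergraph n)
binomialHypergraph k n p = randomSubset p (kSubsets k n)

randomColouring : (q : ℕ) .{{_ : NonZero q}} → List A → Dist (List (A × Fin q))
randomColouring q []       = return []
randomColouring q (x ∷ xs) =
  uniform q            >>= λ c →
  randomColouring q xs >>= λ ys →
  return ((x , c) ∷ ys)

randomColouredHypergraph : (k n q : ℕ) .{{_ : NonZero q}} → ℚ → Dist (ColouredHypergraph n q)
randomColouredHypergraph k n q p = binomialHypergraph k n p >>= randomColouring q

-- K · n^(ℓ-k), for ℓ ≤ k.
edgeProbability : ℚ → (k ℓ n : ℕ) .{{_ : NonZero n}} → ℚ
edgeProbability K k ℓ n = K ℚ.* (ℚ._/_ (+ 1) (n ^ (k ∸ ℓ)) {{m^n≢0 n (k ∸ ℓ)}})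

vertexSet : List (Fin n) → Subset n
vertexSet vs = ⋃ (map ⁅_⁆ vs)

-- With the order v₁,…,vₘ stored as positions 0,…,m-1, this is the set
-- {vₛ₊₁,…,vₛ₊ₖ}, indices modulo m.
segment : (k : ℕ) .{{_ : NonZero m}} → Vec (Fin n) m → ℕ → Subset n
segment {m} k v s = vertexSet (tabulate {n = k} (λ j → lookup v ((s + toℕ j) mod m)))

-- The indices i = 0,…,t-1 represent the same residues as i = 1,…,t.
cycleEdges : (k ℓ t : ℕ) .{{_ : NonZero (t * (k ∸ ℓ))}} →
             Vec (Fin n) (t * (k ∸ ℓ)) → Hypergraph n
cycleEdges k ℓ t v = tabulate {n = t} (λ i → segment k v (toℕ i * (k ∸ ℓ)))

-- v is a cyclic order of the vertex set S (so S has t(k-ℓ) elements)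
-- exhibiting the edge set E as that of an ℓ-cycle.
IsCyclicOrder : (k ℓ t : ℕ) .{{_ : NonZero (t * (k ∸ ℓ))}} →
                Subset n → Hypergraph n → Vec (Fin n) (t * (k ∸ ℓ)) → Set
IsCyclicOrder k ℓ t S E v =
  Unique (toList v) ×
  vertexSet (toList v) ≡ S ×
  E ⊆ cycleEdges k ℓ t v ×
  cycleEdges k ℓ t v ⊆ E

-- The hypergraph with vertex set S and edge set E is a k-uniform ℓ-cycle
-- of length t.
IsCycle : (k ℓ t : ℕ) → Subset n → Hypergraph n → Set
IsCycle k ℓ t S E =
  All (λ e → ∣ e ∣ ≡ k) E ×
  Unique E ×
  length E ≡ t ×
  Σ (NonZero (t * (k ∸ ℓ))) λ nz →
  ∃[ v ] IsCyclicOrder k ℓ t {{nz}} S E v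

IsHamiltonCycle : (k ℓ : ℕ) → Hypergraph n → Set
IsHamiltonCycle k ℓ E = ∃[ t ] IsCycle k ℓ t ⊤ E

edges : ColouredHypergraph n q → Hypergraph n
edges = map proj₁

colours : ColouredHypergraph n q → List (Fin q)
colours = map proj₂

-- _⊑_ is the sublist relation: C retains some of the coloured edges of H.
HasRainbowHamiltonCycle : (k ℓ : ℕ) → ColouredHypergraph n q → Set
HasRainbowHamiltonCycle k ℓ H =
  ∃[ C ] C ⊑ H × IsHamiltonCycle k ℓ (edges C) × Unique (colours C)

unique? : DecidableEquality A → Decidable (Unique {A = A})
unique? _≟A_ = allPairs? (λ x y → ¬? (x ≟A y))

_≟S_ : DecidableEquality (Subset n)
_≟S_ = Vec.≡-dec Bool._≟_

anyVec? : {P : Pred (Vec (Fin n) m) p} → Decidable P → Dec (∃ P)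
anyVec? {m = zero}  P? = map′ (λ h → [] , h) (λ { ([] , h) → h }) (P? [])
anyVec? {m = suc m} P? =
  map′ (λ { (x , xs , h) → x ∷ xs , h }) (λ { (x ∷ xs , h) → x , xs , h })
       (Fin.any? (λ x → anyVec? (λ xs → P? (x ∷ xs))))

anySublist? : {P : Pred (List A) p} → Decidable P → (xs : List A) → Dec (∃[ ys ] ys ⊑ xs × P ys)
anySublist? P? []       = map′ (λ h → [] , [] , h) (λ { ([] , [] , h) → h }) (P? [])
anySublist? P? (x ∷ xs) =
  map′ [ (λ { (ys , s , h) → x ∷ ys , refl ∷ s , h })
       , (λ { (ys , s , h) → ys , x ∷ʳ s , h }) ]
       (λ { (_ , refl ∷ s , h) → inj₁ (_ , s , h)
          ; (_ , _ ∷ʳ s , h)   → inj₂ (_ , s , h) })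
       (anySublist? (λ ys → P? (x ∷ ys)) xs ⊎-dec anySublist? P? xs)

isCyclicOrder? : (k ℓ t : ℕ) .{{_ : NonZero (t * (k ∸ ℓ))}} (S : Subset n) (E : Hypergraph n) →
                 Decidable (IsCyclicOrder k ℓ t S E)
isCyclicOrder? k ℓ t S E v =
  unique? Fin._≟_ (toList v) ×-dec
  (vertexSet (toList v) ≟S S) ×-dec
  (E ⊆? cycleEdges k ℓ t v) ×-dec
  (cycleEdges k ℓ t v ⊆? E)
  where open SubsetDec _≟S_ using (_⊆?_)

isCycle? : (k ℓ t : ℕ) (S : Subset n) → Decidable (IsCycle k ℓ t S)
isCycle? k ℓ t S E =
  all? (λ e → ∣ e ∣ ≟ k) E ×-dec
  unique? _≟S_ E ×-dec
  (length E ≟ t) ×-dec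
  order?
  where
  order? : Dec (Σ (NonZero (t * (k ∸ ℓ))) λ nz → ∃[ v ] IsCyclicOrder k ℓ t {{nz}} S E v)
  order? with nonZero? (t * (k ∸ ℓ))
  ... | no ¬nz = no (λ (nz , _) → ¬nz nz)
  ... | yes nz = map′ (λ h → nz , h) (λ { (_ , h) → h }) (anyVec? (isCyclicOrder? k ℓ t {{nz}} S E))

isHamiltonCycle? : (k ℓ : ℕ) → Decidable (IsHamiltonCycle {n} k ℓ)
isHamiltonCycle? k ℓ E =
  map′ (λ h → length E , h) (λ { (_ , h@(_ , _ , refl , _)) → h }) (isCycle? k ℓ (length E) ⊤ E)

hasRainbowHamiltonCycle? : (k ℓ : ℕ) → Decidable (HasRainbowHamiltonCycle {n} {q} k ℓ)
hasRainbowHamiltonCycle? k ℓ =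
  anySublist? (λ C → isHamiltonCycle? k ℓ (edges C) ×-dec unique? Fin._≟_ (colours C))

{-# OPTIONS --safe #-}
module Submission where

-- Second moment method.  Write m = k - ℓ and n = t m, and let X count the pairs
-- (τ , d) of an ordering τ of the vertices and an injective sequence d of t
-- colours such that every coloured edge (atom) of the resulting coloured cycle is
-- present.  An atom is present with probability r = p / q, so
-- E[X²] / E[X]² is the average of r^(-s), s the number of atoms which a random
-- pair shares with a fixed one.  The set of shared atoms breaks up into chains of
-- overlapping edges.  Each shared atom forces m new vertices and one colour, of
-- total probability O(n^(-m) / q), which against r^(-1) = q n^m / K leaves a
-- factor O(1/K); each chain in addition forces ℓ vertices, which costs O(n^(-ℓ))
-- and, as ℓ ≥ 2, pays for the at most n² choices of where the chain starts in
-- both cycles.  A chain closing up around the cycle is negligible because it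
-- consists of at least t/k atoms.  Hence E[X²] ≤ (1 + O(1/K)) E[X]².

open import Defs
open import Data.Bool using (if_then_else_)
open import Data.Empty using (⊥-elim)
open import Data.Fin using (Fin; zero; suc; toℕ; fromℕ<)
import Data.Fin.Properties as Fin
open import Data.Fin.Subset using (Subset; ⁅_⁆; inside; outside; ∣_∣; _∪_) renaming (_∈_ to _∈ₛ_; ⊤ to full)
open import Data.Fin.Subset.Properties using (x∈⁅x⁆; x∈p∪q⁺; x∈⁅y⁆⇒x≡y; x∈p∪q⁻; ∉⊥; ⊆-antisym; ⊆⊤; ∪-identityˡ; ∣⊥∣≡0) renaming (_∈?_ to _∈ₛ?_)
import Data.Integer as ℤ
import Data.Integer.Properties as ℤ
open import Data.List using (List; []; _∷_; _++_; map; concatMap; length; replicate; allFin; tabulate; filter; applyUpTo; cartesianProduct)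
import Data.List.Membership.DecPropositional as DecMembership
open import Data.List.Membership.Propositional using (_∈_; _∉_; find)
open import Data.List.Membership.Propositional.Properties using (∈-++⁻; ∈-map⁻; ∈-concatMap⁻; ∈-tabulate⁺; ∈-map⁺; ∈-++⁺ˡ; ∈-++⁺ʳ; ∈-filter⁺; ∈-allFin; ∈-tabulate⁻; ∈-filter⁻; ∈-cartesianProduct⁻; ∈-applyUpTo⁻)
open import Data.List.Properties using (length-map; length-++; map-tabulate; length-tabulate; length-replicate; ++-identityʳ; filter-all; filter-accept; filter-reject; length-applyUpTo; map-applyUpTo)
import Data.List.Relation.Binary.Permutation.Propositional as ↭
open import Data.List.Relation.Binary.Permutation.Propositional using (_↭_; prep; swap; ↭-refl; ↭-reflexive; ↭-trans; ↭-sym)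
import Data.List.Relation.Binary.Permutation.Propositional.Properties as ↭ₚ
open import Data.List.Relation.Binary.Sublist.Propositional using ([]; _∷ʳ_; _∷_) renaming (_⊆_ to _⊑_)
import Data.List.Relation.Unary.All as All
open import Data.List.Relation.Unary.All using (All; []; _∷_; all?)
import Data.List.Relation.Unary.All.Properties as Allₚ
import Data.List.Relation.Unary.AllPairs as AllPairs
open import Data.List.Relation.Unary.AllPairs using ([]; _∷_; AllPairs)
import Data.List.Relation.Unary.AllPairs.Properties as AllPairsₚ
open import Data.List.Relation.Unary.Any using (here; there; satisfied; any?)
open import Data.List.Relation.Unary.Unique.Propositional using (Unique)
import Data.List.Relation.Unary.Unique.Propositional.Properties as Uniqueₚ
open import Data.Maybe using (Maybe; just; nothing)
open import Data.Nat as ℕ using (ℕ; zero; suc; NonZero; z≤n; s≤s)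
import Data.Nat.Properties as ℕ
open import Data.Product using (_×_; _,_; proj₁; proj₂; ∃-syntax)
open import Data.Product.Properties using (≡-dec)
open import Data.Rational as ℚ using (ℚ; 0ℚ; 1ℚ)
import Data.Rational.Unnormalised as ℚᵘ
import Data.Rational.Unnormalised.Properties as ℚᵘ
open import Data.Sum using (_⊎_; inj₁; inj₂)
open import Data.Unit using (⊤; tt)
import Data.Vec as Vec
open import Data.Vec using (Vec; []; _∷_; lookup; toList)
open import Data.Vec.Properties using (length-toList; ∷-injectiveˡ; ∷-injectiveʳ)
open import Function using (_∘_)
open import Level using (0ℓ)
open import Relation.Binary.Definitions using (DecidableEquality)
open import Relation.Binary.PropositionalEquality hiding ([_])
open import Relation.Nullary using (Dec; yes; no; ¬_)
open import Relation.Nullary.Decidable using (_×-dec_; ¬?; dec⇒maybe)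
open import Relation.Unary using (Decidable)
import Tactic.RingSolver.Core.AlmostCommutativeRing as ACR

private
  variable
    A B I : Set

-- All counting is done with integer inequalities. With D = n^m q one has r = K / D, so K^t r^(-s)
-- is a product over t edges, with a factor D for each shared atom and K for each other one, and the
-- aim is that its sum over the N pairs, times e, is at most (e + 1) N K^t, where 1/e <= ε.
--
-- The obstacle is that shared atoms may force any number of vertices, up to all n, so falling
-- factorials cannot be replaced by powers with a factor 1 + o(1). The remedy is asymmetric. A
-- forced position may lose a constant factor (4, because N^c is at most 4^c times the falling
-- factorial, for all c up to N): it lies in a shared edge, and a large K absorbs the loss. A free
-- position has to be counted without loss, since there may be n of them.
--
-- The sum over chains is a linear recursion over blocks of m positions, bounded by exhibiting a
-- supersolution `h`. The delicate point is the end of the cycle: a chain still running there wraps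
-- around, and if the first match was near the beginning it can meet its own start before its ℓ
-- overhanging vertices have been charged. Only boundedly many first blocks are affected, and they
-- get a cruder bound.

module Counting where

  open import Data.Nat
  open import Data.Nat.DivMod using (_mod_; m<n⇒m%n≡m; m≡m%n+[m/n]*n; /-monoˡ-≤; %-distribˡ-+; [m+n]%n≡m%n)
  open import Data.Nat.Properties
  open import Data.Nat.Tactic.RingSolver using (solve-∀)

  -- Sums over lists

  ∑ : List A → (A → ℕ) → ℕ
  ∑ []       f = 0
  ∑ (x ∷ xs) f = f x + ∑ xs f

  ∑-cong : ∀ xs {f g : A → ℕ} → (∀ x → f x ≡ g x) → ∑ xs f ≡ ∑ xs g
  ∑-cong []       e = refl
  ∑-cong (x ∷ xs) e = cong₂ _+_ (e x) (∑-cong xs e)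

  ∑-mono-∈ : ∀ xs {f g : A → ℕ} → (∀ x → x ∈ xs → f x ≤ g x) → ∑ xs f ≤ ∑ xs g
  ∑-mono-∈ []       e = z≤n
  ∑-mono-∈ (x ∷ xs) e = +-mono-≤ (e x (here refl)) (∑-mono-∈ xs (λ y → e y ∘ there))

  ∑-mono : ∀ xs {f g : A → ℕ} → (∀ x → f x ≤ g x) → ∑ xs f ≤ ∑ xs g
  ∑-mono xs e = ∑-mono-∈ xs (λ x _ → e x)

  ∑-++ : ∀ xs ys (f : A → ℕ) → ∑ (xs ++ ys) f ≡ ∑ xs f + ∑ ys f
  ∑-++ []       ys f = refl
  ∑-++ (x ∷ xs) ys f = trans (cong (f x +_) (∑-++ xs ys f)) (sym (+-assoc (f x) _ _))

  ∑-map : ∀ (h : A → B) xs (f : B → ℕ) → ∑ (map h xs) f ≡ ∑ xs (f ∘ h)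
  ∑-map h []       f = refl
  ∑-map h (x ∷ xs) f = cong (f (h x) +_) (∑-map h xs f)

  ∑-concatMap : ∀ (h : A → List B) xs (f : B → ℕ) → ∑ (concatMap h xs) f ≡ ∑ xs (λ x → ∑ (h x) f)
  ∑-concatMap h []       f = refl
  ∑-concatMap h (x ∷ xs) f = trans (∑-++ (h x) _ f) (cong (∑ (h x) f +_) (∑-concatMap h xs f))

  ∑-+ : ∀ xs (f g : A → ℕ) → ∑ xs (λ x → f x + g x) ≡ ∑ xs f + ∑ xs g
  ∑-+ []       f g = refl
  ∑-+ (x ∷ xs) f g rewrite ∑-+ xs f g = interchange (f x) (g x) (∑ xs f) (∑ xs g)
    where
    interchange : ∀ a b c d → a + b + (c + d) ≡ a + c + (b + d)
    interchange = solve-∀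

  ∑-*ˡ : ∀ xs c (f : A → ℕ) → ∑ xs (λ x → c * f x) ≡ c * ∑ xs f
  ∑-*ˡ []       c f = sym (*-zeroʳ c)
  ∑-*ˡ (x ∷ xs) c f = trans (cong (c * f x +_) (∑-*ˡ xs c f)) (sym (*-distribˡ-+ c (f x) _))

  ∑-*ʳ : ∀ xs c (f : A → ℕ) → ∑ xs (λ x → f x * c) ≡ ∑ xs f * c
  ∑-*ʳ []       c f = refl
  ∑-*ʳ (x ∷ xs) c f = trans (cong (f x * c +_) (∑-*ʳ xs c f)) (sym (*-distribʳ-+ c (f x) _))

  ∑-const : ∀ (xs : List A) c → ∑ xs (λ _ → c) ≡ length xs * c
  ∑-const []       c = refl
  ∑-const (x ∷ xs) c = cong (c +_) (∑-const xs c)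

  ∑-0 : ∀ (xs : List A) → ∑ xs (λ _ → 0) ≡ 0
  ∑-0 xs = trans (∑-const xs 0) (*-zeroʳ (length xs))

  ∑-swap : ∀ (xs : List A) (ys : List B) (f : A → B → ℕ) →
           ∑ xs (λ x → ∑ ys (f x)) ≡ ∑ ys (λ y → ∑ xs (λ x → f x y))
  ∑-swap []       ys f = sym (∑-0 ys)
  ∑-swap (x ∷ xs) ys f = trans (cong (∑ ys (f x) +_) (∑-swap xs ys f)) (sym (∑-+ ys (f x) _))

  ∑-≤-length : ∀ (xs : List A) {f : A → ℕ} {c} → (∀ x → f x ≤ c) → ∑ xs f ≤ length xs * c
  ∑-≤-length xs {c = c} e = ≤-trans (∑-mono xs e) (≤-reflexive (∑-const xs c))

  𝟙 : ∀ {p} {P : Set p} → Dec P → ℕ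
  𝟙 (yes _) = 1
  𝟙 (no _)  = 0

  𝟙-≤ : ∀ {p} {P : Set p} (P? : Dec P) {c} → (P → 1 ≤ c) → 𝟙 P? ≤ c
  𝟙-≤ (yes p) h = h p
  𝟙-≤ (no _)  h = z≤n

  𝟙-yes : ∀ {p} {P : Set p} (P? : Dec P) → P → 𝟙 P? ≡ 1
  𝟙-yes (yes _) p = refl
  𝟙-yes (no ¬p) p = ⊥-elim (¬p p)

  𝟙-×-dec : ∀ {p q} {P : Set p} {Q : Set q} (P? : Dec P) (Q? : Dec Q) → 𝟙 (P? ×-dec Q?) ≡ 𝟙 P? * 𝟙 Q?
  𝟙-×-dec (yes _) (yes _) = refl
  𝟙-×-dec (yes _) (no _)  = refl
  𝟙-×-dec (no _)  _       = refl

  ∑-∈-≤ : ∀ {xs} {x : A} (f : A → ℕ) → x ∈ xs → f x ≤ ∑ xs f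
  ∑-∈-≤ f (here refl) = m≤m+n _ _
  ∑-∈-≤ f (there p)   = ≤-trans (∑-∈-≤ f p) (m≤n+m _ _)

  ∑-allFin-𝟙 : ∀ {n} {P : Fin n → Set} (P? : Decidable P) →
               (∀ i j → P i → P j → i ≡ j) → ∑ (allFin n) (λ i → 𝟙 (P? i)) ≤ 1
  ∑-allFin-𝟙 {zero}  P? uniq = z≤n
  ∑-allFin-𝟙 {suc n} P? uniq with P? zero
  ... | yes p0 = ≤-reflexive (cong suc (trans (cong (λ xs → ∑ xs (λ i → 𝟙 (P? i))) (sym (map-tabulate (λ i → i) suc)))
                   (trans (∑-map suc (allFin n) _) (trans (∑-cong (allFin n) none) (∑-0 (allFin n))))))
    where
    none : ∀ i → 𝟙 (P? (suc i)) ≡ 0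
    none i with P? (suc i)
    ... | yes p with () ← uniq zero (suc i) p0 p
    ... | no _ = refl
  ... | no _ = ≤-trans (≤-reflexive (trans (cong (λ xs → ∑ xs (λ i → 𝟙 (P? i))) (sym (map-tabulate (λ i → i) suc)))
                   (∑-map suc (allFin n) _)))
                 (∑-allFin-𝟙 (P? ∘ suc) (λ i j p q → Fin.suc-injective (uniq (suc i) (suc j) p q)))

  -- Injective sequences

  picks : List A → List (A × List A)
  picks []       = []
  picks (x ∷ xs) = (x , xs) ∷ map (λ (y , ys) → (y , x ∷ ys)) (picks xs)

  length-picks : ∀ (V : List A) → length (picks V) ≡ length V
  length-picks []       = refl
  length-picks (x ∷ xs) = cong suc (trans (length-map _ (picks xs)) (length-picks xs))

  arrangements : (l : ℕ) → List A → List (Vec A l)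
  arrangements zero    V = [] ∷ []
  arrangements (suc l) V = concatMap (λ (v , V′) → map (v ∷_) (arrangements l V′)) (picks V)

  ∑-arrangements : ∀ l (V : List A) (f : Vec A (suc l) → ℕ) →
    ∑ (arrangements (suc l) V) f ≡ ∑ (picks V) (λ (v , V′) → ∑ (arrangements l V′) (f ∘ (v ∷_)))
  ∑-arrangements l V f =
    trans (∑-concatMap _ (picks V) f) (∑-cong (picks V) (λ (v , V′) → ∑-map (v ∷_) (arrangements l V′) f))

  ∑-picks-map : ∀ (x : A) xs (f : A × List A → ℕ) →
    ∑ (picks (x ∷ xs)) f ≡ f (x , xs) + ∑ (picks xs) (λ (y , ys) → f (y , x ∷ ys))
  ∑-picks-map x xs f = cong (f (x , xs) +_) (∑-map _ (picks xs) f)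

  ∑-picks : ∀ (V : List A) (g : A → ℕ) → ∑ (picks V) (g ∘ proj₁) ≡ ∑ V g
  ∑-picks []       g = refl
  ∑-picks (x ∷ xs) g = trans (∑-picks-map x xs (g ∘ proj₁)) (cong (g x +_) (∑-picks xs g))

  picks-length : ∀ (V : List A) {v V′} → (v , V′) ∈ picks V → length V ≡ suc (length V′)
  picks-length (x ∷ xs) (here refl) = refl
  picks-length (x ∷ xs) (there p) = go (picks xs) (λ q → picks-length xs q) p
    where
    go : ∀ ps {v V′} → (∀ {w W} → (w , W) ∈ ps → length xs ≡ suc (length W)) →
         (v , V′) ∈ map (λ (y , ys) → (y , x ∷ ys)) ps → suc (length xs) ≡ suc (length V′)
    go (_ ∷ ps) h (here refl) = cong suc (h (here refl))
    go (_ ∷ ps) h (there p)   = go ps (h ∘ there) p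

  picks-∑-≤ : ∀ (V : List A) (g : A → ℕ) {v V′} → (v , V′) ∈ picks V → ∑ V′ g ≤ ∑ V g
  picks-∑-≤ (x ∷ xs) g (here refl) = m≤n+m _ _
  picks-∑-≤ (x ∷ xs) g (there p) = go (picks xs) (λ q → picks-∑-≤ xs g q) p
    where
    go : ∀ ps {v V′} → (∀ {w W} → (w , W) ∈ ps → ∑ W g ≤ ∑ xs g) →
         (v , V′) ∈ map (λ (y , ys) → (y , x ∷ ys)) ps → ∑ V′ g ≤ g x + ∑ xs g
    go (_ ∷ ps) h (here refl) = +-monoʳ-≤ (g x) (h (here refl))
    go (_ ∷ ps) h (there p)   = go ps (h ∘ there) p

  -- Drawing two entries in either order leaves the same remainder, because `picks` keeps the
  -- remaining entries in their original order; so `f` may depend on that remainder.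
  ∑-picks-swap : ∀ (V : List A) (f : A → A → List A → ℕ) →
    ∑ (picks V) (λ (v , V′) → ∑ (picks V′) (λ (w , W) → f v w W)) ≡
    ∑ (picks V) (λ (v , V′) → ∑ (picks V′) (λ (w , W) → f w v W))
  ∑-picks-swap []       f = refl
  ∑-picks-swap {A} (x ∷ xs) f = trans (expand f) (trans step (sym (expand (λ v w → f w v))))
    where
    P = picks xs
    fst : (A → A → List A → ℕ) → ℕ
    fst h = ∑ P (λ (w , W) → h x w W)
    snd : (A → A → List A → ℕ) → ℕ
    snd h = ∑ P (λ (v , V′) → h v x V′)
    both : (A → A → List A → ℕ) → ℕ
    both h = ∑ P (λ (v , V′) → ∑ (picks V′) (λ (w , W) → h v w (x ∷ W)))
    expand : ∀ (h : A → A → List A → ℕ) →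
      ∑ (picks (x ∷ xs)) (λ (v , V′) → ∑ (picks V′) (λ (w , W) → h v w W)) ≡ fst h + (snd h + both h)
    expand h = trans (∑-picks-map x xs _) (cong (fst h +_)
      (trans (∑-cong P (λ (v , V′) → ∑-picks-map x V′ (λ (w , W) → h v w W))) (∑-+ P _ _)))
    step : fst f + (snd f + both f) ≡ snd f + (fst f + both (λ v w → f w v))
    step rewrite ∑-picks-swap xs (λ v w W → f v w (x ∷ W)) = comm (fst f) (snd f) _
      where
      comm : ∀ a b c → a + (b + c) ≡ b + (a + c)
      comm = solve-∀

  *-^ : ∀ a b c → (a * b) ^ c ≡ a ^ c * b ^ c
  *-^ a b zero    = refl
  *-^ a b (suc c) = trans (cong (a * b *_) (*-^ a b c)) (shuffle a b (a ^ c) (b ^ c))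
    where
    shuffle : ∀ a b c d → a * b * (c * d) ≡ a * c * (b * d)
    shuffle = solve-∀

  -- The falling factorial N (N - 1) ... (N - l + 1). Truncated subtraction makes it 0 once l
  -- exceeds N.
  fall : ℕ → ℕ → ℕ
  fall N zero    = 1
  fall N (suc l) = N * fall (N ∸ 1) l

  length-arrangements : ∀ l (V : List A) → length (arrangements l V) ≡ fall (length V) l
  length-arrangements l V = trans (sym (trans (∑-const (arrangements l V) 1) (*-identityʳ _))) (count l V)
    where
    count : ∀ l (V : List A) → ∑ (arrangements l V) (λ _ → 1) ≡ fall (length V) l
    count zero    V = refl
    count (suc l) V = trans (∑-arrangements l V _) (trans (eqs (picks V) (λ p → picks-length V p))
        (trans (∑-const (picks V) (fall (length V ∸ 1) l)) (cong (_* fall (length V ∸ 1) l) (length-picks V))))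
      where
      eqs : ∀ ps → (∀ {v V′} → (v , V′) ∈ ps → length V ≡ suc (length V′)) →
            ∑ ps (λ (v , V′) → ∑ (arrangements l V′) (λ _ → 1)) ≡ ∑ ps (λ _ → fall (length V ∸ 1) l)
      eqs []              h = refl
      eqs ((v , V′) ∷ ps) h = cong₂ _+_
        (trans (count l V′) (cong (λ z → fall (z ∸ 1) l) (sym (h (here refl)))))
        (eqs ps (h ∘ there))

  fall-split : ∀ N c j → fall N (c + j) ≡ fall N c * fall (N ∸ c) j
  fall-split N zero    j = sym (+-identityʳ _)
  fall-split N (suc c) j = trans (cong (N *_) (trans (fall-split (N ∸ 1) c j) (cong (λ z → fall (N ∸ 1) c * fall z j) (∸-+-assoc N 1 c))))
    (sym (*-assoc N _ _))

  fall-∷ʳ : ∀ N j → fall N (suc j) ≡ fall N j * (N ∸ j)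
  fall-∷ʳ N j = trans (cong (fall N) (+-comm 1 j)) (trans (fall-split N j 1) (cong (fall N j *_) (*-identityʳ (N ∸ j))))

  fall-pos : ∀ N l → l ≤ N → 0 < fall N l
  fall-pos N       zero    p       = s≤s z≤n
  fall-pos (suc N) (suc l) (s≤s p) = *-mono-≤ (s≤s (z≤n {N})) (fall-pos N l p)

  -- Bernoulli's inequality (1 + 1/x)^h (1 - h/(x+1)) ≤ 1, cleared of denominators.
  bernoulli-≤ : ∀ x h → suc x ^ h * (suc x ∸ h) ≤ x ^ h * suc x
  bernoulli-≤ x zero    = ≤-refl
  bernoulli-≤ x (suc h) = begin
    suc x * suc x ^ h * (x ∸ h)          ≡⟨ shuffle (suc x) (suc x ^ h) (x ∸ h) ⟩
    suc x ^ h * (suc x * (x ∸ h))        ≤⟨ *-monoʳ-≤ (suc x ^ h) (body (≤-total h x)) ⟩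
    suc x ^ h * ((suc x ∸ h) * x)        ≡⟨ sym (*-assoc (suc x ^ h) _ x) ⟩
    suc x ^ h * (suc x ∸ h) * x          ≤⟨ *-monoˡ-≤ x (bernoulli-≤ x h) ⟩
    x ^ h * suc x * x                    ≡⟨ shuffle′ (x ^ h) (suc x) x ⟩
    x * x ^ h * suc x                    ∎
    where
    open ≤-Reasoning
    open import Data.Sum using (_⊎_; inj₁; inj₂)
    shuffle : ∀ a b c → a * b * c ≡ b * (a * c)
    shuffle = solve-∀
    shuffle′ : ∀ a b c → a * b * c ≡ c * a * b
    shuffle′ = solve-∀
    body : h ≤ x ⊎ x ≤ h → suc x * (x ∸ h) ≤ (suc x ∸ h) * x
    body (inj₁ h≤x) rewrite +-∸-assoc 1 h≤x = ≤-trans (≤-reflexive (*-comm (suc x) (x ∸ h)))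
       (≤-trans (≤-reflexive (*-suc (x ∸ h) x)) (+-monoˡ-≤ ((x ∸ h) * x) (m∸n≤m x h)))
    body (inj₂ x≤h) rewrite m≤n⇒m∸n≡0 x≤h = ≤-trans (≤-reflexive (*-zeroʳ x)) z≤n

  -- In `bernoulli-≤` the factor x + 1 - h is at least half of x + 1.
  suc^≤2*^ : ∀ x h → 2 * h ≤ suc x → suc x ^ h ≤ 2 * x ^ h
  suc^≤2*^ x h p = *-cancelʳ-≤ (suc x ^ h) (2 * x ^ h) (suc x) (begin
    suc x ^ h * suc x              ≤⟨ *-monoʳ-≤ (suc x ^ h) half ⟩
    suc x ^ h * (2 * (suc x ∸ h))  ≡⟨ shuffle (suc x ^ h) (suc x ∸ h) ⟩
    2 * (suc x ^ h * (suc x ∸ h))  ≤⟨ *-monoʳ-≤ 2 (bernoulli-≤ x h) ⟩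
    2 * (x ^ h * suc x)            ≡⟨ sym (*-assoc 2 (x ^ h) (suc x)) ⟩
    2 * x ^ h * suc x              ∎)
    where
    open ≤-Reasoning
    shuffle : ∀ a b → a * (2 * b) ≡ 2 * (a * b)
    shuffle = solve-∀
    half : suc x ≤ 2 * (suc x ∸ h)
    half = begin
      suc x                       ≡⟨ sym (m+n∸n≡m (suc x) (suc x)) ⟩
      suc x + suc x ∸ suc x       ≡⟨ cong (λ z → suc x + z ∸ suc x) (sym (+-identityʳ (suc x))) ⟩
      2 * suc x ∸ suc x           ≤⟨ ∸-monoʳ-≤ (2 * suc x) p ⟩
      2 * suc x ∸ 2 * h           ≡⟨ sym (*-distribˡ-∸ 2 (suc x) h) ⟩
      2 * (suc x ∸ h)             ∎

  -- An elementary substitute for (1 + 1/x)^x < e: each half of the exponent costs a factor 2.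
  suc^≤4*^ : ∀ x h → h ≤ x → suc x ^ h ≤ 4 * x ^ h
  suc^≤4*^ x h p = begin
    suc x ^ h                             ≡⟨ cong (suc x ^_) (sym (⌊n/2⌋+⌈n/2⌉≡n h)) ⟩
    suc x ^ (⌊ h /2⌋ + ⌈ h /2⌉)           ≡⟨ ^-distribˡ-+-* (suc x) ⌊ h /2⌋ ⌈ h /2⌉ ⟩
    suc x ^ ⌊ h /2⌋ * suc x ^ ⌈ h /2⌉     ≤⟨ *-mono-≤ (suc^≤2*^ x ⌊ h /2⌋ (≤-trans (*-monoʳ-≤ 2 (⌊n/2⌋≤⌈n/2⌉ h)) twice))
                                                      (suc^≤2*^ x ⌈ h /2⌉ twice) ⟩
    2 * x ^ ⌊ h /2⌋ * (2 * x ^ ⌈ h /2⌉)   ≡⟨ shuffle (x ^ ⌊ h /2⌋) (x ^ ⌈ h /2⌉) ⟩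
    4 * (x ^ ⌊ h /2⌋ * x ^ ⌈ h /2⌉)       ≡⟨ cong (4 *_) (sym (^-distribˡ-+-* x ⌊ h /2⌋ ⌈ h /2⌉)) ⟩
    4 * x ^ (⌊ h /2⌋ + ⌈ h /2⌉)           ≡⟨ cong (λ z → 4 * x ^ z) (⌊n/2⌋+⌈n/2⌉≡n h) ⟩
    4 * x ^ h                             ∎
    where
    open ≤-Reasoning
    shuffle : ∀ a b → 2 * a * (2 * b) ≡ 4 * (a * b)
    shuffle = solve-∀
    twice : 2 * ⌈ h /2⌉ ≤ suc x
    twice = begin
      2 * ⌊ suc h /2⌋                       ≡⟨ cong (⌊ suc h /2⌋ +_) (+-identityʳ _) ⟩
      ⌊ suc h /2⌋ + ⌊ suc h /2⌋             ≤⟨ +-monoʳ-≤ ⌊ suc h /2⌋ (⌊n/2⌋≤⌈n/2⌉ (suc h)) ⟩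
      ⌊ suc h /2⌋ + ⌈ suc h /2⌉             ≡⟨ ⌊n/2⌋+⌈n/2⌉≡n (suc h) ⟩
      suc h                                 ≤⟨ s≤s p ⟩
      suc x                                 ∎

  -- The quotient of the two sides changes by (1 + 1/N)^c when N and c grow by one, and this is at
  -- most 4. The bound is uniform up to c = N, the case in which every vertex is forced.
  ^≤4^*fall : ∀ N c → c ≤ N → N ^ c ≤ 4 ^ c * fall N c
  ^≤4^*fall N       zero    p       = ≤-refl
  ^≤4^*fall (suc N) (suc c) (s≤s p) = begin
    suc N * suc N ^ c                   ≤⟨ *-monoʳ-≤ (suc N) (suc^≤4*^ N c p) ⟩
    suc N * (4 * N ^ c)                 ≤⟨ *-monoʳ-≤ (suc N) (*-monoʳ-≤ 4 (^≤4^*fall N c p)) ⟩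
    suc N * (4 * (4 ^ c * fall N c))    ≡⟨ shuffle (suc N) (4 ^ c) (fall N c) ⟩
    4 * 4 ^ c * (suc N * fall N c)      ∎
    where
    open ≤-Reasoning
    shuffle : ∀ a b c → a * (4 * (b * c)) ≡ 4 * b * (a * c)
    shuffle = solve-∀

  -- Permanents

  count-just : List (Maybe I) → ℕ
  count-just []            = 0
  count-just (nothing ∷ x) = count-just x
  count-just (just _ ∷ x)  = suc (count-just x)

  count-nothing : List (Maybe I) → ℕ
  count-nothing []            = 0
  count-nothing (nothing ∷ x) = suc (count-nothing x)
  count-nothing (just _ ∷ x)  = count-nothing x

  count-length : ∀ (x : List (Maybe I)) → count-just x + count-nothing x ≡ length x
  count-length []            = refl
  count-length (nothing ∷ x) = trans (+-suc (count-just x) _) (cong suc (count-length x))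
  count-length (just _ ∷ x)  = cong suc (count-length x)

  -- The factor 4 pays for replacing falling factorials by powers.
  price : ℕ → ℕ → List (Maybe I) → ℕ
  price N a []            = 1
  price N a (nothing ∷ x) = N * price N a x
  price N a (just _ ∷ x)  = 4 * a * price N a x

  price-count : ∀ N a (x : List (Maybe I)) → price N a x ≡ (4 * a) ^ count-just x * N ^ count-nothing x
  price-count N a []            = refl
  price-count N a (nothing ∷ x) = trans (cong (N *_) (price-count N a x)) (shuffle N ((4 * a) ^ count-just x) _)
    where
    shuffle : ∀ a b c → a * (b * c) ≡ b * (a * c)
    shuffle = solve-∀
  price-count N a (just _ ∷ x)  = trans (cong (4 * a *_) (price-count N a x)) (sym (*-assoc (4 * a) _ _))

  module Permanent {R : I → A → Set} (R? : ∀ i a → Dec (R i a)) where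

    hit : Maybe I → A → ℕ
    hit nothing  a = 1
    hit (just i) a = 𝟙 (R? i a)

    weight : ∀ {l} → List (Maybe I) → Vec A l → ℕ
    weight []      _        = 1
    weight (_ ∷ _) []       = 1
    weight (g ∷ x) (v ∷ vs) = hit g v * weight x vs

    Sat : (ℕ → A) → List (Maybe I) → Set
    Sat f []            = ⊤
    Sat f (nothing ∷ x) = Sat (f ∘ suc) x
    Sat f (just i ∷ x)  = R i (f 0) × Sat (f ∘ suc) x

    sat? : ∀ f x → Dec (Sat f x)
    sat? f []            = yes tt
    sat? f (nothing ∷ x) = sat? (f ∘ suc) x
    sat? f (just i ∷ x)  = R? i (f 0) ×-dec sat? (f ∘ suc) x

    Sat-++ : ∀ f x y → Sat f x → Sat (f ∘ (length x +_)) y → Sat f (x ++ y)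
    Sat-++ f []            y p       q = q
    Sat-++ f (nothing ∷ x) y p       q = Sat-++ (f ∘ suc) x y p q
    Sat-++ f (just i ∷ x)  y (r , p) q = r , Sat-++ (f ∘ suc) x y p q

    Sat-cong : ∀ {f g} x → (∀ a → f a ≡ g a) → Sat f x → Sat g x
    Sat-cong []            e p       = p
    Sat-cong (nothing ∷ x) e p       = Sat-cong x (e ∘ suc) p
    Sat-cong (just i ∷ x)  e (r , p) = subst (R i) (e 0) r , Sat-cong x (e ∘ suc) p

    Sat⇒weight : ∀ {l} f x (vs : Vec A l) → (∀ i → f (toℕ i) ≡ lookup vs i) → Sat f x → weight x vs ≡ 1
    Sat⇒weight f []            vs       e p = refl
    Sat⇒weight f (_ ∷ x)       []       e p = refl
    Sat⇒weight f (nothing ∷ x) (v ∷ vs) e p =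
      trans (+-identityʳ _) (Sat⇒weight (f ∘ suc) x vs (e ∘ suc) p)
    Sat⇒weight f (just i ∷ x)  (v ∷ vs) e (r , p) =
      cong₂ _*_ (𝟙-yes (R? i v) (subst (R i) (e zero) r)) (Sat⇒weight (f ∘ suc) x vs (e ∘ suc) p)

    -- The permanent of a rectangular 0-1 matrix with columns `V`: the row of `just i` is the
    -- indicator of `R i`, and the row of `nothing` consists of ones.
    perm : List (Maybe I) → List A → ℕ
    perm x V = ∑ (arrangements (length x) V) (weight x)

    perm-∷ : ∀ g x V → perm (g ∷ x) V ≡ ∑ (picks V) (λ (v , V′) → hit g v * perm x V′)
    perm-∷ g x V = trans (∑-arrangements (length x) V _)
      (∑-cong (picks V) (λ (v , V′) → ∑-*ˡ (arrangements (length x) V′) (hit g v) (weight x)))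

    -- A free row can be filled last, when |V| - |x| entries remain. As arrangements are built from
    -- the left, the free row is moved past one row at a time with `∑-picks-swap`. Being an
    -- equality, this is what lets free positions be counted without loss.
    perm-nothing : ∀ x V → perm (nothing ∷ x) V ≡ perm x V * (length V ∸ length x)
    perm-nothing []      V = trans (perm-∷ nothing [] V)
      (trans (∑-const (picks V) 1) (trans (*-identityʳ _) (trans (length-picks V) (sym (+-identityʳ _)))))
    perm-nothing (g ∷ x) V = begin
      perm (nothing ∷ g ∷ x) V
        ≡⟨ perm-∷ nothing (g ∷ x) V ⟩
      ∑ (picks V) (λ (v , V′) → 1 * perm (g ∷ x) V′)
        ≡⟨ ∑-cong (picks V) (λ (v , V′) → trans (*-identityˡ _) (perm-∷ g x V′)) ⟩
      ∑ (picks V) (λ (v , V′) → ∑ (picks V′) (λ (w , W) → hit g w * perm x W))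
        ≡⟨ ∑-picks-swap V (λ v w W → hit g w * perm x W) ⟩
      ∑ (picks V) (λ (v , V′) → ∑ (picks V′) (λ (w , W) → hit g v * perm x W))
        ≡⟨ ∑-cong (picks V) (λ (v , V′) → ∑-*ˡ (picks V′) (hit g v) _) ⟩
      ∑ (picks V) (λ (v , V′) → hit g v * ∑ (picks V′) (λ (w , W) → perm x W))
        ≡⟨ ∑-cong (picks V) (λ (v , V′) → cong (hit g v *_) (trans
             (∑-cong (picks V′) (λ (w , W) → sym (*-identityˡ (perm x W)))) (trans (sym (perm-∷ nothing x V′)) (perm-nothing x V′)))) ⟩
      ∑ (picks V) (λ (v , V′) → hit g v * (perm x V′ * (length V′ ∸ length x)))
        ≡⟨ lengths (picks V) (picks-length V) ⟩
      ∑ (picks V) (λ (v , V′) → hit g v * perm x V′ * (length V ∸ suc (length x)))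
        ≡⟨ ∑-*ʳ (picks V) (length V ∸ suc (length x)) (λ (v , V′) → hit g v * perm x V′) ⟩
      ∑ (picks V) (λ (v , V′) → hit g v * perm x V′) * (length V ∸ suc (length x))
        ≡⟨ cong (_* (length V ∸ suc (length x))) (sym (perm-∷ g x V)) ⟩
      perm (g ∷ x) V * (length V ∸ suc (length x)) ∎
      where
      open ≡-Reasoning
      lengths : ∀ ps → (∀ {v V′} → (v , V′) ∈ ps → length V ≡ suc (length V′)) →
        ∑ ps (λ (v , V′) → hit g v * (perm x V′ * (length V′ ∸ length x))) ≡
        ∑ ps (λ (v , V′) → hit g v * perm x V′ * (length V ∸ suc (length x)))
      lengths []              h = refl
      lengths ((v , V′) ∷ ps) h = cong₂ _+_
        (trans (sym (*-assoc (hit g v) _ _)) (cong (λ z → hit g v * perm x V′ * (z ∸ suc (length x))) (sym (h (here refl)))))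
        (lengths ps (h ∘ there))

    -- Unconstrained positions can be filled last, whatever their place.
    perm-≤ : ∀ a x V → (∀ i → ∑ V (λ v → 𝟙 (R? i v)) ≤ a) →
             perm x V ≤ a ^ count-just x * fall (length V ∸ count-just x) (count-nothing x)
    perm-≤ a []            V h = ≤-refl
    perm-≤ a (nothing ∷ x) V h = begin
      perm (nothing ∷ x) V                    ≡⟨ perm-nothing x V ⟩
      perm x V * (N ∸ length x)               ≤⟨ *-monoˡ-≤ (N ∸ length x) (perm-≤ a x V h) ⟩
      a ^ c * fall (N ∸ c) u * (N ∸ length x) ≡⟨ *-assoc (a ^ c) _ _ ⟩
      a ^ c * (fall (N ∸ c) u * (N ∸ length x))
        ≡⟨ cong (λ z → a ^ c * (fall (N ∸ c) u * z)) (trans (cong (N ∸_) (sym (count-length x))) (sym (∸-+-assoc N c u))) ⟩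
      a ^ c * (fall (N ∸ c) u * (N ∸ c ∸ u))  ≡⟨ cong (a ^ c *_) (sym (fall-∷ʳ (N ∸ c) u)) ⟩
      a ^ c * fall (N ∸ c) (suc u)            ∎
      where
      open ≤-Reasoning
      N = length V
      c = count-just x
      u = count-nothing x
    perm-≤ a (just i ∷ x)  V h = begin
      perm (just i ∷ x) V
        ≡⟨ perm-∷ (just i) x V ⟩
      ∑ (picks V) (λ (v , V′) → 𝟙 (R? i v) * perm x V′)
        ≤⟨ ∑-mono-∈ (picks V) (λ (v , V′) p → *-monoʳ-≤ (𝟙 (R? i v))
             (≤-trans (perm-≤ a x V′ (λ j → ≤-trans (picks-∑-≤ V _ p) (h j)))
                      (≤-reflexive (cong (λ z → a ^ c * fall z u)
                        (trans (sym (cong (_∸ suc c) (picks-length V p))) refl))))) ⟩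
      ∑ (picks V) (λ (v , V′) → 𝟙 (R? i v) * (a ^ c * fall (N ∸ suc c) u))
        ≡⟨ ∑-*ʳ (picks V) (a ^ c * fall (N ∸ suc c) u) (λ (v , V′) → 𝟙 (R? i v)) ⟩
      ∑ (picks V) (λ (v , V′) → 𝟙 (R? i v)) * (a ^ c * fall (N ∸ suc c) u)
        ≡⟨ cong (_* (a ^ c * fall (N ∸ suc c) u)) (∑-picks V (λ v → 𝟙 (R? i v))) ⟩
      ∑ V (λ v → 𝟙 (R? i v)) * (a ^ c * fall (N ∸ suc c) u)
        ≤⟨ *-monoˡ-≤ (a ^ c * fall (N ∸ suc c) u) (h i) ⟩
      a * (a ^ c * fall (N ∸ suc c) u)
        ≡⟨ sym (*-assoc a (a ^ c) _) ⟩
      a * a ^ c * fall (N ∸ suc c) u ∎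
      where
      open ≤-Reasoning
      N = length V
      c = count-just x
      u = count-nothing x

    -- After division by the number of arrangements and by N^|x|, N = |V|, this says that a random
    -- arrangement meets a pattern with c constrained rows with probability at most (4a/N)^c.
    perm-price : ∀ a x V → (∀ i → ∑ V (λ v → 𝟙 (R? i v)) ≤ a) → length x ≤ length V →
      perm x V * length V ^ length x ≤ length (arrangements (length x) V) * price (length V) a x
    perm-price a x V h l = begin
      perm x V * N ^ length x
        ≤⟨ *-mono-≤ (perm-≤ a x V h) (≤-reflexive (trans (cong (N ^_) (sym (count-length x))) (^-distribˡ-+-* N c u))) ⟩
      a ^ c * fall (N ∸ c) u * (N ^ c * N ^ u)
        ≤⟨ *-monoʳ-≤ (a ^ c * fall (N ∸ c) u) (*-monoˡ-≤ (N ^ u) (^≤4^*fall N c (≤-trans (m≤m+n c u) (≤-trans (≤-reflexive (count-length x)) l)))) ⟩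
      a ^ c * fall (N ∸ c) u * (4 ^ c * fall N c * N ^ u)
        ≡⟨ shuffle (a ^ c) (fall (N ∸ c) u) (4 ^ c) (fall N c) (N ^ u) ⟩
      fall N c * fall (N ∸ c) u * (4 ^ c * a ^ c * N ^ u)
        ≡⟨ cong₂ _*_ (trans (sym (fall-split N c u)) (trans (cong (fall N) (count-length x)) (sym (length-arrangements (length x) V))))
                     (trans (cong (_* N ^ u) (sym (*-^ 4 a c))) (sym (price-count N a x))) ⟩
      length (arrangements (length x) V) * price N a x ∎
      where
      open ≤-Reasoning
      N = length V
      c = count-just x
      u = count-nothing x
      shuffle : ∀ p q r s w → p * q * (r * s * w) ≡ s * q * (r * p * w)
      shuffle = solve-∀

  -- The transfer recursion for chains of shared edges

  module Transfer (n κ K m ℓ t β Δ : ℕ) where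

    -- The weight of c consecutive positions, the first o of which lie in a matched edge.
    ω : ℕ → ℕ → ℕ
    ω o       zero    = 1
    ω zero    (suc c) = n * ω zero c
    ω (suc o) (suc c) = κ * ω o c

    ω-0 : ∀ c → ω 0 c ≡ n ^ c
    ω-0 zero    = refl
    ω-0 (suc c) = cong (n *_) (ω-0 c)

    ω-+ : ∀ o a b → ω o (a + b) ≡ ω o a * ω (o ∸ a) b
    ω-+ o       zero    b = sym (+-identityʳ _)
    ω-+ zero    (suc a) b = trans (cong (n *_) (trans (ω-+ zero a b) (cong (λ z → ω 0 a * ω z b) (0∸n≡0 a)))) (sym (*-assoc n _ _))
    ω-+ (suc o) (suc a) b = trans (cong (κ *_) (ω-+ o a b)) (sym (*-assoc κ _ _))

    ω-full : ∀ c → ω c c ≡ κ ^ c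
    ω-full zero    = refl
    ω-full (suc c) = cong (κ *_) (ω-full c)

    ω-extend : ∀ o a b → o ≤ a → ω o (a + b) ≡ ω o a * n ^ b
    ω-extend o a b o≤a = trans (ω-+ o a b) (cong (ω o a *_) (trans (cong (λ z → ω z b) (m≤n⇒m∸n≡0 o≤a)) (ω-0 b)))

    -- Both sides weigh m + ℓ positions of which the first o are forced. Thus the window weight
    -- `ω o ℓ` is an eigenfunction of the step over an unmatched block, with eigenvalue n^m.
    ω-shift : ∀ o → o ≤ ℓ → ω o m * ω (o ∸ m) ℓ ≡ n ^ m * ω o ℓ
    ω-shift o o≤ℓ = trans (sym (ω-+ o m ℓ)) (trans (cong (ω o) (+-comm m ℓ)) (trans (ω-extend o ℓ m o≤ℓ) (*-comm (ω o ℓ) _)))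

    -- The supersolution for `G`. The window weight alone would be reproduced exactly by unmatched
    -- blocks; the factor o + 1 adds the slack needed for further matches of a running chain. Going
    -- from `h 0` = n^ℓ to the constant `h ℓ` is what a new chain pays.
    h : ℕ → ℕ
    h o = suc o * ω o ℓ

    -- The weight of all continuations over r blocks of m positions, when the last matched
    -- edge extends over the next o positions; g is the weight of the state at the end.
    -- A new chain can be matched anywhere (t ways), a running one continues in at most Δ ways.
    G : (ℕ → ℕ) → ℕ → ℕ → ℕ
    G g zero    o       = g o
    G g (suc r) zero    = K * n ^ m * G g r 0 + t * (β * G g r ℓ)
    G g (suc r) (suc o) = K * ω (suc o) m * G g r (suc o ∸ m) + Δ * (β * G g r ℓ)

    -- Split by the block b of the first matched edge; the last chain may wrap around
    -- and cover positions before block b.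
    total : ℕ → ℕ → ℕ
    total b zero    = K ^ b * n ^ (b * m)
    total b (suc r) = K ^ b * (t * (β * G (λ o → ω o (b * m)) r ℓ)) + total (suc b) r

    U : ℕ
    U = K * n ^ m

    U^ : ∀ b → U ^ b ≡ K ^ b * n ^ (b * m)
    U^ b = trans (*-^ K (n ^ m) b) (cong (K ^ b *_) (trans (^-*-assoc n m b) (cong (n ^_) (*-comm m b))))

    module _ (κ≤n : κ ≤ n) where

      ω-≤ : ∀ o c → ω o c ≤ n ^ c
      ω-≤ o       zero    = ≤-refl
      ω-≤ zero    (suc c) = *-monoʳ-≤ n (ω-≤ zero c)
      ω-≤ (suc o) (suc c) = *-mono-≤ κ≤n (ω-≤ o c)

      ω-≥ : ∀ o c → κ ^ c ≤ ω o c
      ω-≥ o       zero    = ≤-refl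
      ω-≥ zero    (suc c) = *-mono-≤ κ≤n (ω-≥ zero c)
      ω-≥ (suc o) (suc c) = *-monoʳ-≤ κ (ω-≥ o c)

      -- `Λ` is the growth per block allowed overall, slightly above the rate `U` of an unmatched
      -- block outside chains. `V` bounds the total weight of a block entered while a chain is
      -- running, over all ways to proceed.
      module Bounds
        (Λ V : ℕ) (1≤m : 1 ≤ m)
        (Δβ≤U : Δ * (β * suc ℓ) ≤ U)
        (U≤Λ : U ≤ Λ)
        (idle : U * n ^ ℓ + t * (β * h ℓ) ≤ Λ * n ^ ℓ)
        (β+V≤U : β + V ≤ U)
        (active : ∀ o → K * ω (suc o) m + Δ * β ≤ V)
        where
        open ≤-Reasoning

        h0 : h 0 ≡ n ^ ℓ
        h0 = trans (+-identityʳ _) (ω-0 ℓ)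

        -- h decays by one unit of its linear factor per step, which absorbs the Δ possible continuations.
        h-step : ∀ o → suc o ≤ ℓ → K * ω (suc o) m * h (suc o ∸ m) + Δ * (β * h ℓ) ≤ Λ * h (suc o)
        h-step o o<ℓ = begin
          K * ω (suc o) m * h (suc o ∸ m) + Δ * (β * h ℓ)
            ≡⟨ cong₂ _+_ (s₁ K (ω (suc o) m) (suc (suc o ∸ m)) (ω (suc o ∸ m) ℓ)) (s₂ Δ β (suc ℓ) (ω ℓ ℓ)) ⟩
          K * (ω (suc o) m * ω (suc o ∸ m) ℓ) * suc (suc o ∸ m) + Δ * (β * suc ℓ) * ω ℓ ℓ
            ≤⟨ +-mono-≤ (*-mono-≤ (≤-reflexive (cong (K *_) (ω-shift (suc o) o<ℓ))) (drop m 1≤m))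
                        (*-mono-≤ Δβ≤U (≤-trans (≤-reflexive (ω-full ℓ)) (ω-≥ (suc o) ℓ))) ⟩
          K * (n ^ m * ω (suc o) ℓ) * suc o + U * ω (suc o) ℓ
            ≡⟨ s₃ K (n ^ m) (ω (suc o) ℓ) (suc o) ⟩
          U * h (suc o)
            ≤⟨ *-monoˡ-≤ (h (suc o)) U≤Λ ⟩
          Λ * h (suc o) ∎
          where
          s₁ : ∀ a b c d → a * b * (c * d) ≡ a * (b * d) * c
          s₁ = solve-∀
          s₂ : ∀ a b c d → a * (b * (c * d)) ≡ a * (b * c) * d
          s₂ = solve-∀
          s₃ : ∀ a b c d → a * (b * c) * d + a * b * c ≡ a * b * ((1 + d) * c)
          s₃ = solve-∀
          drop : ∀ m → 1 ≤ m → suc (suc o ∸ m) ≤ suc o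
          drop (suc m) _ = s≤s (m∸n≤m o m)

        -- `h` is a supersolution with rate `Λ`: `idle` is the required inequality in state 0 and
        -- `h-step` that in the other states. The condition on `g` says that a chain still running
        -- at the end has its overhang charged.
        G-≤-h : ∀ g c → (∀ o → o ≤ ℓ → n ^ ℓ * g o ≤ c * h o) →
                ∀ r o → o ≤ ℓ → n ^ ℓ * G g r o ≤ c * (Λ ^ r * h o)
        G-≤-h g c hg zero    o       o≤ℓ = ≤-trans (hg o o≤ℓ) (≤-reflexive (cong (c *_) (sym (+-identityʳ (h o)))))
        G-≤-h g c hg (suc r) zero    o≤ℓ = begin
          n ^ ℓ * (U * G g r 0 + t * (β * G g r ℓ))
            ≡⟨ s₁ (n ^ ℓ) U (G g r 0) t β (G g r ℓ) ⟩
          U * (n ^ ℓ * G g r 0) + t * (β * (n ^ ℓ * G g r ℓ))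
            ≤⟨ +-mono-≤ (*-monoʳ-≤ U (G-≤-h g c hg r 0 z≤n))
                        (*-monoʳ-≤ t (*-monoʳ-≤ β (G-≤-h g c hg r ℓ ≤-refl))) ⟩
          U * (c * (Λ ^ r * h 0)) + t * (β * (c * (Λ ^ r * h ℓ)))
            ≡⟨ s₂ U c (Λ ^ r) (h 0) t β (h ℓ) ⟩
          c * (Λ ^ r * (U * h 0 + t * (β * h ℓ)))
            ≤⟨ *-monoʳ-≤ c (*-monoʳ-≤ (Λ ^ r) (subst (λ z → U * z + t * (β * h ℓ) ≤ Λ * z) (sym h0) idle)) ⟩
          c * (Λ ^ r * (Λ * h 0))
            ≡⟨ s₃ c (Λ ^ r) Λ (h 0) ⟩
          c * (Λ * Λ ^ r * h 0) ∎
          where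
          s₁ : ∀ a b x t y z → a * (b * x + t * (y * z)) ≡ b * (a * x) + t * (y * (a * z))
          s₁ = solve-∀
          s₂ : ∀ u c l x t b y → u * (c * (l * x)) + t * (b * (c * (l * y))) ≡ c * (l * (u * x + t * (b * y)))
          s₂ = solve-∀
          s₃ : ∀ c l x y → c * (l * (x * y)) ≡ c * (x * l * y)
          s₃ = solve-∀
        G-≤-h g c hg (suc r) (suc o) o≤ℓ = begin
          n ^ ℓ * (W * G g r (suc o ∸ m) + Δ * (β * G g r ℓ))
            ≡⟨ s₁ (n ^ ℓ) W (G g r (suc o ∸ m)) Δ β (G g r ℓ) ⟩
          W * (n ^ ℓ * G g r (suc o ∸ m)) + Δ * (β * (n ^ ℓ * G g r ℓ))
            ≤⟨ +-mono-≤ (*-monoʳ-≤ W (G-≤-h g c hg r (suc o ∸ m) (≤-trans (m∸n≤m (suc o) m) o≤ℓ)))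
                        (*-monoʳ-≤ Δ (*-monoʳ-≤ β (G-≤-h g c hg r ℓ ≤-refl))) ⟩
          W * (c * (Λ ^ r * h (suc o ∸ m))) + Δ * (β * (c * (Λ ^ r * h ℓ)))
            ≡⟨ s₂ W c (Λ ^ r) (h (suc o ∸ m)) Δ β (h ℓ) ⟩
          c * (Λ ^ r * (W * h (suc o ∸ m) + Δ * (β * h ℓ)))
            ≤⟨ *-monoʳ-≤ c (*-monoʳ-≤ (Λ ^ r) (h-step o o≤ℓ)) ⟩
          c * (Λ ^ r * (Λ * h (suc o)))
            ≡⟨ s₃ c (Λ ^ r) Λ (h (suc o)) ⟩
          c * (Λ * Λ ^ r * h (suc o)) ∎
          where
          W = K * ω (suc o) m
          s₁ : ∀ a b x t y z → a * (b * x + t * (y * z)) ≡ b * (a * x) + t * (y * (a * z))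
          s₁ = solve-∀
          s₂ : ∀ u c l x t b y → u * (c * (l * x)) + t * (b * (c * (l * y))) ≡ c * (l * (u * x + t * (b * y)))
          s₂ = solve-∀
          s₃ : ∀ c l x y → c * (l * (x * y)) ≡ c * (x * l * y)
          s₃ = solve-∀

        -- Here an unfinished chain need not be paid for.  A chain that never stops decays
        -- like V ^ r; the extra term in the first inequality makes the induction close.
        G-≤-V : ∀ g c → (∀ o → g o ≤ c) → ∀ r →
          (n ^ ℓ * G g r 0 + c * (t * (n ^ ℓ * V ^ r)) ≤ c * (suc t * (Λ ^ r * n ^ ℓ))) ×
          (∀ o → o ≤ ℓ → n ^ ℓ * G g r o ≤ c * (n ^ ℓ * V ^ r + suc t * (Λ ^ r * h o)))
        G-≤-V g c hg zero = base , λ o _ → begin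
            n ^ ℓ * g o                                ≤⟨ *-monoʳ-≤ (n ^ ℓ) (hg o) ⟩
            n ^ ℓ * c                                  ≡⟨ s₂ (n ^ ℓ) c ⟩
            c * (n ^ ℓ * 1)                            ≤⟨ *-monoʳ-≤ c (m≤m+n _ _) ⟩
            c * (n ^ ℓ * 1 + suc t * (1 * h o))        ∎
          where
          s₁ : ∀ a c t → a * c + c * (t * (a * 1)) ≡ c * ((1 + t) * (1 * a))
          s₁ = solve-∀
          s₂ : ∀ a c → a * c ≡ c * (a * 1)
          s₂ = solve-∀
          base = begin
            n ^ ℓ * g 0 + c * (t * (n ^ ℓ * 1))  ≤⟨ +-monoˡ-≤ _ (*-monoʳ-≤ (n ^ ℓ) (hg 0)) ⟩
            n ^ ℓ * c + c * (t * (n ^ ℓ * 1))    ≡⟨ s₁ (n ^ ℓ) c t ⟩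
            c * (suc t * (1 * n ^ ℓ))            ∎
        G-≤-V g c hg (suc r) = first , second
          where
          N = n ^ ℓ
          v = V ^ r
          L = Λ ^ r
          IH₀ = proj₁ (G-≤-V g c hg r)
          IH = proj₂ (G-≤-V g c hg r)
          s₁ : ∀ a b x t y z w → a * (b * x + t * (y * z)) + w ≡ b * (a * x) + t * (y * (a * z)) + w
          s₁ = solve-∀
          s₂ : ∀ N x U t β c v L H V → U * (N * x) + t * (β * (c * (N * v + suc t * (L * H)))) + c * (t * (N * (V * v)))
               ≡ U * (N * x) + c * (t * (N * ((β + V) * v))) + c * (suc t * (L * (t * (β * H))))
          s₂ = solve-∀
          s₃ : ∀ N x U c t v → U * (N * x) + c * (t * (N * (U * v))) ≡ U * (N * x + c * (t * (N * v)))
          s₃ = solve-∀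
          s₄ : ∀ U c T L N t b H → U * (c * (T * (L * N))) + c * (T * (L * (t * (b * H)))) ≡ c * (T * (L * (U * N + t * (b * H))))
          s₄ = solve-∀
          s₅ : ∀ L x y → L * (x * y) ≡ x * L * y
          s₅ = solve-∀
          first : N * (U * G g r 0 + t * (β * G g r ℓ)) + c * (t * (N * (V * v))) ≤ c * (suc t * (Λ * L * N))
          first = begin
            N * (U * G g r 0 + t * (β * G g r ℓ)) + c * (t * (N * (V * v)))
              ≡⟨ s₁ N U (G g r 0) t β (G g r ℓ) _ ⟩
            U * (N * G g r 0) + t * (β * (N * G g r ℓ)) + c * (t * (N * (V * v)))
              ≤⟨ +-monoˡ-≤ _ (+-monoʳ-≤ (U * (N * G g r 0)) (*-monoʳ-≤ t (*-monoʳ-≤ β (IH ℓ ≤-refl)))) ⟩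
            U * (N * G g r 0) + t * (β * (c * (N * v + suc t * (L * h ℓ)))) + c * (t * (N * (V * v)))
              ≡⟨ s₂ N (G g r 0) U t β c v L (h ℓ) V ⟩
            U * (N * G g r 0) + c * (t * (N * ((β + V) * v))) + c * (suc t * (L * (t * (β * h ℓ))))
              -- The chains started here that never stop contribute `β * v`, and the extra term of
              -- the claim contributes `V * v`. Together they are at most `U * v`, that is, `U`
              -- times the extra term of the induction hypothesis.
              ≤⟨ +-monoˡ-≤ _ (+-monoʳ-≤ (U * (N * G g r 0)) (*-monoʳ-≤ c (*-monoʳ-≤ t (*-monoʳ-≤ N (*-monoˡ-≤ v β+V≤U))))) ⟩
            U * (N * G g r 0) + c * (t * (N * (U * v))) + c * (suc t * (L * (t * (β * h ℓ))))
              ≡⟨ cong (_+ c * (suc t * (L * (t * (β * h ℓ))))) (s₃ N (G g r 0) U c t v) ⟩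
            U * (N * G g r 0 + c * (t * (N * v))) + c * (suc t * (L * (t * (β * h ℓ))))
              ≤⟨ +-monoˡ-≤ _ (*-monoʳ-≤ U IH₀) ⟩
            U * (c * (suc t * (L * N))) + c * (suc t * (L * (t * (β * h ℓ))))
              ≡⟨ s₄ U c (suc t) L N t β (h ℓ) ⟩
            c * (suc t * (L * (U * N + t * (β * h ℓ))))
              ≤⟨ *-monoʳ-≤ c (*-monoʳ-≤ (suc t) (*-monoʳ-≤ L idle)) ⟩
            c * (suc t * (L * (Λ * N)))
              ≡⟨ cong (λ z → c * (suc t * z)) (s₅ L Λ N) ⟩
            c * (suc t * (Λ * L * N)) ∎
          s₆ : ∀ a b x t y z → a * (b * x + t * (y * z)) ≡ b * (a * x) + t * (y * (a * z))
          s₆ = solve-∀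
          s₇ : ∀ W c N v T L H D b H′ → W * (c * (N * v + T * (L * H))) + D * (b * (c * (N * v + T * (L * H′))))
               ≡ c * (N * ((W + D * b) * v) + T * (L * (W * H + D * (b * H′))))
          s₇ = solve-∀
          second : ∀ o → o ≤ ℓ → N * G g (suc r) o ≤ c * (N * (V * v) + suc t * (Λ * L * h o))
          second zero    _   = ≤-trans (≤-trans (m≤m+n _ _) first)
            (*-monoʳ-≤ c (≤-trans (≤-reflexive (cong (λ z → suc t * (Λ * L * z)) (sym h0))) (m≤n+m _ (N * (V * v)))))
          second (suc o) o<ℓ = begin
            N * (W * G g r (suc o ∸ m) + Δ * (β * G g r ℓ))
              ≡⟨ s₆ N W (G g r (suc o ∸ m)) Δ β (G g r ℓ) ⟩
            W * (N * G g r (suc o ∸ m)) + Δ * (β * (N * G g r ℓ))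
              ≤⟨ +-mono-≤ (*-monoʳ-≤ W (IH (suc o ∸ m) (≤-trans (m∸n≤m (suc o) m) o<ℓ)))
                          (*-monoʳ-≤ Δ (*-monoʳ-≤ β (IH ℓ ≤-refl))) ⟩
            W * (c * (N * v + suc t * (L * h (suc o ∸ m)))) + Δ * (β * (c * (N * v + suc t * (L * h ℓ))))
              ≡⟨ s₇ W c N v (suc t) L (h (suc o ∸ m)) Δ β (h ℓ) ⟩
            c * (N * ((W + Δ * β) * v) + suc t * (L * (W * h (suc o ∸ m) + Δ * (β * h ℓ))))
              ≤⟨ *-monoʳ-≤ c (+-mono-≤ (*-monoʳ-≤ N (*-monoˡ-≤ v (active o))) (*-monoʳ-≤ (suc t) (*-monoʳ-≤ L (h-step o o<ℓ)))) ⟩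
            c * (N * (V * v) + suc t * (L * (Λ * h (suc o))))
              ≡⟨ cong (λ z → c * (N * (V * v) + suc t * z)) (s₅ L Λ (h (suc o))) ⟩
            c * (N * (V * v) + suc t * (Λ * L * h (suc o))) ∎
            where W = K * ω (suc o) m

        module Sum
          .{{_ : NonZero n}} .{{_ : NonZero K}}
          (e c₂ : ℕ) (2≤ℓ : 2 ≤ ℓ) (1≤t : 1 ≤ t) (t≤n : t ≤ n)
          (U≡2V : U ≡ 2 * V)
          (Λ^t≤2U^t : Λ ^ t ≤ 2 * U ^ t)
          (βh≤ : β * h ℓ ≤ c₂ * n ^ m)
          (β≤ : β ≤ c₂ * n ^ m)
          (t2^ℓ≤2^t : t * 2 ^ ℓ ≤ 2 ^ t)
          (ec₂≤K : e * ((2 + 5 * ℓ) * c₂) ≤ K)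
          where

          private instance
            n^m≢0 : NonZero (n ^ m)
            n^m≢0 = m^n≢0 n m
            n^ℓ≢0 : NonZero (n ^ ℓ)
            n^ℓ≢0 = m^n≢0 n ℓ

          n²≤n^ℓ : n * n ≤ n ^ ℓ
          n²≤n^ℓ = ≤-trans (≤-reflexive (cong (n *_) (sym (*-identityʳ n)))) (^-monoʳ-≤ n 2≤ℓ)

          summand : ℕ → ℕ → ℕ
          summand b r = K ^ b * (t * (β * G (λ o → ω o (b * m)) r ℓ))

          -- With ℓ ≤ b m a chain still running at the end finds room for its whole overhang before
          -- block b; this is `terminal`, and `G-≤-h` applies. Of the n² ≤ n^ℓ gained, one factor n
          -- pays for the t partners of the first match, and the other makes the bound summable over
          -- all b.
          summand-far : ∀ b r → b + suc r ≡ t → ℓ ≤ b * m → K * n * summand b r ≤ 2 * c₂ * U ^ t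
          summand-far b r eq ℓ≤bm = *-cancelˡ-≤ n (begin
            n * (K * n * S)                 ≡⟨ s₀ n K S ⟩
            K * (n * n * S)                 ≤⟨ *-monoʳ-≤ K (*-monoˡ-≤ S n²≤n^ℓ) ⟩
            K * (n ^ ℓ * S)                 ≤⟨ *-cancelˡ-≤ (n ^ m) scaled ⟩
            t * (2 * c₂ * U ^ t)            ≤⟨ *-monoˡ-≤ _ t≤n ⟩
            n * (2 * c₂ * U ^ t)            ∎)
            where
            S = summand b r
            g : ℕ → ℕ
            g o = ω o (b * m)
            s₀ : ∀ a b c → a * (b * a * c) ≡ b * (a * a * c)
            s₀ = solve-∀
            s₁ : ∀ x N K k t β g → x * (K * (N * (k * (t * (β * g))))) ≡ K * x * (k * (t * (β * (N * g))))
            s₁ = solve-∀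
            s₂ : ∀ u k t β y L H → u * (k * (t * (β * (y * (L * H))))) ≡ t * (β * H) * (u * (k * y) * L)
            s₂ = solve-∀
            s₃ : ∀ t c x u → t * (c * x) * (2 * u) ≡ x * (t * (2 * c * u))
            s₃ = solve-∀
            terminal : ∀ o → o ≤ ℓ → n ^ ℓ * g o ≤ n ^ (b * m) * h o
            terminal o o≤ℓ = begin
              n ^ ℓ * ω o (b * m)        ≡⟨ *-comm (n ^ ℓ) _ ⟩
              ω o (b * m) * n ^ ℓ        ≡⟨ sym (ω-extend o (b * m) ℓ (≤-trans o≤ℓ ℓ≤bm)) ⟩
              ω o (b * m + ℓ)            ≡⟨ cong (ω o) (+-comm (b * m) ℓ) ⟩
              ω o (ℓ + b * m)            ≡⟨ ω-extend o ℓ (b * m) o≤ℓ ⟩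
              ω o ℓ * n ^ (b * m)        ≡⟨ *-comm (ω o ℓ) _ ⟩
              n ^ (b * m) * ω o ℓ        ≤⟨ *-monoʳ-≤ (n ^ (b * m)) (m≤m+n (ω o ℓ) _) ⟩
              n ^ (b * m) * h o          ∎
            scaled : n ^ m * (K * (n ^ ℓ * S)) ≤ n ^ m * (t * (2 * c₂ * U ^ t))
            scaled = begin
              n ^ m * (K * (n ^ ℓ * S))
                ≡⟨ s₁ (n ^ m) (n ^ ℓ) K (K ^ b) t β (G g r ℓ) ⟩
              U * (K ^ b * (t * (β * (n ^ ℓ * G g r ℓ))))
                ≤⟨ *-monoʳ-≤ U (*-monoʳ-≤ (K ^ b) (*-monoʳ-≤ t (*-monoʳ-≤ β (G-≤-h g (n ^ (b * m)) terminal r ℓ ≤-refl)))) ⟩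
              U * (K ^ b * (t * (β * (n ^ (b * m) * (Λ ^ r * h ℓ)))))
                ≡⟨ s₂ U (K ^ b) t β (n ^ (b * m)) (Λ ^ r) (h ℓ) ⟩
              t * (β * h ℓ) * (U * (K ^ b * n ^ (b * m)) * Λ ^ r)
                ≡⟨ cong (λ z → t * (β * h ℓ) * (U * z * Λ ^ r)) (sym (U^ b)) ⟩
              t * (β * h ℓ) * (U ^ suc b * Λ ^ r)
                ≤⟨ *-mono-≤ (*-monoʳ-≤ t βh≤) (*-monoˡ-≤ (Λ ^ r) (^-monoˡ-≤ (suc b) U≤Λ)) ⟩
              t * (c₂ * n ^ m) * (Λ ^ suc b * Λ ^ r)
                ≡⟨ cong (t * (c₂ * n ^ m) *_) (trans (sym (^-distribˡ-+-* Λ (suc b) r)) (cong (Λ ^_) (trans (sym (+-suc b r)) eq))) ⟩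
              t * (c₂ * n ^ m) * Λ ^ t
                ≤⟨ *-monoʳ-≤ (t * (c₂ * n ^ m)) Λ^t≤2U^t ⟩
              t * (c₂ * n ^ m) * (2 * U ^ t)
                ≡⟨ s₃ t c₂ (n ^ m) (U ^ t) ⟩
              n ^ m * (t * (2 * c₂ * U ^ t)) ∎

          -- Before block b there may be too little room for the overhang, so `G-≤-V` takes the
          -- place of `G-≤-h`. Compared with `summand-far` a factor n is lost, which is harmless for
          -- at most ℓ values of b. In 5 = 1 + 4 the 1 stands for a chain that never stops, and the
          -- 4 is the product of the 2 from `square` and the 2 from `short`.
          summand-near : ∀ b r → b + suc r ≡ t → b < ℓ → K * summand b r ≤ 5 * c₂ * U ^ t
          summand-near b r eq b<ℓ = *-cancelˡ-≤ (n ^ ℓ) (*-cancelˡ-≤ (n ^ m) (begin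
            n ^ m * (n ^ ℓ * (K * S))
              ≡⟨ s₁ (n ^ m) (n ^ ℓ) K (K ^ b) t β (G g r ℓ) ⟩
            U * (K ^ b * (t * (β * (n ^ ℓ * G g r ℓ))))
              ≤⟨ *-monoʳ-≤ U (*-monoʳ-≤ (K ^ b) (*-monoʳ-≤ t (*-monoʳ-≤ β (proj₂ (G-≤-V g (n ^ (b * m)) (λ o → ω-≤ o (b * m)) r) ℓ ≤-refl)))) ⟩
            U * (K ^ b * (t * (β * (n ^ (b * m) * (n ^ ℓ * V ^ r + suc t * (Λ ^ r * h ℓ))))))
              ≡⟨ s₂ U (K ^ b) t β (n ^ (b * m)) (n ^ ℓ) (V ^ r) (suc t) (Λ ^ r) (h ℓ) ⟩
            β * n ^ ℓ * (U * (K ^ b * n ^ (b * m)) * (t * V ^ r)) + suc t * t * (β * h ℓ) * (U * (K ^ b * n ^ (b * m)) * Λ ^ r)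
              ≡⟨ cong (λ z → β * n ^ ℓ * (U * z * (t * V ^ r)) + suc t * t * (β * h ℓ) * (U * z * Λ ^ r)) (sym (U^ b)) ⟩
            β * n ^ ℓ * (U ^ suc b * (t * V ^ r)) + suc t * t * (β * h ℓ) * (U ^ suc b * Λ ^ r)
              ≤⟨ +-mono-≤ (*-mono-≤ (*-monoˡ-≤ (n ^ ℓ) β≤) long)
                          (*-mono-≤ (*-mono-≤ (square) βh≤) short) ⟩
            c₂ * n ^ m * n ^ ℓ * U ^ t + 2 * n ^ ℓ * (c₂ * n ^ m) * (2 * U ^ t)
              ≡⟨ s₃ c₂ (n ^ m) (n ^ ℓ) (U ^ t) ⟩
            n ^ m * (n ^ ℓ * (5 * c₂ * U ^ t)) ∎))
            where
            S = summand b r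
            g : ℕ → ℕ
            g o = ω o (b * m)
            s₁ : ∀ x N K k t β g → x * (N * (K * (k * (t * (β * g))))) ≡ K * x * (k * (t * (β * (N * g))))
            s₁ = solve-∀
            s₂ : ∀ u k t β y N v T L H → u * (k * (t * (β * (y * (N * v + T * (L * H)))))) ≡
                 β * N * (u * (k * y) * (t * v)) + T * t * (β * H) * (u * (k * y) * L)
            s₂ = solve-∀
            s₃ : ∀ c x N u → c * x * N * u + 2 * N * (c * x) * (2 * u) ≡ x * (N * (5 * c * u))
            s₃ = solve-∀
            exponents : suc b + r ≡ t
            exponents = trans (sym (+-suc b r)) eq
            -- As V = U / 2, a chain that never stops gains 2^(-r), and since r ≥ t - ℓ this
            -- outweighs the t choices for its first partner.
            t≤2^r : t ≤ 2 ^ r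
            t≤2^r = *-cancelʳ-≤ t (2 ^ r) (2 ^ ℓ) {{m^n≢0 2 ℓ}} (begin
              t * 2 ^ ℓ         ≤⟨ t2^ℓ≤2^t ⟩
              2 ^ t             ≡⟨ cong (2 ^_) (sym (trans (+-comm r (suc b)) exponents)) ⟩
              2 ^ (r + suc b)   ≤⟨ ^-monoʳ-≤ 2 (+-monoʳ-≤ r b<ℓ) ⟩
              2 ^ (r + ℓ)       ≡⟨ ^-distribˡ-+-* 2 r ℓ ⟩
              2 ^ r * 2 ^ ℓ     ∎)
            long : U ^ suc b * (t * V ^ r) ≤ U ^ t
            long = begin
              U ^ suc b * (t * V ^ r)       ≤⟨ *-monoʳ-≤ (U ^ suc b) (*-monoˡ-≤ (V ^ r) t≤2^r) ⟩
              U ^ suc b * (2 ^ r * V ^ r)   ≡⟨ cong (U ^ suc b *_) (trans (sym (*-^ 2 V r)) (cong (_^ r) (sym U≡2V))) ⟩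
              U ^ suc b * U ^ r             ≡⟨ sym (^-distribˡ-+-* U (suc b) r) ⟩
              U ^ (suc b + r)               ≡⟨ cong (U ^_) exponents ⟩
              U ^ t                         ∎
            short : U ^ suc b * Λ ^ r ≤ 2 * U ^ t
            short = begin
              U ^ suc b * Λ ^ r             ≤⟨ *-monoˡ-≤ (Λ ^ r) (^-monoˡ-≤ (suc b) U≤Λ) ⟩
              Λ ^ suc b * Λ ^ r             ≡⟨ trans (sym (^-distribˡ-+-* Λ (suc b) r)) (cong (Λ ^_) exponents) ⟩
              Λ ^ t                         ≤⟨ Λ^t≤2U^t ⟩
              2 * U ^ t                     ∎
            square : suc t * t ≤ 2 * n ^ ℓ
            square = begin
              suc t * t          ≤⟨ *-monoˡ-≤ t (+-mono-≤ 1≤t (m≤m+n t 0)) ⟩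
              2 * t * t          ≡⟨ *-assoc 2 t t ⟩
              2 * (t * t)        ≤⟨ *-monoʳ-≤ 2 (≤-trans (*-mono-≤ t≤n t≤n) n²≤n^ℓ) ⟩
              2 * n ^ ℓ          ∎

          -- From block b on there are at most r far summands and at most `ℓ ∸ b` near ones, the
          -- latter each dearer by a factor of order n.
          total-≤ : ∀ b r → b + r ≡ t →
            K * n * total b r ≤ K * n * U ^ t + r * (2 * c₂ * U ^ t) + (ℓ ∸ b) * (n * (5 * c₂ * U ^ t))
          total-≤ b zero eq = begin
            K * n * (K ^ b * n ^ (b * m))  ≡⟨ cong (K * n *_) (sym (U^ b)) ⟩
            K * n * U ^ b                  ≡⟨ cong (λ z → K * n * U ^ z) (trans (sym (+-identityʳ b)) eq) ⟩
            K * n * U ^ t                  ≤⟨ m≤m+n _ _ ⟩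
            K * n * U ^ t + 0              ≤⟨ m≤m+n _ _ ⟩
            K * n * U ^ t + 0 + (ℓ ∸ b) * (n * (5 * c₂ * U ^ t)) ∎
          total-≤ b (suc r) eq with ≤-<-connex ℓ b
          ... | inj₁ ℓ≤b = begin
            K * n * (summand b r + total (suc b) r)
              ≡⟨ *-distribˡ-+ (K * n) _ _ ⟩
            K * n * summand b r + K * n * total (suc b) r
              ≤⟨ +-mono-≤ (summand-far b r eq (≤-trans ℓ≤b (m≤m*n b m {{>-nonZero 1≤m}}))) (total-≤ (suc b) r (trans (sym (+-suc b r)) eq)) ⟩
            Y + (X + r * Y + (ℓ ∸ suc b) * Z)
              ≡⟨ s Y X (r * Y) ((ℓ ∸ suc b) * Z) ⟩
            X + suc r * Y + (ℓ ∸ suc b) * Z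
              ≤⟨ +-monoʳ-≤ (X + suc r * Y) (*-monoˡ-≤ Z (∸-monoʳ-≤ ℓ (n≤1+n b))) ⟩
            X + suc r * Y + (ℓ ∸ b) * Z ∎
            where
            X = K * n * U ^ t
            Y = 2 * c₂ * U ^ t
            Z = n * (5 * c₂ * U ^ t)
            s : ∀ y x r z → y + (x + r + z) ≡ x + (y + r) + z
            s = solve-∀
          ... | inj₂ b<ℓ = begin
            K * n * (summand b r + total (suc b) r)
              ≡⟨ *-distribˡ-+ (K * n) _ _ ⟩
            K * n * summand b r + K * n * total (suc b) r
              ≤⟨ +-mono-≤ (≤-trans (≤-reflexive (s₀ K n (summand b r))) (*-monoʳ-≤ n (summand-near b r eq b<ℓ)))
                          (total-≤ (suc b) r (trans (sym (+-suc b r)) eq)) ⟩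
            Z + (X + r * Y + (ℓ ∸ suc b) * Z)
              ≡⟨ s Z X (r * Y) ((ℓ ∸ suc b) * Z) ⟩
            X + r * Y + suc (ℓ ∸ suc b) * Z
              ≡⟨ cong (λ z → X + r * Y + z * Z) (sym (+-∸-assoc 1 b<ℓ)) ⟩
            X + r * Y + (ℓ ∸ b) * Z
              ≤⟨ +-monoˡ-≤ ((ℓ ∸ b) * Z) (+-monoʳ-≤ X (m≤n+m (r * Y) Y)) ⟩
            X + suc r * Y + (ℓ ∸ b) * Z ∎
            where
            X = K * n * U ^ t
            Y = 2 * c₂ * U ^ t
            Z = n * (5 * c₂ * U ^ t)
            s₀ : ∀ a b c → a * b * c ≡ b * (a * c)
            s₀ = solve-∀
            s : ∀ y x r z → y + (x + r + z) ≡ x + r + (y + z)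
            s = solve-∀

          total-bound : e * total 0 t ≤ suc e * U ^ t
          total-bound = *-cancelˡ-≤ K (*-cancelˡ-≤ n (begin
            n * (K * (e * total 0 t))
              ≡⟨ s₁ n K e (total 0 t) ⟩
            e * (K * n * total 0 t)
              ≤⟨ *-monoʳ-≤ e (total-≤ 0 t refl) ⟩
            e * (K * n * u + t * (2 * c₂ * u) + ℓ * (n * (5 * c₂ * u)))
              ≤⟨ *-monoʳ-≤ e (+-monoˡ-≤ _ (+-monoʳ-≤ (K * n * u) (*-monoˡ-≤ (2 * c₂ * u) t≤n))) ⟩
            e * (K * n * u + n * (2 * c₂ * u) + ℓ * (n * (5 * c₂ * u)))
              ≡⟨ s₂ e K n u c₂ ℓ ⟩
            e * (K * n * u) + e * ((2 + 5 * ℓ) * c₂) * (n * u)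
              ≤⟨ +-monoʳ-≤ (e * (K * n * u)) (*-monoˡ-≤ (n * u) ec₂≤K) ⟩
            e * (K * n * u) + K * (n * u)
              ≡⟨ s₃ e K n u ⟩
            n * (K * (suc e * u)) ∎))
            where
            u = U ^ t
            s₁ : ∀ n K e x → n * (K * (e * x)) ≡ e * (K * n * x)
            s₁ = solve-∀
            s₂ : ∀ e K n u c l → e * (K * n * u + n * (2 * c * u) + l * (n * (5 * c * u))) ≡
                 e * (K * n * u) + e * ((2 + 5 * l) * c) * (n * u)
            s₂ = solve-∀
            s₃ : ∀ e K n u → e * (K * n * u) + K * (n * u) ≡ n * (K * ((1 + e) * u))
            s₃ = solve-∀

  -- The constants, and the hypotheses of the transfer bound.

  chainCost : ℕ → ℕ
  chainCost k = 4 * suc k * (4 * k) ^ k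

  -- A quarter of K. Here `chainCost k` bounds β h(ℓ) / n^m = 4 (ℓ + 1) (4k)^k, the weight of a
  -- chain. The factor 5 k² + 2 dominates both the 5 ℓ + 2 arising from `total-≤` and the k²
  -- continuations of a running chain, and `e` brings the error down to 1/e. Nothing depends on ℓ,
  -- as the theorem demands of its constant.
  density : ℕ → ℕ → ℕ
  density k e = e * ((5 * (k * k) + 2) * chainCost k)

  chainCost-pos : ∀ k → 1 ≤ k → 1 ≤ chainCost k
  chainCost-pos k@(suc _) _ = *-mono-≤ (s≤s (z≤n {k + 3 * suc k})) (m^n>0 (4 * k) k)

  density-pos : ∀ k e → 1 ≤ k → 1 ≤ e → 1 ≤ density k e
  density-pos k e 1≤k 1≤e = *-mono-≤ 1≤e (*-mono-≤ {1} (≤-trans (s≤s z≤n) (m≤n+m 2 (5 * (k * k)))) (chainCost-pos k 1≤k))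

  module _ (k ℓ m e t n : ℕ) (m+ℓ≡k : m + ℓ ≡ k) (1≤m : 1 ≤ m) (2≤ℓ : 2 ≤ ℓ) (1≤e : 1 ≤ e)
    (1≤t : 1 ≤ t) (t≤n : t ≤ n) (16k≤n : 4 * (4 * k) ≤ n) (t2^ℓ≤2^t : t * 2 ^ ℓ ≤ 2 ^ t) where

    private
      κ K C Q β x : ℕ
      κ = 4 * k
      Q = density k e
      -- `U` consists of four parts Q n^m: one dominates an unmatched block within a chain, one the
      -- matches that continue the chain (these two make up `V`), and a third dominates `β`.
      K = 4 * Q
      C = chainCost k
      β = 4 * n ^ m * κ ^ m
      x = n ^ (m ∸ 1)

      m≤k : m ≤ k
      m≤k = ≤-trans (m≤m+n m ℓ) (≤-reflexive m+ℓ≡k)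
      ℓ≤k : ℓ ≤ k
      ℓ≤k = ≤-trans (m≤n+m ℓ m) (≤-reflexive m+ℓ≡k)
      1≤k : 1 ≤ k
      1≤k = ≤-trans 1≤m m≤k

      instance
        κ≢0 : NonZero κ
        κ≢0 = >-nonZero (≤-trans 1≤k (m≤m+n k _))
        n≢0 : NonZero n
        n≢0 = >-nonZero (≤-trans 1≤t t≤n)
        K≢0 : NonZero K
        K≢0 = >-nonZero (≤-trans (density-pos k e 1≤k 1≤e) (m≤m+n Q _))

      κ≤n : κ ≤ n
      κ≤n = ≤-trans (m≤m+n κ _) 16k≤n

      open Transfer n κ K m ℓ t β (k * k)
      open ≤-Reasoning

      n^m : n ^ m ≡ n * x
      n^m = cong (n ^_) (sym (m+[n∸m]≡n 1≤m))

      kkC≤Q : k * k * C ≤ Q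
      kkC≤Q = begin
        k * k * C                       ≤⟨ *-monoˡ-≤ C (≤-trans (m≤m+n (k * k) _) (m≤m+n (5 * (k * k)) 2)) ⟩
        (5 * (k * k) + 2) * C           ≤⟨ m≤n*m _ e {{>-nonZero 1≤e}} ⟩
        Q                               ∎

      C≤Q : C ≤ Q
      C≤Q = ≤-trans (m≤n*m C (k * k) {{>-nonZero (*-mono-≤ 1≤k 1≤k)}}) kkC≤Q

      4κ^m : 4 * κ ^ m * suc ℓ ≤ C
      4κ^m = begin
        4 * κ ^ m * suc ℓ   ≡⟨ s 4 (κ ^ m) (suc ℓ) ⟩
        4 * suc ℓ * κ ^ m   ≤⟨ *-mono-≤ (*-monoʳ-≤ 4 (s≤s ℓ≤k)) (^-monoʳ-≤ κ m≤k) ⟩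
        C                   ∎
        where
        s : ∀ a b c → a * b * c ≡ a * c * b
        s = solve-∀

      βℓ≤ : β * suc ℓ ≤ C * n ^ m
      βℓ≤ = begin
        β * suc ℓ                   ≡⟨ s (n ^ m) (κ ^ m) (suc ℓ) ⟩
        4 * κ ^ m * suc ℓ * n ^ m   ≤⟨ *-monoˡ-≤ (n ^ m) 4κ^m ⟩
        C * n ^ m                   ∎
        where
        s : ∀ a b c → 4 * a * b * c ≡ 4 * b * c * a
        s = solve-∀

      β≤ : β ≤ C * n ^ m
      β≤ = ≤-trans (m≤m*n β (suc ℓ)) βℓ≤

      βh≤ : β * h ℓ ≤ C * n ^ m
      βh≤ = begin
        β * (suc ℓ * ω ℓ ℓ)                          ≡⟨ cong (λ z → β * (suc ℓ * z)) (ω-full ℓ) ⟩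
        4 * n ^ m * κ ^ m * (suc ℓ * κ ^ ℓ)          ≡⟨ s (n ^ m) (κ ^ m) (suc ℓ) (κ ^ ℓ) ⟩
        4 * suc ℓ * (κ ^ m * κ ^ ℓ) * n ^ m          ≡⟨ cong (λ z → 4 * suc ℓ * z * n ^ m) (trans (sym (^-distribˡ-+-* κ m ℓ)) (cong (κ ^_) m+ℓ≡k)) ⟩
        4 * suc ℓ * κ ^ k * n ^ m                    ≤⟨ *-monoˡ-≤ (n ^ m) (*-monoˡ-≤ (κ ^ k) (*-monoʳ-≤ 4 (s≤s ℓ≤k))) ⟩
        C * n ^ m                                    ∎
        where
        s : ∀ a b c d → 4 * a * b * (c * d) ≡ 4 * c * (b * d) * a
        s = solve-∀

      Δβ≤ : k * k * (β * suc ℓ) ≤ Q * n ^ m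
      Δβ≤ = begin
        k * k * (β * suc ℓ)     ≤⟨ *-monoʳ-≤ (k * k) βℓ≤ ⟩
        k * k * (C * n ^ m)     ≡⟨ sym (*-assoc (k * k) C _) ⟩
        k * k * C * n ^ m       ≤⟨ *-monoˡ-≤ (n ^ m) kkC≤Q ⟩
        Q * n ^ m               ∎

      Δβ≤U : k * k * (β * suc ℓ) ≤ U
      Δβ≤U = ≤-trans Δβ≤ (*-monoˡ-≤ (n ^ m) (m≤m+n Q _))

      Λ V : ℕ
      Λ = U + C * x
      V = 2 * Q * n ^ m

      n²≤n^ℓ : n * n ≤ n ^ ℓ
      n²≤n^ℓ = ≤-trans (≤-reflexive (cong (n *_) (sym (*-identityʳ n)))) (^-monoʳ-≤ n 2≤ℓ)

      -- Here ℓ ≥ 2 enters. A new chain has t ≤ n possible partners and gains h(ℓ) / h(0) =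
      -- O(n^(-ℓ)), so the relative excess per block is O(1/n), which t ≤ n blocks can afford.
      idle : U * n ^ ℓ + t * (β * h ℓ) ≤ Λ * n ^ ℓ
      idle = begin
        U * n ^ ℓ + t * (β * h ℓ)         ≤⟨ +-monoʳ-≤ (U * n ^ ℓ) (*-mono-≤ t≤n βh≤) ⟩
        U * n ^ ℓ + n * (C * n ^ m)       ≡⟨ cong (λ z → U * n ^ ℓ + n * (C * z)) n^m ⟩
        U * n ^ ℓ + n * (C * (n * x))     ≡⟨ cong (U * n ^ ℓ +_) (s n C x) ⟩
        U * n ^ ℓ + C * x * (n * n)       ≤⟨ +-monoʳ-≤ (U * n ^ ℓ) (*-monoʳ-≤ (C * x) n²≤n^ℓ) ⟩
        U * n ^ ℓ + C * x * n ^ ℓ         ≡⟨ sym (*-distribʳ-+ (n ^ ℓ) U (C * x)) ⟩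
        Λ * n ^ ℓ                         ∎
        where
        s : ∀ n c x → n * (c * (n * x)) ≡ c * x * (n * n)
        s = solve-∀

      β+V≤U : β + V ≤ U
      β+V≤U = begin
        β + V                               ≤⟨ +-monoˡ-≤ V (≤-trans β≤ (*-monoˡ-≤ (n ^ m) C≤Q)) ⟩
        Q * n ^ m + 2 * Q * n ^ m           ≤⟨ m≤m+n _ (Q * n ^ m) ⟩
        Q * n ^ m + 2 * Q * n ^ m + Q * n ^ m ≡⟨ s Q (n ^ m) ⟩
        U                                   ∎
        where
        s : ∀ q y → q * y + 2 * q * y + q * y ≡ 4 * q * y
        s = solve-∀

      ω-suc : ∀ o → ω (suc o) m ≤ κ * x
      ω-suc o = begin
        ω (suc o) m               ≡⟨ cong (ω (suc o)) (sym (m+[n∸m]≡n 1≤m)) ⟩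
        κ * ω o (m ∸ 1)           ≤⟨ *-monoʳ-≤ κ (ω-≤ κ≤n o (m ∸ 1)) ⟩
        κ * x                     ∎

      active : ∀ o → K * ω (suc o) m + k * k * β ≤ V
      active o = begin
        K * ω (suc o) m + k * k * β       ≤⟨ +-mono-≤ (*-monoʳ-≤ K (ω-suc o)) (≤-trans (*-monoʳ-≤ (k * k) (m≤m*n β (suc ℓ))) Δβ≤) ⟩
        K * (κ * x) + Q * n ^ m           ≡⟨ cong (_+ Q * n ^ m) (s₁ Q κ x) ⟩
        Q * (4 * κ * x) + Q * n ^ m       ≤⟨ +-monoˡ-≤ (Q * n ^ m) (*-monoʳ-≤ Q (*-monoˡ-≤ x 16k≤n)) ⟩
        Q * (n * x) + Q * n ^ m           ≡⟨ cong (λ z → Q * z + Q * n ^ m) (sym n^m) ⟩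
        Q * n ^ m + Q * n ^ m             ≡⟨ s₂ Q (n ^ m) ⟩
        V                                 ∎
        where
        s₁ : ∀ q a x → 4 * q * (a * x) ≡ q * (4 * a * x)
        s₁ = solve-∀
        s₂ : ∀ q y → q * y + q * y ≡ 2 * q * y
        s₂ = solve-∀

      -- Enlarging C to Q turns the ratio Λ / U into exactly 1 + 1/(4n), and 2t ≤ 4n + 1 lets
      -- `suc^≤2*^` apply.
      Λ^t≤2U^t : Λ ^ t ≤ 2 * U ^ t
      Λ^t≤2U^t = begin
        (U + C * x) ^ t                      ≤⟨ ^-monoˡ-≤ t (+-monoʳ-≤ U (*-monoˡ-≤ x C≤Q)) ⟩
        (U + Q * x) ^ t                      ≡⟨ cong (λ z → (K * z + Q * x) ^ t) n^m ⟩
        (4 * Q * (n * x) + Q * x) ^ t        ≡⟨ cong (_^ t) (s₁ Q n x) ⟩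
        (Q * x * suc (4 * n)) ^ t            ≡⟨ *-^ (Q * x) (suc (4 * n)) t ⟩
        (Q * x) ^ t * suc (4 * n) ^ t        ≤⟨ *-monoʳ-≤ ((Q * x) ^ t) (suc^≤2*^ (4 * n) t 2t≤) ⟩
        (Q * x) ^ t * (2 * (4 * n) ^ t)      ≡⟨ s₂ ((Q * x) ^ t) ((4 * n) ^ t) ⟩
        2 * ((Q * x) ^ t * (4 * n) ^ t)      ≡⟨ cong (2 *_) (sym (*-^ (Q * x) (4 * n) t)) ⟩
        2 * (Q * x * (4 * n)) ^ t            ≡⟨ cong (λ z → 2 * z ^ t) (s₃ Q x n) ⟩
        2 * (4 * Q * (n * x)) ^ t            ≡⟨ cong (λ z → 2 * (K * z) ^ t) (sym n^m) ⟩
        2 * U ^ t                            ∎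
        where
        s₁ : ∀ q n x → 4 * q * (n * x) + q * x ≡ q * x * (1 + 4 * n)
        s₁ = solve-∀
        s₂ : ∀ a b → a * (2 * b) ≡ 2 * (a * b)
        s₂ = solve-∀
        s₃ : ∀ q x n → q * x * (4 * n) ≡ 4 * q * (n * x)
        s₃ = solve-∀
        2t≤ : 2 * t ≤ suc (4 * n)
        2t≤ = ≤-trans (*-mono-≤ (s≤s (s≤s (z≤n {2}))) t≤n) (n≤1+n (4 * n))

      U≡2V : U ≡ 2 * V
      U≡2V = s Q (n ^ m)
        where
        s : ∀ q y → 4 * q * y ≡ 2 * (2 * q * y)
        s = solve-∀

      ec₂≤K : e * ((2 + 5 * ℓ) * C) ≤ K
      ec₂≤K = begin
        e * ((2 + 5 * ℓ) * C)         ≤⟨ *-monoʳ-≤ e (*-monoˡ-≤ C bound) ⟩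
        Q                             ≤⟨ m≤m+n Q _ ⟩
        K                             ∎
        where
        bound : 2 + 5 * ℓ ≤ 5 * (k * k) + 2
        bound = ≤-trans (+-monoʳ-≤ 2 (*-monoʳ-≤ 5 (≤-trans ℓ≤k (m≤m*n k k {{>-nonZero 1≤k}})))) (≤-reflexive (+-comm 2 (5 * (k * k))))

    transfer-bound : e * total 0 t ≤ suc e * (K * n ^ m) ^ t
    transfer-bound = total-bound
      where
      open Bounds κ≤n Λ V 1≤m Δβ≤U (m≤m+n U _) idle β+V≤U active
      open Sum e C 2≤ℓ 1≤t t≤n U≡2V Λ^t≤2U^t βh≤ β≤ t2^ℓ≤2^t ec₂≤K

  -- Pairs of coloured cycles by their shared atoms

  -- A word prescribes partners in the fixed cycle for r consecutive edges. A letter `nothing` does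
  -- not forbid a match: words come from multiplying out the sums in `prod`, they do not partition
  -- the pairs.
  words : List I → ℕ → List (List (Maybe I))
  words is zero    = [] ∷ []
  words is (suc r) = map (nothing ∷_) (words is r) ++ concatMap (λ i → map (just i ∷_) (words is r)) is

  ∑-words : ∀ (is : List I) r (f : List (Maybe I) → ℕ) → ∑ (words is (suc r)) f ≡
    ∑ (words is r) (λ x → f (nothing ∷ x)) + ∑ is (λ i → ∑ (words is r) (λ x → f (just i ∷ x)))
  ∑-words is r f = trans (∑-++ (map (nothing ∷_) (words is r)) _ f) (cong₂ _+_ (∑-map _ (words is r) f)
    (trans (∑-concatMap _ is f) (∑-cong is (λ i → ∑-map _ (words is r) f))))

  length-words : ∀ (is : List I) r {x} → x ∈ words is r → length x ≡ r
  length-words is zero    (here refl) = refl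
  length-words is (suc r) p with ∈-++⁻ (map (nothing ∷_) (words is r)) p
  ... | inj₁ p′ with _ , q , refl ← ∈-map⁻ _ p′ = cong suc (length-words is r q)
  ... | inj₂ p′ with i , p″ ← satisfied (∈-concatMap⁻ _ {xs = is} p′) with _ , q , refl ← ∈-map⁻ _ p″ = cong suc (length-words is r q)

  cover : ℕ → I → ℕ → List (Maybe I)
  cover o       v zero    = []
  cover zero    v (suc c) = nothing ∷ cover zero v c
  cover (suc o) v (suc c) = just v ∷ cover o v c

  length-cover : ∀ o (v : I) c → length (cover o v c) ≡ c
  length-cover o       v zero    = refl
  length-cover zero    v (suc c) = cong suc (length-cover zero v c)
  length-cover (suc o) v (suc c) = cong suc (length-cover o v c)

  price-++ : ∀ N a (x y : List (Maybe I)) → price N a (x ++ y) ≡ price N a x * price N a y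
  price-++ N a []            y = sym (+-identityʳ _)
  price-++ N a (nothing ∷ x) y = trans (cong (N *_) (price-++ N a x y)) (sym (*-assoc N _ _))
  price-++ N a (just _ ∷ x)  y = trans (cong (4 * a *_) (price-++ N a x y)) (sym (*-assoc (4 * a) _ _))

  Sat-cover : ∀ {R : I → A → Set} (R? : ∀ i a → Dec (R i a)) f o v c →
              (∀ a → a < o → R v (f a)) → Permanent.Sat R? f (cover o v c)
  Sat-cover R? f o       v zero    h = tt
  Sat-cover R? f zero    v (suc c) h = Sat-cover R? (f ∘ suc) zero v c (λ _ ())
  Sat-cover R? f (suc o) v (suc c) h = h 0 (s≤s z≤n) , Sat-cover R? (f ∘ suc) o v c (λ a a<o → h (suc a) (s≤s a<o))

  Sat-replicate-nothing : ∀ {R : I → A → Set} (R? : ∀ i a → Dec (R i a)) f b → Permanent.Sat R? f (replicate b nothing)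
  Sat-replicate-nothing R? f zero    = tt
  Sat-replicate-nothing R? f (suc b) = Sat-replicate-nothing R? (f ∘ suc) b

  price-replicate-nothing : ∀ N a b → price {I = I} N a (replicate b nothing) ≡ N ^ b
  price-replicate-nothing N a zero    = refl
  price-replicate-nothing N a (suc b) = cong (N *_) (price-replicate-nothing N a b)

  infixl 20 _⟨_⟩

  _⟨_⟩ : ∀ {N} .{{_ : NonZero N}} → Vec A N → ℕ → A
  _⟨_⟩ {N = N} v a = lookup v (a mod N)

  ⟨⟩-lookup : ∀ {N} .{{_ : NonZero N}} (v : Vec A N) i → v ⟨ toℕ i ⟩ ≡ lookup v i
  ⟨⟩-lookup {N = N} v i = cong (lookup v) (Fin.toℕ-injective
    (trans (Fin.toℕ-fromℕ< _) (m<n⇒m%n≡m (Fin.toℕ<n i))))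

  ⟨⟩-periodic : ∀ {N} .{{_ : NonZero N}} (v : Vec A N) a → v ⟨ N + a ⟩ ≡ v ⟨ a ⟩
  ⟨⟩-periodic {N = N} v a = cong (lookup v) (Fin.toℕ-injective
    (trans (Fin.toℕ-fromℕ< _) (trans (trans (cong (_% N) (+-comm N a)) ([m+n]%n≡m%n a N)) (sym (Fin.toℕ-fromℕ< _)))))

  ∈-vertexSet : ∀ {n} {u : Fin n} {us} → u ∈ us → u ∈ₛ vertexSet us
  ∈-vertexSet {us = u ∷ us} (here refl) = x∈p∪q⁺ (inj₁ (x∈⁅x⁆ u))
  ∈-vertexSet {us = w ∷ us} (there p)   = x∈p∪q⁺ {p = ⁅ w ⁆} (inj₂ (∈-vertexSet p))

  ∈-segment : ∀ {n N} .{{_ : NonZero N}} k (v : Vec (Fin n) N) s a → a < k → v ⟨ s + a ⟩ ∈ₛ segment k v s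
  ∈-segment {N = N} k v s a a<k = ∈-vertexSet (subst (λ z → v ⟨ s + z ⟩ ∈ tabulate (λ j → v ⟨ s + toℕ j ⟩))
    (Fin.toℕ-fromℕ< a<k) (∈-tabulate⁺ {f = λ (j : Fin k) → v ⟨ s + toℕ j ⟩} (Data.Fin.fromℕ< a<k)))

  -- `S` and `C` are the edges and colours of the fixed coloured cycle, whose geometry enters
  -- through the bounds `size` and `degree`.
  module Overlap (k ℓ m t q K : ℕ) .{{_ : NonZero t}} .{{_ : NonZero q}} .{{_ : NonZero (t * m)}}
    (m+ℓ≡k : m + ℓ ≡ k) (1≤m : 1 ≤ m) (t≤q : t ≤ q)
    (S : Fin t → Subset (t * m)) (C : Fin t → Fin q)
    (size : ∀ i → ∑ (allFin (t * m)) (λ u → 𝟙 (u ∈ₛ? S i)) ≤ k)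
    (degree : ∀ u → ∑ (allFin t) (λ i → 𝟙 (u ∈ₛ? S i)) ≤ k)
    where

    n D β : ℕ
    n = t * m
    D = n ^ m * q
    -- A match has coefficient D = n^m q, price (4k)^m for the m positions of its block and price 4
    -- for its colour. The factor q is split off, as it is for an unmatched block, whose free colour
    -- has price q.
    β = 4 * n ^ m * (4 * k) ^ m

    open Transfer n (4 * k) K m ℓ t β (k * k)

    Atom : Set
    Atom = Subset n × Fin q

    _≟A_ : DecidableEquality Atom
    _≟A_ = ≡-dec _≟S_ Fin._≟_

    atomOf : Fin t → Atom
    atomOf i = S i , C i

    atom : Vec (Fin n) n → Vec (Fin q) t → ℕ → Atom
    atom τ d j = segment k τ (j * m) , d ⟨ j ⟩

    module Atoms    = Permanent {R = λ i b → b ≡ atomOf i} (λ i b → b ≟A atomOf i)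
    module Vertices = Permanent {R = λ i u → u ∈ₛ S i} (λ i u → u ∈ₛ? S i)
    module Colours  = Permanent {R = λ i c → c ≡ C i} (λ i c → c Fin.≟ C i)

    is : List (Fin t)
    is = allFin t

    State : Set
    State = ℕ × Fin t

    -- Counts common vertices; matched edges that overlap in one cycle have one in the other.
    near : ℕ → Fin t → Fin t → ℕ
    near zero    v i = 1
    near (suc _) v i = ∑ (allFin n) (λ u → 𝟙 (u ∈ₛ? S v) * 𝟙 (u ∈ₛ? S i))

    -- Double counting: the edge v has at most k vertices, each of which lies in at most k edges.
    -- This is the value of Δ in the recursion.
    near-sum : ∀ o v → ∑ is (near (suc o) v) ≤ k * k
    near-sum o v = begin
      ∑ is (λ i → ∑ (allFin n) (λ u → 𝟙 (u ∈ₛ? S v) * 𝟙 (u ∈ₛ? S i)))  ≡⟨ ∑-swap is (allFin n) _ ⟩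
      ∑ (allFin n) (λ u → ∑ is (λ i → 𝟙 (u ∈ₛ? S v) * 𝟙 (u ∈ₛ? S i)))  ≡⟨ ∑-cong (allFin n) (λ u → ∑-*ˡ is (𝟙 (u ∈ₛ? S v)) (λ i → 𝟙 (u ∈ₛ? S i))) ⟩
      ∑ (allFin n) (λ u → 𝟙 (u ∈ₛ? S v) * ∑ is (λ i → 𝟙 (u ∈ₛ? S i)))  ≤⟨ ∑-mono (allFin n) (λ u → *-monoʳ-≤ (𝟙 (u ∈ₛ? S v)) (degree u)) ⟩
      ∑ (allFin n) (λ u → 𝟙 (u ∈ₛ? S v) * k)                          ≡⟨ ∑-*ʳ (allFin n) k (λ u → 𝟙 (u ∈ₛ? S v)) ⟩
      ∑ (allFin n) (λ u → 𝟙 (u ∈ₛ? S v)) * k                          ≤⟨ *-monoˡ-≤ k (size v) ⟩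
      k * k                                                          ∎
      where open ≤-Reasoning

    -- In state (o , v) the next o positions lie in the previously matched edge v.
    step : State → Maybe (Fin t) → State
    step (o , v) nothing  = o ∸ m , v
    step (o , v) (just i) = ℓ , i

    final : State → List (Maybe (Fin t)) → State
    final s []      = s
    final s (g ∷ x) = final (step s g) x

    -- A match is charged for the m positions of its own block. The other ℓ positions of the edge
    -- are passed on in the state and charged later, unless a further match takes them over, so no
    -- position is charged twice.
    block : State → Maybe (Fin t) → List (Maybe (Fin t))
    block (o , v) nothing  = cover o v m
    block (o , v) (just i) = cover m i m

    rowsFrom : State → List (Maybe (Fin t)) → List (Maybe (Fin t))
    rowsFrom s []      = []
    rowsFrom s (g ∷ x) = block s g ++ rowsFrom (step s g) x

    nearBy : State → Maybe (Fin t) → ℕ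
    nearBy (o , v) nothing  = 1
    nearBy (o , v) (just i) = near o v i

    compat : State → List (Maybe (Fin t)) → ℕ
    compat s []      = 1
    compat s (g ∷ x) = nearBy s g * compat (step s g) x

    coef : List (Maybe (Fin t)) → ℕ
    coef []            = 1
    coef (nothing ∷ x) = K * coef x
    coef (just _ ∷ x)  = D * coef x

    val : (ℕ → ℕ) → State → List (Maybe (Fin t)) → ℕ
    val g (o , v) []            = g o
    val g (o , v) (nothing ∷ x) = K * ω o m * val g (o ∸ m , v) x
    val g (o , v) (just i ∷ x)  = near o v i * (β * val g (ℓ , i) x)

    -- Summing out the letters one by one turns `near` into the number of partners: t when no chain
    -- is running, at most k² otherwise.
    val-sum : ∀ g r o v → ∑ (words is r) (val g (o , v)) ≤ G g r o
    val-sum g zero    o       v = ≤-reflexive (+-identityʳ (g o))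
    val-sum g (suc r) o       v = ≤-trans (≤-reflexive expand) (bound o)
      where
      open ≤-Reasoning
      expand : ∑ (words is (suc r)) (val g (o , v)) ≡
        K * ω o m * ∑ (words is r) (val g (o ∸ m , v)) + ∑ is (λ i → near o v i * (β * ∑ (words is r) (val g (ℓ , i))))
      expand = trans (∑-words is r (val g (o , v))) (cong₂ _+_ (∑-*ˡ (words is r) (K * ω o m) (val g (o ∸ m , v)))
        (∑-cong is (λ i → trans (∑-*ˡ (words is r) (near o v i) (λ x → β * val g (ℓ , i) x)) (cong (near o v i *_) (∑-*ˡ (words is r) β (val g (ℓ , i)))))))
      matched : ∀ o → ∑ is (λ i → near o v i * (β * ∑ (words is r) (val g (ℓ , i)))) ≤ ∑ is (near o v) * (β * G g r ℓ)
      matched o = ≤-trans (∑-mono is (λ i → *-monoʳ-≤ (near o v i) (*-monoʳ-≤ β (val-sum g r ℓ i))))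
        (≤-reflexive (∑-*ʳ is (β * G g r ℓ) (near o v)))
      ones : ∑ is (near 0 v) ≡ t
      ones = trans (∑-const is 1) (trans (*-identityʳ (length is)) (length-tabulate {n = t} (λ i → i)))
      bound : ∀ o → K * ω o m * ∑ (words is r) (val g (o ∸ m , v)) + ∑ is (λ i → near o v i * (β * ∑ (words is r) (val g (ℓ , i)))) ≤ G g (suc r) o
      bound zero    = +-mono-≤ (*-mono-≤ (≤-reflexive (cong (K *_) (ω-0 m))) (subst (λ z → ∑ (words is r) (val g (z , v)) ≤ G g r 0) (sym (0∸n≡0 m)) (val-sum g r 0 v)))
        (≤-trans (matched 0) (≤-reflexive (cong (_* (β * G g r ℓ)) ones)))
      bound (suc o) = +-mono-≤ (*-monoʳ-≤ (K * ω (suc o) m) (val-sum g r (suc o ∸ m) v))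
        (≤-trans (matched (suc o)) (*-monoˡ-≤ (β * G g r ℓ) (near-sum o v)))

    price-cover : ∀ o (v : Fin t) c → price n k (cover o v c) ≡ ω o c
    price-cover o       v zero    = refl
    price-cover zero    v (suc c) = cong (n *_) (price-cover zero v c)
    price-cover (suc o) v (suc c) = cong (4 * k *_) (price-cover o v c)

    -- Every block yields one factor q, within `D` if it is matched and as the price of a free
    -- colour if not. Hence q^|x| splits off and the weights of the recursion do not involve the
    -- number of colours.
    val-price : ∀ g s x → coef x * (compat s x * (price n k (rowsFrom s x) * price q 1 x)) * g (proj₁ (final s x)) ≡ val g s x * q ^ length x
    val-price g (o , v) [] = trans (+-identityʳ _) (sym (*-identityʳ _))
    val-price g (o , v) (nothing ∷ x)
      rewrite price-++ n k (cover o v m) (rowsFrom (o ∸ m , v) x) | price-cover o v m =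
      trans (s₁ K (coef x) (compat s′ x) (ω o m) (price n k (rowsFrom s′ x)) q (price q 1 x) (g (proj₁ (final s′ x))))
      (trans (cong (λ z → K * ω o m * q * z) (val-price g s′ x)) (s₂ K (ω o m) q (val g s′ x) (q ^ length x)))
      where
      s′ = (o ∸ m , v)
      s₁ : ∀ K c p w r q y g → K * c * (1 * p * (w * r * (q * y))) * g ≡ K * w * q * (c * (p * (r * y)) * g)
      s₁ = solve-∀
      s₂ : ∀ K w q v y → K * w * q * (v * y) ≡ K * w * v * (q * y)
      s₂ = solve-∀
    val-price g (o , v) (just i ∷ x)
      rewrite price-++ n k (cover m i m) (rowsFrom (ℓ , i) x) | price-cover m i m | ω-full m =
      trans (s₁ (n ^ m) q (coef x) (near o v i) (compat s′ x) ((4 * k) ^ m) (price n k (rowsFrom s′ x)) (price q 1 x) (g (proj₁ (final s′ x))))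
      (trans (cong (λ z → near o v i * (β * q) * z) (val-price g s′ x)) (s₂ (near o v i) β q (val g s′ x) (q ^ length x)))
      where
      s′ = (ℓ , i)
      s₁ : ∀ N q c w p κ r y g → N * q * c * (w * p * (κ * r * (4 * y))) * g ≡ w * (4 * N * κ * q) * (c * (p * (r * y)) * g)
      s₁ = solve-∀
      s₂ : ∀ w b q v y → w * (b * q) * (v * y) ≡ w * (b * v) * (q * y)
      s₂ = solve-∀

    -- An upper bound for K^(r - s) D^s, s the number of atoms among f 0, ..., f (r - 1) that
    -- are shared with the fixed cycle, in a form that expands over words.
    prod : (ℕ → Atom) → ℕ → ℕ
    prod f zero    = 1
    prod f (suc r) = (K + D * ∑ is (λ i → 𝟙 (f 0 ≟A atomOf i))) * prod (f ∘ suc) r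

    prod-cong : ∀ {f g} r → (∀ a → f a ≡ g a) → prod f r ≡ prod g r
    prod-cong zero    e = refl
    prod-cong (suc r) e = cong₂ _*_ (cong (λ z → K + D * ∑ is (λ i → 𝟙 (z ≟A atomOf i))) (e 0)) (prod-cong r (e ∘ suc))

    prod-words : ∀ f r → prod f r ≡ ∑ (words is r) (λ x → coef x * 𝟙 (Atoms.sat? f x))
    prod-words f zero    = refl
    prod-words f (suc r) = sym (begin
      ∑ (words is (suc r)) (λ x → coef x * 𝟙 (Atoms.sat? f x))
        ≡⟨ ∑-words is r _ ⟩
      ∑ (words is r) (λ x → K * coef x * 𝟙 (Atoms.sat? (f ∘ suc) x)) +
      ∑ is (λ i → ∑ (words is r) (λ x → D * coef x * 𝟙 (Atoms.sat? f (just i ∷ x))))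
        ≡⟨ cong₂ _+_
             (trans (∑-cong (words is r) (λ x → *-assoc K (coef x) _)) (trans (∑-*ˡ (words is r) K (λ x → coef x * 𝟙 (Atoms.sat? (f ∘ suc) x))) (cong (K *_) (sym (prod-words (f ∘ suc) r)))))
             (∑-cong is (λ i → trans (∑-cong (words is r) (λ x → trans (cong (D * coef x *_) (𝟙-×-dec (f 0 ≟A atomOf i) (Atoms.sat? (f ∘ suc) x))) (s D (coef x) (𝟙 (f 0 ≟A atomOf i)) (𝟙 (Atoms.sat? (f ∘ suc) x)))))
                (trans (∑-*ˡ (words is r) (D * 𝟙 (f 0 ≟A atomOf i)) (λ x → coef x * 𝟙 (Atoms.sat? (f ∘ suc) x))) (cong (D * 𝟙 (f 0 ≟A atomOf i) *_) (sym (prod-words (f ∘ suc) r)))))) ⟩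
      K * prod (f ∘ suc) r + ∑ is (λ i → D * 𝟙 (f 0 ≟A atomOf i) * prod (f ∘ suc) r)
        ≡⟨ cong (K * prod (f ∘ suc) r +_) (trans (∑-*ʳ is (prod (f ∘ suc) r) (λ i → D * 𝟙 (f 0 ≟A atomOf i))) (cong (_* prod (f ∘ suc) r) (∑-*ˡ is D (λ i → 𝟙 (f 0 ≟A atomOf i))))) ⟩
      K * prod (f ∘ suc) r + D * ∑ is (λ i → 𝟙 (f 0 ≟A atomOf i)) * prod (f ∘ suc) r
        ≡⟨ sym (*-distribʳ-+ (prod (f ∘ suc) r) K _) ⟩
      prod f (suc r) ∎)
      where
      open ≡-Reasoning
      s : ∀ d c x y → d * c * (x * y) ≡ d * x * (c * y)
      s = solve-∀

    module _ (τ : Vec (Fin n) n) (d : Vec (Fin q) t) where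

      Inv : ℕ → State → Set
      Inv j (o , v) = ∀ a → a < o → τ ⟨ j * m + a ⟩ ∈ₛ S v

      shift : ∀ j a → τ ⟨ suc j * m + a ⟩ ≡ τ ⟨ j * m + (m + a) ⟩
      shift j a = cong (τ ⟨_⟩) (s m (j * m) a)
        where
        s : ∀ x y z → x + y + z ≡ y + (x + z)
        s = solve-∀

      hit-vertices : ∀ j i → atom τ d j ≡ atomOf i → ∀ a → a < k → τ ⟨ j * m + a ⟩ ∈ₛ S i
      hit-vertices j i e a a<k = subst (τ ⟨ j * m + a ⟩ ∈ₛ_) (cong proj₁ e) (∈-segment k τ (j * m) a a<k)

      Inv-hit : ∀ j i → atom τ d j ≡ atomOf i → Inv (suc j) (ℓ , i)
      Inv-hit j i e a a<ℓ = subst (_∈ₛ S i) (sym (shift j a))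
        (hit-vertices j i e (m + a) (≤-trans (+-monoʳ-< m a<ℓ) (≤-reflexive m+ℓ≡k)))

      Inv-skip : ∀ j o v → Inv j (o , v) → Inv (suc j) (o ∸ m , v)
      Inv-skip j o v I a a<o∸m = subst (_∈ₛ S v) (sym (shift j a)) (I (m + a) (subst (m + a <_) (m+[n∸m]≡n m≤o) (+-monoʳ-< m a<o∸m)))
        where
        m≤o : m ≤ o
        m≤o = <⇒≤ (m∸n≢0⇒n<m (λ e → n≮0 (subst (a <_) e a<o∸m)))

      m≤k : m ≤ k
      m≤k = ≤-trans (m≤m+n m ℓ) (≤-reflexive m+ℓ≡k)

      cover-hit : ∀ j i → atom τ d j ≡ atomOf i → Vertices.Sat (λ a → τ ⟨ j * m + a ⟩) (cover m i m)
      cover-hit j i e = Sat-cover {R = λ i u → u ∈ₛ S i} (λ i u → u ∈ₛ? S i) (λ a → τ ⟨ j * m + a ⟩) m i m (λ a a<m → hit-vertices j i e a (≤-trans a<m m≤k))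

      -- Walks along a matched word while maintaining `Inv`. The final invariant is kept for the
      -- wrap-around in `match-≤`. If a match occurs while a chain is running, position j m lies in
      -- the old edge and in the new one, which makes `near` positive.
      trace : ∀ x j s → Inv j s → Atoms.Sat (λ a → atom τ d (j + a)) x →
        Vertices.Sat (λ a → τ ⟨ j * m + a ⟩) (rowsFrom s x) × Inv (j + length x) (final s x) × 1 ≤ compat s x
      trace [] j s I p = tt , subst (λ z → Inv z s) (sym (+-identityʳ j)) I , ≤-refl
      trace (g ∷ x) j s I p =
          Vertices.Sat-++ (λ a → τ ⟨ j * m + a ⟩) (block s g) (rowsFrom (step s g) x) (here-sat g s I p)
            (Vertices.Sat-cong {f = λ a → τ ⟨ suc j * m + a ⟩} {g = λ a → τ ⟨ j * m + (length (block s g) + a) ⟩} (rowsFrom (step s g) x) (λ a → trans (shift j a) (cong (λ z → τ ⟨ j * m + (z + a) ⟩) (sym (length-block g)))) (proj₁ rec))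
        , subst (λ z → Inv z (final (step s g) x)) (sym (+-suc j (length x))) (proj₁ (proj₂ rec))
        , *-mono-≤ (here-near g s I p) (proj₂ (proj₂ rec))
        where
        length-block : ∀ g → length (block s g) ≡ m
        length-block nothing  = length-cover (proj₁ s) (proj₂ s) m
        length-block (just i) = length-cover m i m
        shift-atoms : ∀ a → atom τ d (j + suc a) ≡ atom τ d (suc j + a)
        shift-atoms a = cong (atom τ d) (+-suc j a)
        at-j : ∀ {i} → atom τ d (j + 0) ≡ atomOf i → atom τ d j ≡ atomOf i
        at-j = trans (cong (atom τ d) (sym (+-identityʳ j)))
        here-sat : ∀ g s → Inv j s → Atoms.Sat (λ a → atom τ d (j + a)) (g ∷ x) → Vertices.Sat (λ a → τ ⟨ j * m + a ⟩) (block s g)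
        here-sat nothing  (o , v) I p       = Sat-cover {R = λ i u → u ∈ₛ S i} (λ i u → u ∈ₛ? S i) (λ a → τ ⟨ j * m + a ⟩) o v m I
        here-sat (just i) s       I (e , p) = cover-hit j i (at-j e)
        here-near : ∀ g s → Inv j s → Atoms.Sat (λ a → atom τ d (j + a)) (g ∷ x) → 1 ≤ nearBy s g
        here-near nothing  s           I p       = ≤-refl
        here-near (just i) (zero , v)  I p       = ≤-refl
        here-near (just i) (suc o , v) I (e , p) = ≤-trans
          (≤-reflexive (sym (cong₂ _*_ (𝟙-yes (u ∈ₛ? S v) (I 0 (s≤s z≤n))) (𝟙-yes (u ∈ₛ? S i) (hit-vertices j i (at-j e) 0 0<k)))))
          (∑-∈-≤ (λ u → 𝟙 (u ∈ₛ? S v) * 𝟙 (u ∈ₛ? S i)) (∈-tabulate⁺ {f = λ i → i} u))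
          where
          u = τ ⟨ j * m + 0 ⟩
          0<k : 0 < k
          0<k = ≤-trans 1≤m m≤k
        next : ∀ g s → Inv j s → Atoms.Sat (λ a → atom τ d (j + a)) (g ∷ x) → Inv (suc j) (step s g)
        next nothing  (o , v) I p       = Inv-skip j o v I
        next (just i) s       I (e , p) = Inv-hit j i (at-j e)
        tail : ∀ g → Atoms.Sat (λ a → atom τ d (j + a)) (g ∷ x) → Atoms.Sat (λ a → atom τ d (suc j + a)) x
        tail nothing  p       = Atoms.Sat-cong {f = λ a → atom τ d (j + suc a)} {g = λ a → atom τ d (suc j + a)} x shift-atoms p
        tail (just i) (e , p) = Atoms.Sat-cong {f = λ a → atom τ d (j + suc a)} {g = λ a → atom τ d (suc j + a)} x shift-atoms p
        rec = trace x (suc j) (step s g) (next g s I p) (tail g p)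

      colours-sat : ∀ x (f : ℕ → ℕ) → Atoms.Sat (λ a → atom τ d (f a)) x → Colours.Sat (λ a → d ⟨ f a ⟩) x
      colours-sat []            f p       = tt
      colours-sat (nothing ∷ x) f p       = colours-sat x (f ∘ suc) p
      colours-sat (just i ∷ x)  f (e , p) = cong proj₂ e , colours-sat x (f ∘ suc) p

    -- The pattern for all n positions. Those before block b receive what overhangs in the final
    -- state, and from block b on the word is followed from `(0 , i)`, a state in which no chain is
    -- running.
    rows : ℕ → Fin t → List (Maybe (Fin t)) → List (Maybe (Fin t))
    rows b i x = cover (proj₁ (final (ℓ , i) x)) (proj₂ (final (ℓ , i) x)) (b * m) ++ rowsFrom (0 , i) (just i ∷ x)

    cols : ℕ → Fin t → List (Maybe (Fin t)) → List (Maybe (Fin t))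
    cols b i x = replicate b nothing ++ just i ∷ x

    -- The chain alive at the end of the word wraps around and constrains the first positions.
    match-≤ : ∀ τ d b i x → b + suc (length x) ≡ t →
      𝟙 (Atoms.sat? (λ a → atom τ d (b + a)) (just i ∷ x)) ≤
      compat (ℓ , i) x * (Vertices.weight (rows b i x) τ * Colours.weight (cols b i x) d)
    match-≤ τ d b i x eq = 𝟙-≤ (Atoms.sat? (λ a → atom τ d (b + a)) (just i ∷ x)) λ p →
      let rs , inv , near≥1 = trace τ d (just i ∷ x) b (0 , i) (λ _ ()) p
          o , v = final (ℓ , i) x
          prefix : Vertices.Sat (τ ⟨_⟩) (cover o v (b * m))
          prefix = Sat-cover {R = λ i u → u ∈ₛ S i} (λ i u → u ∈ₛ? S i) (τ ⟨_⟩) o v (b * m) (λ a a<o → subst (_∈ₛ S v)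
            (trans (cong (λ z → τ ⟨ z * m + a ⟩) eq) (⟨⟩-periodic τ a)) (inv a a<o))
          vertices : Vertices.weight (rows b i x) τ ≡ 1
          vertices = Vertices.Sat⇒weight (τ ⟨_⟩) (rows b i x) τ (⟨⟩-lookup τ)
            (Vertices.Sat-++ (τ ⟨_⟩) (cover o v (b * m)) (rowsFrom (0 , i) (just i ∷ x)) prefix
              (Vertices.Sat-cong {f = λ a → τ ⟨ b * m + a ⟩} {g = λ a → τ ⟨ length (cover o v (b * m)) + a ⟩} (rowsFrom (0 , i) (just i ∷ x)) (λ a → cong (λ z → τ ⟨ z + a ⟩) (sym (length-cover o v (b * m)))) rs))
          colours : Colours.weight (cols b i x) d ≡ 1
          colours = Colours.Sat⇒weight (d ⟨_⟩) (cols b i x) d (⟨⟩-lookup d)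
            (Colours.Sat-++ (d ⟨_⟩) (replicate b nothing) (just i ∷ x) (Sat-replicate-nothing {R = λ i c → c ≡ C i} (λ i c → c Fin.≟ C i) (d ⟨_⟩) b)
              (Colours.Sat-cong {f = λ a → d ⟨ b + a ⟩} {g = λ a → d ⟨ length (replicate {A = Maybe (Fin t)} b nothing) + a ⟩} (just i ∷ x) (λ a → cong (λ z → d ⟨ z + a ⟩) (sym (length-replicate b)))
                (colours-sat τ d (just i ∷ x) (b +_) p)))
      in ≤-trans (subst (1 ≤_) (+-identityʳ _) near≥1)
           (≤-reflexive (trans (sym (*-identityʳ _)) (cong (compat (ℓ , i) x *_) (sym (cong₂ _*_ vertices colours)))))

    length-rowsFrom : ∀ s x → length (rowsFrom s x) ≡ length x * m
    length-rowsFrom s []      = refl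
    length-rowsFrom s (g ∷ x) = trans (length-++ (block s g)) (cong₂ _+_ (length-block s g) (length-rowsFrom (step s g) x))
      where
      length-block : ∀ s g → length (block s g) ≡ m
      length-block (o , v) nothing  = length-cover o v m
      length-block (o , v) (just i) = length-cover m i m

    length-rows : ∀ b i x → b + suc (length x) ≡ t → length (rows b i x) ≡ n
    length-rows b i x eq = trans (length-++ (cover (proj₁ (final (ℓ , i) x)) (proj₂ (final (ℓ , i) x)) (b * m)))
      (trans (cong₂ _+_ (length-cover (proj₁ (final (ℓ , i) x)) (proj₂ (final (ℓ , i) x)) (b * m)) (length-rowsFrom (0 , i) (just i ∷ x)))
        (trans (sym (*-distribʳ-+ m b (suc (length x)))) (cong (_* m) eq)))

    length-cols : ∀ b i x → b + suc (length x) ≡ t → length (cols b i x) ≡ t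
    length-cols b i x eq = trans (length-++ (replicate b nothing)) (trans (cong (_+ suc (length x)) (length-replicate b)) eq)

    τs : List (Vec (Fin n) n)
    τs = arrangements n (allFin n)

    ds : List (Vec (Fin q) t)
    ds = arrangements t (allFin q)

    length-allFin : ∀ N → length (allFin N) ≡ N
    length-allFin N = length-tabulate {n = N} (λ i → i)

    vertex-count : ∀ x → length x ≡ n → ∑ τs (Vertices.weight x) * n ^ n ≤ length τs * price n k x
    vertex-count x e = subst (λ N → ∑ τs (Vertices.weight x) * N ^ n ≤ length τs * price N k x) (length-allFin n)
      (subst (λ l → ∑ (arrangements l (allFin n)) (Vertices.weight x) * length (allFin n) ^ l ≤ length (arrangements l (allFin n)) * price (length (allFin n)) k x) e
        (Vertices.perm-price k x (allFin n) size (≤-reflexive (trans e (sym (length-allFin n))))))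

    colour-count : ∀ x → length x ≡ t → ∑ ds (Colours.weight x) * q ^ t ≤ length ds * price q 1 x
    colour-count x e = subst (λ N → ∑ ds (Colours.weight x) * N ^ t ≤ length ds * price N 1 x) (length-allFin q)
      (subst (λ l → ∑ (arrangements l (allFin q)) (Colours.weight x) * length (allFin q) ^ l ≤ length (arrangements l (allFin q)) * price (length (allFin q)) 1 x) e
        (Colours.perm-price 1 x (allFin q) (λ i → ∑-allFin-𝟙 (Fin._≟ C i) (λ _ _ p q → trans p (sym q)))
          (≤-trans (≤-reflexive e) (≤-trans t≤q (≤-reflexive (sym (length-allFin q)))))))

    ∑∑ : (Vec (Fin n) n → Vec (Fin q) t → ℕ) → ℕ
    ∑∑ f = ∑ τs (λ τ → ∑ ds (f τ))

    ∑∑-mono : ∀ {f g} → (∀ τ d → f τ d ≤ g τ d) → ∑∑ f ≤ ∑∑ g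
    ∑∑-mono e = ∑-mono τs (λ τ → ∑-mono ds (e τ))

    ∑∑-cong : ∀ {f g} → (∀ τ d → f τ d ≡ g τ d) → ∑∑ f ≡ ∑∑ g
    ∑∑-cong e = ∑-cong τs (λ τ → ∑-cong ds (e τ))

    ∑∑-*ˡ : ∀ c f → ∑∑ (λ τ d → c * f τ d) ≡ c * ∑∑ f
    ∑∑-*ˡ c f = trans (∑-cong τs (λ τ → ∑-*ˡ ds c (f τ))) (∑-*ˡ τs c (λ τ → ∑ ds (f τ)))

    ∑∑-+ : ∀ f g → ∑∑ (λ τ d → f τ d + g τ d) ≡ ∑∑ f + ∑∑ g
    ∑∑-+ f g = trans (∑-cong τs (λ τ → ∑-+ ds _ _)) (∑-+ τs _ _)

    ∑∑-∑ : ∀ {B : Set} (xs : List B) (f : Vec (Fin n) n → Vec (Fin q) t → B → ℕ) → ∑∑ (λ τ d → ∑ xs (f τ d)) ≡ ∑ xs (λ x → ∑∑ (λ τ d → f τ d x))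
    ∑∑-∑ xs f = trans (∑-cong τs (λ τ → ∑-swap ds xs (f τ))) (∑-swap τs xs (λ τ x → ∑ ds (λ d → f τ d x)))

    ∑∑-product : ∀ f g → ∑∑ (λ τ d → f τ * g d) ≡ ∑ τs f * ∑ ds g
    ∑∑-product f g = trans (∑-cong τs (λ τ → ∑-*ˡ ds (f τ) g)) (∑-*ʳ τs (∑ ds g) f)

    N : ℕ
    N = length τs * length ds

    interchange : ∀ c p X Y u v T L R Q → X * u ≤ T * R → Y * v ≤ L * Q →
      c * (p * (X * Y)) * (u * v) ≤ T * L * (c * p * (R * Q))
    interchange c p X Y u v T L R Q h₁ h₂ = begin
      c * (p * (X * Y)) * (u * v)     ≡⟨ s₁ c p X Y u v ⟩
      c * p * (X * u * (Y * v))       ≤⟨ *-monoʳ-≤ (c * p) (*-mono-≤ h₁ h₂) ⟩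
      c * p * (T * R * (L * Q))       ≡⟨ s₂ c p T R L Q ⟩
      T * L * (c * p * (R * Q))       ∎
      where
      open ≤-Reasoning
      s₁ : ∀ c p x y a b → c * (p * (x * y)) * (a * b) ≡ c * p * (x * a * (y * b))
      s₁ = solve-∀
      s₂ : ∀ c p T R L Q → c * p * (T * R * (L * Q)) ≡ T * L * (c * p * (R * Q))
      s₂ = solve-∀

    -- The ordering and the colour sequence vary independently, so the sum over pairs factors into
    -- two permanents. `perm-price` bounds each of them, and `val-price` evaluates the product of
    -- the prices.
    word-count : ∀ b i x → b + suc (length x) ≡ t →
      coef (just i ∷ x) * ∑∑ (λ τ d → 𝟙 (Atoms.sat? (λ a → atom τ d (b + a)) (just i ∷ x))) * (n ^ n * q ^ t) ≤
      N * (β * val (λ o → ω o (b * m)) (ℓ , i) x * q ^ t)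
    word-count b i x eq = ≤-trans step₁ (≤-trans step₂ (≤-reflexive (cong (N *_) step₃)))
      where
      w : List (Maybe (Fin t))
      w = just i ∷ x
      R Q : List (Maybe (Fin t))
      R = rows b i x
      Q = cols b i x
      p o PR PC X Y : ℕ
      p = compat (ℓ , i) x
      o = proj₁ (final (ℓ , i) x)
      PR = price n k (rowsFrom (0 , i) w)
      PC = price q 1 w
      X = ∑ τs (Vertices.weight R)
      Y = ∑ ds (Colours.weight Q)
      g : ℕ → ℕ
      g o = ω o (b * m)
      priceR : price n k R ≡ g o * PR
      priceR = trans (price-++ n k (cover o _ (b * m)) _) (cong (_* PR) (price-cover o _ (b * m)))
      priceQ : price q 1 Q ≡ q ^ b * PC
      priceQ = trans (price-++ q 1 (replicate b nothing) w) (cong (_* PC) (price-replicate-nothing q 1 b))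
      step₁ : coef w * ∑∑ (λ τ d → 𝟙 (Atoms.sat? (λ a → atom τ d (b + a)) w)) * (n ^ n * q ^ t) ≤
              coef w * (p * (X * Y)) * (n ^ n * q ^ t)
      step₁ = *-monoˡ-≤ (n ^ n * q ^ t) (*-monoʳ-≤ (coef w) (≤-trans (∑∑-mono (λ τ d → match-≤ τ d b i x eq))
        (≤-reflexive (trans (∑∑-*ˡ p (λ τ d → Vertices.weight R τ * Colours.weight Q d)) (cong (p *_) (∑∑-product (Vertices.weight R) (Colours.weight Q)))))))
      step₂ : coef w * (p * (X * Y)) * (n ^ n * q ^ t) ≤ N * (coef w * p * (price n k R * price q 1 Q))
      step₂ = interchange (coef w) p X Y (n ^ n) (q ^ t) (length τs) (length ds) (price n k R) (price q 1 Q)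
        (vertex-count R (length-rows b i x eq)) (colour-count Q (length-cols b i x eq))
      step₃ : coef w * p * (price n k R * price q 1 Q) ≡ β * val g (ℓ , i) x * q ^ t
      step₃ = trans (cong₂ (λ y z → coef w * p * (y * z)) priceR priceQ)
        (trans (s₂ (coef w) p (g o) PR (q ^ b) PC)
        (trans (cong (q ^ b *_) (val-price g (0 , i) w))
        (trans (s₃ (q ^ b) (β * val g (ℓ , i) x) (q ^ suc (length x)))
        (cong (β * val g (ℓ , i) x *_) (trans (sym (^-distribˡ-+-* q b (suc (length x)))) (cong (q ^_) eq))))))
        where
        s₂ : ∀ c p g r q y → c * p * (g * r * (q * y)) ≡ q * (c * (1 * p * (r * y)) * g)
        s₂ = solve-∀
        s₃ : ∀ b v y → b * (1 * v * y) ≡ v * (b * y)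
        s₃ = solve-∀

    -- Splits at block b. If its letter is `nothing`, the factor K joins K^b and the induction
    -- proceeds to block b + 1. If it is `just i`, block b is the first match and the remaining
    -- product is expanded into words, which `word-count` and `val-sum` handle.
    prod-count : ∀ b r → b + r ≡ t →
      K ^ b * ∑∑ (λ τ d → prod (λ a → atom τ d (b + a)) r) * (n ^ n * q ^ t) ≤ N * (total b r * q ^ t)
    prod-count b zero eq = ≤-reflexive (trans
      (cong (λ z → K ^ b * z * (n ^ n * q ^ t)) (trans (∑-cong τs (λ τ → ∑-const ds 1)) (trans (∑-const τs _) (cong (length τs *_) (*-identityʳ _)))))
      (trans (cong (λ z → K ^ b * N * (n ^ (z * m) * q ^ t)) (trans (sym eq) (+-identityʳ b))) (s (K ^ b) N (n ^ (b * m)) (q ^ t))))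
      where
      s : ∀ a b c d → a * b * (c * d) ≡ b * (a * c * d)
      s = solve-∀
    prod-count b (suc r) eq = begin
      K ^ b * ∑∑ (λ τ d → prod (f τ d) (suc r)) * Z
        ≡⟨ cong (λ z → K ^ b * z * Z) (trans (∑∑-cong split) (trans (∑∑-+ (λ τ d → K * P τ d) (λ τ d → ∑ is (λ i → ∑ (words is r) (λ x → coef (just i ∷ x) * M i x τ d)))) (cong₂ _+_ (∑∑-*ˡ K P) (trans (∑∑-∑ is (λ τ d i → ∑ (words is r) (λ x → coef (just i ∷ x) * M i x τ d))) (∑-cong is (λ i → ∑∑-∑ (words is r) (λ τ d x → coef (just i ∷ x) * M i x τ d))))))) ⟩
      K ^ b * (K * rest + ∑ is (λ i → ∑ (words is r) (λ x → ∑∑ (λ τ d → coef (just i ∷ x) * M i x τ d)))) * Z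
        ≡⟨ s₁ (K ^ b) K rest _ Z ⟩
      K ^ b * (∑ is (λ i → ∑ (words is r) (λ x → ∑∑ (λ τ d → coef (just i ∷ x) * M i x τ d))) * Z) + K ^ suc b * rest * Z
        ≤⟨ +-mono-≤ (*-monoʳ-≤ (K ^ b) matched) (prod-count (suc b) r (trans (sym (+-suc b r)) eq)) ⟩
      K ^ b * (N * (t * (β * G g r ℓ) * q ^ t)) + N * (total (suc b) r * q ^ t)
        ≡⟨ s₂ (K ^ b) N (t * (β * G g r ℓ)) (q ^ t) (total (suc b) r) ⟩
      N * (total b (suc r) * q ^ t) ∎
      where
      open ≤-Reasoning
      Z = n ^ n * q ^ t
      f : Vec (Fin n) n → Vec (Fin q) t → ℕ → Atom
      f τ d a = atom τ d (b + a)
      g : ℕ → ℕ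
      g o = ω o (b * m)
      P : Vec (Fin n) n → Vec (Fin q) t → ℕ
      P τ d = prod (λ a → atom τ d (suc b + a)) r
      rest = ∑∑ P
      M : Fin t → List (Maybe (Fin t)) → Vec (Fin n) n → Vec (Fin q) t → ℕ
      M i x τ d = 𝟙 (Atoms.sat? (f τ d) (just i ∷ x))
      T : Fin t → List (Maybe (Fin t)) → ℕ
      T i x = ∑∑ (λ τ d → coef (just i ∷ x) * M i x τ d)
      s₁ : ∀ k K r x z → k * (K * r + x) * z ≡ k * (x * z) + K * k * r * z
      s₁ = solve-∀
      s₂ : ∀ k N x q y → k * (N * (x * q)) + N * (y * q) ≡ N * ((k * x + y) * q)
      s₂ = solve-∀
      split : ∀ τ d → prod (f τ d) (suc r) ≡
        K * prod (λ a → atom τ d (suc b + a)) r + ∑ is (λ i → ∑ (words is r) (λ x → coef (just i ∷ x) * M i x τ d))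
      split τ d = trans (prod-words (f τ d) (suc r)) (trans (∑-words is r _) (cong (_+ ∑ is (λ i → ∑ (words is r) (λ x → coef (just i ∷ x) * M i x τ d)))
        (trans (trans (∑-cong (words is r) (λ x → *-assoc K (coef x) _)) (∑-*ˡ (words is r) K (λ x → coef x * 𝟙 (Atoms.sat? (f τ d ∘ suc) x))))
          (cong (K *_) (trans (sym (prod-words (f τ d ∘ suc) r)) (prod-cong r (λ a → cong (atom τ d) (+-suc b a))))))))
      one : ∀ i x → x ∈ words is r → ∑∑ (λ τ d → coef (just i ∷ x) * M i x τ d) * Z ≤ N * (β * val g (ℓ , i) x * q ^ t)
      one i x x∈ = ≤-trans (≤-reflexive (cong (_* Z) (∑∑-*ˡ (coef (just i ∷ x)) (M i x))))
        (word-count b i x (trans (cong (λ z → b + suc z) (length-words is r x∈)) eq))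
      matched : ∑ is (λ i → ∑ (words is r) (λ x → ∑∑ (λ τ d → coef (just i ∷ x) * M i x τ d))) * Z ≤ N * (t * (β * G g r ℓ) * q ^ t)
      matched = begin
        ∑ is (λ i → ∑ (words is r) (λ x → ∑∑ (λ τ d → coef (just i ∷ x) * M i x τ d))) * Z
          ≡⟨ sym (trans (∑-cong is (λ i → ∑-*ʳ (words is r) Z (T i))) (∑-*ʳ is Z (λ i → ∑ (words is r) (T i)))) ⟩
        ∑ is (λ i → ∑ (words is r) (λ x → ∑∑ (λ τ d → coef (just i ∷ x) * M i x τ d) * Z))
          ≤⟨ ∑-mono is (λ i → ∑-mono-∈ (words is r) (one i)) ⟩
        ∑ is (λ i → ∑ (words is r) (λ x → N * (β * val g (ℓ , i) x * q ^ t)))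
          ≡⟨ ∑-cong is (λ i → trans (∑-*ˡ (words is r) N (λ x → β * val g (ℓ , i) x * q ^ t)) (cong (N *_) (trans (∑-*ʳ (words is r) (q ^ t) (λ x → β * val g (ℓ , i) x)) (cong (_* q ^ t) (∑-*ˡ (words is r) β (val g (ℓ , i))))))) ⟩
        ∑ is (λ i → N * (β * ∑ (words is r) (val g (ℓ , i)) * q ^ t))
          ≤⟨ ∑-≤-length is (λ i → *-monoʳ-≤ N (*-monoˡ-≤ (q ^ t) (*-monoʳ-≤ β (val-sum g r ℓ i)))) ⟩
        length is * (N * (β * G g r ℓ * q ^ t))
          ≡⟨ trans (cong (_* (N * (β * G g r ℓ * q ^ t))) (length-allFin t)) (s₃ t N (β * G g r ℓ) (q ^ t)) ⟩
        N * (t * (β * G g r ℓ) * q ^ t) ∎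
        where
        s₃ : ∀ t N x q → t * (N * (x * q)) ≡ N * (t * x * q)
        s₃ = solve-∀

    overlap-bound : ∀ e → e * total 0 t ≤ suc e * (K * n ^ m) ^ t →
      e * ∑∑ (λ τ d → prod (atom τ d) t) ≤ suc e * (N * K ^ t)
    overlap-bound e h = *-cancelʳ-≤ _ _ Z {{m*n≢0 (n ^ n) (q ^ t) {{m^n≢0 n n}} {{m^n≢0 q t}}}} (begin
      e * T * Z                                   ≡⟨ *-assoc e T Z ⟩
      e * (T * Z)                                 ≡⟨ cong (λ z → e * (z * Z)) (sym (+-identityʳ T)) ⟩
      e * ((T + 0) * Z)                           ≤⟨ *-monoʳ-≤ e (prod-count 0 t refl) ⟩
      e * (N * (total 0 t * q ^ t))               ≡⟨ s₁ e N (total 0 t) (q ^ t) ⟩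
      N * (e * total 0 t) * q ^ t                 ≤⟨ *-monoˡ-≤ (q ^ t) (*-monoʳ-≤ N h) ⟩
      N * (suc e * U ^ t) * q ^ t                 ≡⟨ cong (λ z → N * (suc e * z) * q ^ t) (U^ t) ⟩
      N * (suc e * (K ^ t * n ^ n)) * q ^ t       ≡⟨ s₂ N (suc e) (K ^ t) (n ^ n) (q ^ t) ⟩
      suc e * (N * K ^ t) * Z                     ∎)
      where
      open ≤-Reasoning
      T Z : ℕ
      T = ∑∑ (λ τ d → prod (atom τ d) t)
      Z = n ^ n * q ^ t
      s₁ : ∀ e N x q → e * (N * (x * q)) ≡ N * (e * x) * q
      s₁ = solve-∀
      s₂ : ∀ N e k x q → N * (e * (k * x)) * q ≡ e * (N * k) * (x * q)
      s₂ = solve-∀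

  -- Segments of cyclic orders

  Unique-resp-↭ : ∀ {xs ys : List A} → xs ↭ ys → Unique xs → Unique ys
  Unique-resp-↭ ↭.refl          u               = u
  Unique-resp-↭ (↭.prep x p)    (x∉ ∷ u)        = ↭ₚ.All-resp-↭ p x∉ ∷ Unique-resp-↭ p u
  Unique-resp-↭ (↭.swap x y p)  ((x≢y ∷ x∉) ∷ y∉ ∷ u) =
    ((λ e → x≢y (sym e)) ∷ ↭ₚ.All-resp-↭ p y∉) ∷ ↭ₚ.All-resp-↭ p x∉ ∷ Unique-resp-↭ p u
  Unique-resp-↭ (↭.trans p₁ p₂) u               = Unique-resp-↭ p₂ (Unique-resp-↭ p₁ u)

  Unique-++⁻ˡ : ∀ (xs : List A) {ys} → Unique (xs ++ ys) → Unique xs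
  Unique-++⁻ˡ []       u        = []
  Unique-++⁻ˡ (x ∷ xs) (x∉ ∷ u) = Allₚ.++⁻ˡ xs x∉ ∷ Unique-++⁻ˡ xs u

  picks-↭ : ∀ (V : List A) {v V′} → (v , V′) ∈ picks V → v ∷ V′ ↭ V
  picks-↭ (x ∷ xs) (here refl) = ↭-refl
  picks-↭ (x ∷ xs) (there p) with (y , ys) , q , refl ← ∈-map⁻ (λ (y , ys) → (y , x ∷ ys)) p =
    ↭-trans (swap y x ↭-refl) (prep x (picks-↭ xs q))

  arrangements-↭ : ∀ l (V : List A) {v} → v ∈ arrangements l V → ∃[ W ] toList v ++ W ↭ V
  arrangements-↭ zero    V (here refl) = V , ↭-refl
  arrangements-↭ (suc l) V p with (x , V′) , q , p′ ← find (∈-concatMap⁻ (λ (v , V′) → map (v ∷_) (arrangements l V′)) {xs = picks V} p)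
    with w , w∈ , refl ← ∈-map⁻ (x ∷_) p′ =
    let W , W↭ = arrangements-↭ l V′ w∈ in W , ↭-trans (prep x W↭) (picks-↭ V q)

  arrangements-unique : ∀ l {V : List A} {v} → Unique V → v ∈ arrangements l V → Unique (toList v)
  arrangements-unique l {V} {v} u v∈ =
    let W , W↭ = arrangements-↭ l V v∈ in Unique-++⁻ˡ (toList v) (Unique-resp-↭ (↭-sym W↭) u)

  arrangements-full : ∀ n {v} → v ∈ arrangements n (allFin n) → ∀ u → u ∈ toList v
  arrangements-full n {v} v∈ u with arrangements-↭ n (allFin n) v∈
  ... | []    , W↭ = subst (u ∈_) (++-identityʳ (toList v)) (↭ₚ.∈-resp-↭ (↭-sym W↭) (∈-allFin u))
  ... | w ∷ W , W↭ = ⊥-elim (m+1+n≢m n (trans (cong (_+ suc (length W)) (sym (length-toList v)))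
    (trans (sym (length-++ (toList v))) (trans (↭ₚ.↭-length W↭) (length-tabulate {n = n} (λ i → i))))))

  lookup-injective : ∀ {l} {v : Vec A l} → Unique (toList v) → ∀ {i j} → lookup v i ≡ lookup v j → i ≡ j
  lookup-injective {v = x ∷ v} u        {zero}  {zero}  e = refl
  lookup-injective {v = x ∷ v} (x∉ ∷ u) {zero}  {suc j} e = ⊥-elim (All.lookup x∉ (lookup-∈ v j) e)
    where
    lookup-∈ : ∀ {l} (v : Vec _ l) j → lookup v j ∈ toList v
    lookup-∈ (x ∷ v) zero    = here refl
    lookup-∈ (x ∷ v) (suc j) = there (lookup-∈ v j)
  lookup-injective {v = x ∷ v} (x∉ ∷ u) {suc i} {zero}  e = sym (lookup-injective {v = x ∷ v} (x∉ ∷ u) {zero} {suc i} (sym e))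
  lookup-injective {v = x ∷ v} (x∉ ∷ u) {suc i} {suc j} e = cong suc (lookup-injective u e)

  ⟨⟩-injective : ∀ {N} .{{_ : NonZero N}} {v : Vec A N} → Unique (toList v) → ∀ {a b} → v ⟨ a ⟩ ≡ v ⟨ b ⟩ → a % N ≡ b % N
  ⟨⟩-injective u e = trans (sym (Fin.toℕ-fromℕ< _)) (trans (cong toℕ (lookup-injective u e)) (Fin.toℕ-fromℕ< _))

  module _ {N : ℕ} .{{_ : NonZero N}} where

    %≡⇒multiple : ∀ {a b} → a ≤ b → a % N ≡ b % N → ∃[ c ] b ≡ a + c * N
    %≡⇒multiple {a} {b} a≤b e = b / N ∸ a / N , (begin
      b                                              ≡⟨ m≡m%n+[m/n]*n b N ⟩
      b % N + b / N * N                              ≡⟨ cong₂ (λ x y → x + y * N) (sym e) (sym (m+[n∸m]≡n (/-monoˡ-≤ N a≤b))) ⟩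
      a % N + (a / N + (b / N ∸ a / N)) * N          ≡⟨ s (a % N) (a / N) (b / N ∸ a / N) N ⟩
      a % N + a / N * N + (b / N ∸ a / N) * N        ≡⟨ cong (_+ (b / N ∸ a / N) * N) (sym (m≡m%n+[m/n]*n a N)) ⟩
      a + (b / N ∸ a / N) * N                        ∎)
      where
      open ≡-Reasoning
      s : ∀ r x y n → r + (x + y) * n ≡ r + x * n + y * n
      s = solve-∀

    %≡-shift : ∀ {a b} c → a % N ≡ b % N → (a + c) % N ≡ (b + c) % N
    %≡-shift {a} {b} c e = trans (%-distribˡ-+ a c N) (trans (cong (λ z → (z + c % N) % N) e) (sym (%-distribˡ-+ b c N)))

    multiple<⇒0 : ∀ {x c} → x ≡ c * N → x < N → x ≡ 0
    multiple<⇒0 {x} {zero}  e x<N = e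
    multiple<⇒0 {x} {suc c} e x<N = ⊥-elim (<⇒≱ x<N (≤-trans (m≤m+n N (c * N)) (≤-reflexive (sym e))))

    %≡-cancel-≤ : ∀ s {a b} → a ≤ b → b < N → (s + a) % N ≡ (s + b) % N → a ≡ b
    %≡-cancel-≤ s {a} {b} a≤b b<N e =
      let c , eq = %≡⇒multiple (+-monoʳ-≤ s a≤b) e
          δ : b ∸ a ≡ c * N
          δ = +-cancelˡ-≡ (s + a) (b ∸ a) (c * N) (trans (+-assoc s a (b ∸ a)) (trans (cong (s +_) (m+[n∸m]≡n a≤b)) eq))
      in ≤-antisym a≤b (m∸n≡0⇒m≤n (multiple<⇒0 {c = c} δ (≤-<-trans (m∸n≤m b a) b<N)))

    %≡-cancel-+ : ∀ s {a b} → a < N → b < N → (s + a) % N ≡ (s + b) % N → a ≡ b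
    %≡-cancel-+ s {a} {b} a<N b<N e with ≤-total a b
    ... | inj₁ a≤b = %≡-cancel-≤ s a≤b b<N e
    ... | inj₂ b≤a = sym (%≡-cancel-≤ s b≤a a<N (sym e))

  ∈-vertexSet⁻ : ∀ {n} {u : Fin n} us → u ∈ₛ vertexSet us → u ∈ us
  ∈-vertexSet⁻ []       u∈ = ⊥-elim (∉⊥ u∈)
  ∈-vertexSet⁻ (w ∷ us) u∈ with x∈p∪q⁻ ⁅ w ⁆ (vertexSet us) u∈
  ... | inj₁ u∈w = here (x∈⁅y⁆⇒x≡y w u∈w)
  ... | inj₂ u∈′ = there (∈-vertexSet⁻ us u∈′)

  𝟙-vertexSet : ∀ {n} (u : Fin n) us → 𝟙 (u ∈ₛ? vertexSet us) ≤ ∑ us (λ w → 𝟙 (u Fin.≟ w))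
  𝟙-vertexSet u us = 𝟙-≤ (u ∈ₛ? vertexSet us) (λ u∈ → ≤-trans (≤-reflexive (sym (𝟙-yes (u Fin.≟ u) refl)))
    (∑-∈-≤ (λ w → 𝟙 (u Fin.≟ w)) (∈-vertexSet⁻ us u∈)))

  ∣⁅x⁆∪p∣ : ∀ {n} (x : Fin n) p → ¬ (x ∈ₛ p) → ∣ ⁅ x ⁆ ∪ p ∣ ≡ suc ∣ p ∣
  ∣⁅x⁆∪p∣ zero    (inside ∷ p)  x∉ = ⊥-elim (x∉ Vec.here)
  ∣⁅x⁆∪p∣ zero    (outside ∷ p) x∉ = cong (suc ∘ ∣_∣) (∪-identityˡ p)
  ∣⁅x⁆∪p∣ (suc x) (inside ∷ p)  x∉ = cong suc (∣⁅x⁆∪p∣ x p (x∉ ∘ Vec.there))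
  ∣⁅x⁆∪p∣ (suc x) (outside ∷ p) x∉ = ∣⁅x⁆∪p∣ x p (x∉ ∘ Vec.there)

  ∣vertexSet∣ : ∀ {n} {us : List (Fin n)} → Unique us → ∣ vertexSet us ∣ ≡ length us
  ∣vertexSet∣ {n} {[]}     u        = ∣⊥∣≡0 n
  ∣vertexSet∣ {n} {w ∷ us} (w∉ ∷ u) = trans (∣⁅x⁆∪p∣ w (vertexSet us) (λ w∈ → All.lookup w∉ (∈-vertexSet⁻ us w∈) refl)) (cong suc (∣vertexSet∣ u))

  ∈-allSubsets : ∀ {n} (p : Subset n) → p ∈ allSubsets n
  ∈-allSubsets []            = here refl
  ∈-allSubsets (inside ∷ p)  = ∈-++⁺ˡ (∈-map⁺ (inside ∷_) (∈-allSubsets p))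
  ∈-allSubsets (outside ∷ p) = ∈-++⁺ʳ (map (inside ∷_) (allSubsets _)) (∈-map⁺ (outside ∷_) (∈-allSubsets p))

  allSubsets-unique : ∀ n → Unique (allSubsets n)
  allSubsets-unique zero    = [] ∷ []
  allSubsets-unique (suc n) = Uniqueₚ.++⁺ (Uniqueₚ.map⁺ ∷-injectiveʳ (allSubsets-unique n)) (Uniqueₚ.map⁺ ∷-injectiveʳ (allSubsets-unique n)) disjoint
    where
    disjoint : ∀ {p} → ¬ (p ∈ map (inside ∷_) (allSubsets n) × p ∈ map (outside ∷_) (allSubsets n))
    disjoint (a , b) with _ , _ , refl ← ∈-map⁻ (inside ∷_) a with _ , _ , e ← ∈-map⁻ (outside ∷_) b with () ← ∷-injectiveˡ e

  kSubsets-unique : ∀ k n → Unique (kSubsets k n)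
  kSubsets-unique k n = Uniqueₚ.filter⁺ (λ e → ∣ e ∣ ≟ k) (allSubsets-unique n)

  ∈-kSubsets : ∀ {k n} {p : Subset n} → ∣ p ∣ ≡ k → p ∈ kSubsets k n
  ∈-kSubsets {k} {p = p} e = ∈-filter⁺ (λ e → ∣ e ∣ ≟ k) (∈-allSubsets p) e

  vertexSet-full : ∀ {n} {v : Vec (Fin n) n} → v ∈ arrangements n (allFin n) → vertexSet (toList v) ≡ full
  vertexSet-full {n} v∈ = ⊆-antisym ⊆⊤ (λ {u} _ → ∈-vertexSet (arrangements-full n v∈ u))

  segment-size : ∀ {n N} .{{_ : NonZero N}} k (v : Vec (Fin n) N) s → ∑ (allFin n) (λ u → 𝟙 (u ∈ₛ? segment k v s)) ≤ k
  segment-size {n} k v s = begin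
    ∑ (allFin n) (λ u → 𝟙 (u ∈ₛ? vertexSet us))               ≤⟨ ∑-mono (allFin n) (λ u → 𝟙-vertexSet u us) ⟩
    ∑ (allFin n) (λ u → ∑ us (λ w → 𝟙 (u Fin.≟ w)))          ≡⟨ ∑-swap (allFin n) us (λ u w → 𝟙 (u Fin.≟ w)) ⟩
    ∑ us (λ w → ∑ (allFin n) (λ u → 𝟙 (u Fin.≟ w)))          ≤⟨ ∑-≤-length us (λ w → ∑-allFin-𝟙 (Fin._≟ w) (λ _ _ p q → trans p (sym q))) ⟩
    length us * 1                                            ≡⟨ trans (*-identityʳ (length us)) (length-tabulate (λ (j : Fin k) → v ⟨ s + toℕ j ⟩)) ⟩
    k                                                        ∎
    where
    open ≤-Reasoning
    us : List (Fin n)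
    us = tabulate {n = k} (λ j → v ⟨ s + toℕ j ⟩)

  module Segments {t m : ℕ} .{{_ : NonZero (t * m)}} (1≤m : 1 ≤ m) {n : ℕ} (k : ℕ) (k+k≤N : k + k ≤ t * m)
    (v : Vec (Fin n) (t * m)) (unique : Unique (toList v)) where

    start< : ∀ {i} → i < t → i * m < t * m
    start< i<t = *-monoˡ-< m {{>-nonZero 1≤m}} i<t

    start-injective : ∀ {i j} → i * m ≡ j * m → i ≡ j
    start-injective {i} {j} e = *-cancelʳ-≡ i j m {{>-nonZero 1≤m}} e

    -- For each of the k offsets at most one segment has u there, because the starts i m are
    -- distinct modulo t m.
    segment-degree : ∀ u → ∑ (allFin t) (λ i → 𝟙 (u ∈ₛ? segment k v (toℕ i * m))) ≤ k
    segment-degree u = begin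
      ∑ (allFin t) (λ i → 𝟙 (u ∈ₛ? segment k v (toℕ i * m)))
        ≤⟨ ∑-mono (allFin t) (λ i → 𝟙-vertexSet u (tabulate {n = k} (λ j → v ⟨ toℕ i * m + toℕ j ⟩))) ⟩
      ∑ (allFin t) (λ i → ∑ (tabulate {n = k} (λ j → v ⟨ toℕ i * m + toℕ j ⟩)) (λ w → 𝟙 (u Fin.≟ w)))
        ≡⟨ ∑-cong (allFin t) (λ i → trans (cong (λ us → ∑ us (λ w → 𝟙 (u Fin.≟ w))) (sym (map-tabulate {n = k} (λ j → j) (λ j → v ⟨ toℕ i * m + toℕ j ⟩))))
             (∑-map (λ j → v ⟨ toℕ i * m + toℕ j ⟩) (allFin k) (λ w → 𝟙 (u Fin.≟ w)))) ⟩
      ∑ (allFin t) (λ i → ∑ (allFin k) (λ j → 𝟙 (u Fin.≟ v ⟨ toℕ i * m + toℕ j ⟩)))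
        ≡⟨ ∑-swap (allFin t) (allFin k) (λ i j → 𝟙 (u Fin.≟ v ⟨ toℕ i * m + toℕ j ⟩)) ⟩
      ∑ (allFin k) (λ j → ∑ (allFin t) (λ i → 𝟙 (u Fin.≟ v ⟨ toℕ i * m + toℕ j ⟩)))
        ≤⟨ ∑-≤-length (allFin k) (λ j → ∑-allFin-𝟙 (λ i → u Fin.≟ v ⟨ toℕ i * m + toℕ j ⟩) (λ i i′ p q → Fin.toℕ-injective (same i i′ j (trans (sym p) q)))) ⟩
      length (allFin k) * 1
        ≡⟨ trans (*-identityʳ _) (length-tabulate {n = k} (λ i → i)) ⟩
      k ∎
      where
      open ≤-Reasoning
      same : ∀ i i′ (j : Fin k) → v ⟨ toℕ i * m + toℕ j ⟩ ≡ v ⟨ toℕ i′ * m + toℕ j ⟩ → toℕ i ≡ toℕ i′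
      same i i′ j e = start-injective
        (%≡-cancel-+ (toℕ j) (start< (Fin.toℕ<n i)) (start< (Fin.toℕ<n i′))
          (trans (cong (_% (t * m)) (+-comm (toℕ j) (toℕ i * m))) (trans (⟨⟩-injective unique {toℕ i * m + toℕ j} {toℕ i′ * m + toℕ j} e) (cong (_% (t * m)) (+-comm (toℕ i′ * m) (toℕ j))))))

    k≤N : k ≤ t * m
    k≤N = ≤-trans (m≤m+n k k) k+k≤N

    segment-card : ∀ s → ∣ segment k v s ∣ ≡ k
    segment-card s = trans (∣vertexSet∣ (Uniqueₚ.tabulate⁺ {f = λ (j : Fin k) → v ⟨ s + toℕ j ⟩} (λ {i} {j} e → Fin.toℕ-injective
        (%≡-cancel-+ s (<-≤-trans (Fin.toℕ<n i) k≤N) (<-≤-trans (Fin.toℕ<n j) k≤N) (⟨⟩-injective unique {s + toℕ i} {s + toℕ j} e)))))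
      (length-tabulate (λ (j : Fin k) → v ⟨ s + toℕ j ⟩))

    ∈-segment⁻ : ∀ {u} s → u ∈ₛ segment k v s → ∃[ a ] a < k × u ≡ v ⟨ s + a ⟩
    ∈-segment⁻ s u∈ = let j , e = ∈-tabulate⁻ {f = λ (j : Fin k) → v ⟨ s + toℕ j ⟩} (∈-vertexSet⁻ (tabulate {n = k} (λ j → v ⟨ s + toℕ j ⟩)) u∈)
      in toℕ j , Fin.toℕ<n j , e

    -- If the sets agree, each start lies in the other segment: modulo t m, i m is j m + a and j m
    -- is i m + b with a, b < k. So a + b is a multiple of t m below 2k ≤ t m, hence 0.
    segment-injective : 1 ≤ k → ∀ {i j} → i < t → j < t → segment k v (i * m) ≡ segment k v (j * m) → i ≡ j
    segment-injective 1≤k {i} {j} i<t j<t eq = start-injective (trans (sym (m<n⇒m%n≡m (start< i<t)))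
        (trans i≡j+a (trans (cong (λ z → (j * m + z) % (t * m)) a≡0) (trans (cong (_% (t * m)) (+-identityʳ (j * m))) (m<n⇒m%n≡m (start< j<t))))))
      where
      offset : ∀ i j → segment k v (i * m) ≡ segment k v (j * m) → ∃[ a ] a < k × (i * m) % (t * m) ≡ (j * m + a) % (t * m)
      offset i j eq =
        let a , a<k , e = ∈-segment⁻ (j * m) (subst (v ⟨ i * m + 0 ⟩ ∈ₛ_) eq (∈-segment k v (i * m) 0 1≤k))
        in a , a<k , trans (cong (_% (t * m)) (sym (+-identityʳ (i * m)))) (⟨⟩-injective unique {i * m + 0} {j * m + a} e)
      a = proj₁ (offset i j eq)
      a<k = proj₁ (proj₂ (offset i j eq))
      i≡j+a = proj₂ (proj₂ (offset i j eq))
      b = proj₁ (offset j i (sym eq))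
      b<k = proj₁ (proj₂ (offset j i (sym eq)))
      j≡i+b = proj₂ (proj₂ (offset j i (sym eq)))
      b+a≡0 : b + a ≡ 0
      b+a≡0 = %≡-cancel-+ (i * m) (<-≤-trans (+-mono-< b<k a<k) k+k≤N) (≤-<-trans z≤n (start< i<t))
        (trans (cong (_% (t * m)) (sym (+-assoc (i * m) b a)))
          (trans (sym (%≡-shift {a = j * m} {b = i * m + b} a j≡i+b)) (trans (sym i≡j+a) (cong (_% (t * m)) (sym (+-identityʳ (i * m)))))))
      a≡0 : a ≡ 0
      a≡0 = m+n≡0⇒n≡0 b b+a≡0

module Probability where

  open Counting
  open import Data.Nat.Tactic.RingSolver using () renaming (solve-∀ to ℕ-solve-∀)
  open import Data.Rational hiding (NonZero; _≟_)
  open import Data.Rational.Properties hiding (_≟_)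
  open import Tactic.RingSolver using (solve-∀)

  ℚ-ring : ACR.AlmostCommutativeRing 0ℓ 0ℓ
  ℚ-ring = ACR.fromCommutativeRing +-*-commutativeRing (λ x → dec⇒maybe (0ℚ ℚ.≟ x))

  *-monoˡ-≤-0≤ : ∀ {r x y} → 0ℚ ≤ r → x ≤ y → r * x ≤ r * y
  *-monoˡ-≤-0≤ {r} 0≤r = *-monoˡ-≤-nonNeg r {{nonNegative 0≤r}}

  0≤* : ∀ {x y} → 0ℚ ≤ x → 0ℚ ≤ y → 0ℚ ≤ x * y
  0≤* {x} {y} 0≤x 0≤y = ≤-trans (≤-reflexive (sym (*-zeroʳ x))) (*-monoˡ-≤-0≤ 0≤x 0≤y)

  0<* : ∀ {x y} → 0ℚ < x → 0ℚ < y → 0ℚ < x * y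
  0<* {x} {y} 0<x 0<y = subst (_< x * y) (*-zeroʳ x) (*-monoʳ-<-pos x {{positive 0<x}} 0<y)

  0≤+ : ∀ {x y} → 0ℚ ≤ x → 0ℚ ≤ y → 0ℚ ≤ x + y
  0≤+ 0≤x 0≤y = ≤-trans (≤-reflexive (sym (+-identityʳ 0ℚ))) (+-mono-≤ 0≤x 0≤y)

  0≤square : ∀ x → 0ℚ ≤ x * x
  0≤square x with ≤-total 0ℚ x
  ... | inj₁ 0≤x = 0≤* 0≤x 0≤x
  ... | inj₂ x≤0 = subst (0ℚ ≤_) (s x) (0≤* (neg-antimono-≤ x≤0) (neg-antimono-≤ x≤0))
    where
    s : ∀ x → (- x) * (- x) ≡ x * x
    s = solve-∀ ℚ-ring

  -- Expectations over weighted lists, and the second moment inequality.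

  E : Dist A → (A → ℚ) → ℚ
  E []            f = 0ℚ
  E ((x , w) ∷ d) f = w * f x + E d f

  E-cong : ∀ (d : Dist A) {f g} → (∀ x → f x ≡ g x) → E d f ≡ E d g
  E-cong []            e = refl
  E-cong ((x , w) ∷ d) e = cong₂ (λ y z → w * y + z) (e x) (E-cong d e)

  E-++ : ∀ (d d′ : Dist A) f → E (d ++ d′) f ≡ E d f + E d′ f
  E-++ []            d′ f = sym (+-identityˡ _)
  E-++ ((x , w) ∷ d) d′ f = trans (cong (w * f x +_) (E-++ d d′ f)) (sym (+-assoc (w * f x) (E d f) (E d′ f)))

  E-scale : ∀ w (d : Dist A) f → E (map (λ (y , w′) → (y , w * w′)) d) f ≡ w * E d f
  E-scale w []             f = sym (*-zeroʳ w)
  E-scale w ((x , w′) ∷ d) f = trans (cong (w * w′ * f x +_) (E-scale w d f)) (s w w′ (f x) (E d f))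
    where
    s : ∀ w v x y → w * v * x + w * y ≡ w * (v * x + y)
    s = solve-∀ ℚ-ring

  E->>= : ∀ (d : Dist A) (h : A → Dist B) f → E (d >>= h) f ≡ E d (λ x → E (h x) f)
  E->>= []            h f = refl
  E->>= ((x , w) ∷ d) h f = trans (E-++ (map (λ (y , w′) → (y , w * w′)) (h x)) (d >>= h) f)
    (cong₂ _+_ (E-scale w (h x) f) (E->>= d h f))

  E-return : ∀ (x : A) f → E (return x) f ≡ f x
  E-return x f = s (f x)
    where
    s : ∀ y → 1ℚ * y + 0ℚ ≡ y
    s = solve-∀ ℚ-ring

  E-+ : ∀ (d : Dist A) f g → E d (λ x → f x + g x) ≡ E d f + E d g
  E-+ []            f g = sym (+-identityˡ 0ℚ)
  E-+ ((x , w) ∷ d) f g = trans (cong (w * (f x + g x) +_) (E-+ d f g)) (s w (f x) (g x) (E d f) (E d g))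
    where
    s : ∀ w x y a b → w * (x + y) + (a + b) ≡ w * x + a + (w * y + b)
    s = solve-∀ ℚ-ring

  E-* : ∀ (d : Dist A) c f → E d (λ x → c * f x) ≡ c * E d f
  E-* []            c f = sym (*-zeroʳ c)
  E-* ((x , w) ∷ d) c f = trans (cong (w * (c * f x) +_) (E-* d c f)) (s w c (f x) (E d f))
    where
    s : ∀ w c x a → w * (c * x) + c * a ≡ c * (w * x + a)
    s = solve-∀ ℚ-ring

  E-0 : ∀ (d : Dist A) → E d (λ _ → 0ℚ) ≡ 0ℚ
  E-0 []            = refl
  E-0 ((x , w) ∷ d) = trans (cong₂ _+_ (*-zeroʳ w) (E-0 d)) (+-identityˡ 0ℚ)

  E-swap : ∀ (d : Dist A) (d′ : Dist B) (f : A → B → ℚ) →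
           E d (λ x → E d′ (f x)) ≡ E d′ (λ y → E d (λ x → f x y))
  E-swap []            d′ f = sym (E-0 d′)
  E-swap ((x , w) ∷ d) d′ f = trans (cong₂ _+_ (sym (E-* d′ w (f x))) (E-swap d d′ f))
    (sym (E-+ d′ (λ y → w * f x y) (λ y → E d (λ x → f x y))))

  Nonneg : Dist A → Set
  Nonneg = All (λ (_ , w) → 0ℚ ≤ w)

  E-mono : ∀ {d : Dist A} → Nonneg d → ∀ {f g} → (∀ x → f x ≤ g x) → E d f ≤ E d g
  E-mono []        e = ≤-refl
  E-mono (0≤w ∷ p) e = +-mono-≤ (*-monoˡ-≤-0≤ 0≤w (e _)) (E-mono p e)

  Nonneg->>= : ∀ {d : Dist A} {h : A → Dist B} → Nonneg d → (∀ x → Nonneg (h x)) → Nonneg (d >>= h)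
  Nonneg->>= []        q = []
  Nonneg->>= {h = h} (_∷_ {x = x , w} 0≤w p) q =
    Allₚ.++⁺ (Allₚ.map⁺ (All.map (0≤* 0≤w) (q x))) (Nonneg->>= p q)

  ∑ℚ : List A → (A → ℚ) → ℚ
  ∑ℚ []       f = 0ℚ
  ∑ℚ (x ∷ xs) f = f x + ∑ℚ xs f

  ∑ℚ-cong : ∀ (xs : List A) {f g} → (∀ x → x ∈ xs → f x ≡ g x) → ∑ℚ xs f ≡ ∑ℚ xs g
  ∑ℚ-cong []       e = refl
  ∑ℚ-cong (x ∷ xs) e = cong₂ _+_ (e x (here refl)) (∑ℚ-cong xs (λ y → e y ∘ there))

  ∑ℚ-mono : ∀ (xs : List A) {f g} → (∀ x → x ∈ xs → f x ≤ g x) → ∑ℚ xs f ≤ ∑ℚ xs g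
  ∑ℚ-mono []       e = ≤-refl
  ∑ℚ-mono (x ∷ xs) e = +-mono-≤ (e x (here refl)) (∑ℚ-mono xs (λ y → e y ∘ there))

  ∑ℚ-* : ∀ (xs : List A) c f → ∑ℚ xs (λ x → c * f x) ≡ c * ∑ℚ xs f
  ∑ℚ-* []       c f = sym (*-zeroʳ c)
  ∑ℚ-* (x ∷ xs) c f = trans (cong (c * f x +_) (∑ℚ-* xs c f)) (sym (*-distribˡ-+ c (f x) (∑ℚ xs f)))

  ∑ℚ-0 : ∀ (xs : List A) {f} → (∀ x → x ∈ xs → f x ≡ 0ℚ) → ∑ℚ xs f ≡ 0ℚ
  ∑ℚ-0 []       e = refl
  ∑ℚ-0 (x ∷ xs) e = trans (cong₂ _+_ (e x (here refl)) (∑ℚ-0 xs (λ y → e y ∘ there))) (+-identityˡ 0ℚ)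

  ∑ℚ-single : ∀ {xs : List A} {f} c → Unique xs → c ∈ xs → (∀ x → x ≢ c → f x ≡ 0ℚ) → ∑ℚ xs f ≡ f c
  ∑ℚ-single {xs = x ∷ xs} {f} c (x∉ ∷ u) (here refl) e =
    trans (cong (f x +_) (∑ℚ-0 xs (λ y y∈ → e y (λ y≡x → All.lookup x∉ y∈ (sym y≡x))))) (+-identityʳ (f x))
  ∑ℚ-single {xs = x ∷ xs} {f} c (x∉ ∷ u) (there p)   e =
    trans (cong₂ _+_ (e x (All.lookup x∉ p)) (∑ℚ-single c u p e)) (+-identityˡ (f c))

  E-∑ℚ : ∀ (d : Dist A) (xs : List B) (f : B → A → ℚ) → E d (λ x → ∑ℚ xs (λ y → f y x)) ≡ ∑ℚ xs (λ y → E d (f y))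
  E-∑ℚ d []       f = E-0 d
  E-∑ℚ d (y ∷ ys) f = trans (E-+ d (f y) (λ x → ∑ℚ ys (λ y → f y x))) (cong (E d (f y) +_) (E-∑ℚ d ys f))

  ι : ℕ → ℚ
  ι zero    = 0ℚ
  ι (suc n) = 1ℚ + ι n

  ι-+ : ∀ a b → ι (a ℕ.+ b) ≡ ι a + ι b
  ι-+ zero    b = sym (+-identityˡ (ι b))
  ι-+ (suc a) b = trans (cong (1ℚ +_) (ι-+ a b)) (sym (+-assoc 1ℚ (ι a) (ι b)))

  ι-* : ∀ a b → ι (a ℕ.* b) ≡ ι a * ι b
  ι-* zero    b = sym (*-zeroˡ (ι b))
  ι-* (suc a) b = trans (ι-+ b (a ℕ.* b)) (trans (cong (_+_ (ι b)) (ι-* a b)) (s (ι a) (ι b)))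
    where
    s : ∀ a b → b + a * b ≡ (1ℚ + a) * b
    s = solve-∀ ℚ-ring

  0≤ι : ∀ n → 0ℚ ≤ ι n
  0≤ι zero    = ≤-refl
  0≤ι (suc n) = 0≤+ (nonNegative⁻¹ 1ℚ) (0≤ι n)

  ι-mono : ∀ {a b} → a ℕ.≤ b → ι a ≤ ι b
  ι-mono {b = b} ℕ.z≤n = 0≤ι b
  ι-mono (ℕ.s≤s p)     = +-monoʳ-≤ 1ℚ (ι-mono p)

  ι-pos : ∀ n → 0 ℕ.< n → 0ℚ < ι n
  ι-pos (suc n) _ = <-≤-trans (positive⁻¹ 1ℚ) (≤-trans (≤-reflexive (sym (+-identityʳ 1ℚ))) (+-monoʳ-≤ 1ℚ (0≤ι n)))

  ∑ℚ-const : ∀ (xs : List A) c → ∑ℚ xs (λ _ → c) ≡ ι (length xs) * c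
  ∑ℚ-const []       c = sym (*-zeroˡ c)
  ∑ℚ-const (x ∷ xs) c = trans (cong (c +_) (∑ℚ-const xs c)) (s c (ι (length xs)))
    where
    s : ∀ c l → c + l * c ≡ (1ℚ + l) * c
    s = solve-∀ ℚ-ring

  infixr 8 _^ᵣ_

  _^ᵣ_ : ℚ → ℕ → ℚ
  r ^ᵣ zero  = 1ℚ
  r ^ᵣ suc n = r * r ^ᵣ n

  ^ᵣ-+ : ∀ r a b → r ^ᵣ (a ℕ.+ b) ≡ r ^ᵣ a * r ^ᵣ b
  ^ᵣ-+ r zero    b = sym (*-identityˡ _)
  ^ᵣ-+ r (suc a) b = trans (cong (r *_) (^ᵣ-+ r a b)) (sym (*-assoc r (r ^ᵣ a) (r ^ᵣ b)))

  ^ᵣ-nonneg : ∀ {r} n → 0ℚ ≤ r → 0ℚ ≤ r ^ᵣ n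
  ^ᵣ-nonneg zero    p = nonNegative⁻¹ 1ℚ
  ^ᵣ-nonneg (suc n) p = 0≤* p (^ᵣ-nonneg n p)

  0<^ᵣ : ∀ {x} j → 0ℚ < x → 0ℚ < x ^ᵣ j
  0<^ᵣ zero    0<x = positive⁻¹ 1ℚ
  0<^ᵣ (suc j) 0<x = 0<* 0<x (0<^ᵣ j 0<x)

  ^ᵣ-* : ∀ r s n → (r * s) ^ᵣ n ≡ r ^ᵣ n * s ^ᵣ n
  ^ᵣ-* r s zero    = sym (*-identityˡ 1ℚ)
  ^ᵣ-* r s (suc n) = trans (cong (r * s *_) (^ᵣ-* r s n)) (sh r s (r ^ᵣ n) (s ^ᵣ n))
    where
    sh : ∀ r s a b → r * s * (a * b) ≡ r * a * (s * b)
    sh = solve-∀ ℚ-ring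

  ι-^ : ∀ a n → ι (a ℕ.^ n) ≡ ι a ^ᵣ n
  ι-^ a zero    = +-identityʳ 1ℚ
  ι-^ a (suc n) = trans (ι-* a (a ℕ.^ n)) (cong (ι a *_) (ι-^ a n))

  𝟙ℚ : ∀ {p} {P : Set p} → Dec P → ℚ
  𝟙ℚ (yes _) = 1ℚ
  𝟙ℚ (no _)  = 0ℚ

  𝟙ℚ-cong : ∀ {p q} {P : Set p} {Q : Set q} (P? : Dec P) (Q? : Dec Q) → (P → Q) → (Q → P) → 𝟙ℚ P? ≡ 𝟙ℚ Q?
  𝟙ℚ-cong (yes _) (yes _) f g = refl
  𝟙ℚ-cong (yes p) (no ¬q) f g = ⊥-elim (¬q (f p))
  𝟙ℚ-cong (no ¬p) (yes q) f g = ⊥-elim (¬p (g q))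
  𝟙ℚ-cong (no _)  (no _)  f g = refl

  𝟙ℚ-no : ∀ {p} {P : Set p} (P? : Dec P) → ¬ P → 𝟙ℚ P? ≡ 0ℚ
  𝟙ℚ-no (yes p) ¬p = ⊥-elim (¬p p)
  𝟙ℚ-no (no _)  ¬p = refl

  Pr-E : ∀ {P : A → Set} (P? : Decidable P) (d : Dist A) → Pr P? d ≡ E d (λ x → 𝟙ℚ (P? x))
  Pr-E P? []            = refl
  Pr-E P? ((x , w) ∷ d) with P? x
  ... | yes _ = cong₂ _+_ (sym (*-identityʳ w)) (Pr-E P? d)
  ... | no _  = trans (Pr-E P? d) (trans (sym (+-identityˡ _)) (cong (_+ _) (sym (*-zeroʳ w))))

  -- From (μ - X)² ≥ 0 the indicator of X ≠ 0 is at least (2μX - X²)/μ².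
  second-moment : ∀ {P : A → Set} (P? : Decidable P) {d : Dist A} → Nonneg d → (X : A → ℚ) (μ ε : ℚ) (e : ℕ) →
    0ℚ < μ → 0 ℕ.< e → 1ℚ ≤ ε * ι e →
    (∀ x → ¬ P x → X x ≡ 0ℚ) → E d X ≡ μ → ι e * E d (λ x → X x * X x) ≤ ι (suc e) * (μ * μ) →
    1ℚ - ε ≤ Pr P? d
  second-moment P? {d} nn X μ ε e 0<μ 0<e 1≤εe X0 EX EXX = begin
    1ℚ - ε                 ≤⟨ +-monoˡ-≤ (- ε) bound ⟩
    Pr P? d + ε - ε        ≡⟨ s₀ (Pr P? d) ε ⟩
    Pr P? d                ∎
    where
    open ≤-Reasoning
    s₀ : ∀ a b → a + b - b ≡ a
    s₀ = solve-∀ ℚ-ring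
    pr = Pr P? d
    z = μ * μ
    i = ι e
    pointwise : ∀ x → (μ + μ) * X x ≤ z * 𝟙ℚ (P? x) + X x * X x
    pointwise x with P? x
    ... | no ¬p rewrite X0 x ¬p = ≤-reflexive (s μ z)
      where
      s : ∀ μ z → (μ + μ) * 0ℚ ≡ z * 0ℚ + 0ℚ * 0ℚ
      s = solve-∀ ℚ-ring
    ... | yes _ = begin
      (μ + μ) * X x                                    ≡⟨ sym (+-identityʳ _) ⟩
      (μ + μ) * X x + 0ℚ                               ≤⟨ +-monoʳ-≤ ((μ + μ) * X x) (0≤square (μ - X x)) ⟩
      (μ + μ) * X x + (μ - X x) * (μ - X x)            ≡⟨ s μ (X x) ⟩
      z * 1ℚ + X x * X x                               ∎
      where
      s : ∀ m x → (m + m) * x + (m - x) * (m - x) ≡ m * m * 1ℚ + x * x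
      s = solve-∀ ℚ-ring
    moment : (μ + μ) * μ ≤ z * pr + E d (λ x → X x * X x)
    moment = begin
      (μ + μ) * μ                                                ≡⟨ cong ((μ + μ) *_) (sym EX) ⟩
      (μ + μ) * E d X                                            ≡⟨ sym (E-* d (μ + μ) X) ⟩
      E d (λ x → (μ + μ) * X x)                                  ≤⟨ E-mono nn pointwise ⟩
      E d (λ x → z * 𝟙ℚ (P? x) + X x * X x)                      ≡⟨ E-+ d (λ x → z * 𝟙ℚ (P? x)) (λ x → X x * X x) ⟩
      E d (λ x → z * 𝟙ℚ (P? x)) + E d (λ x → X x * X x)          ≡⟨ cong (_+ E d (λ x → X x * X x)) (trans (E-* d z (λ x → 𝟙ℚ (P? x))) (cong (z *_) (sym (Pr-E P? d)))) ⟩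
      z * pr + E d (λ x → X x * X x)                             ∎
    0<z : 0ℚ < z
    0<z = 0<* 0<μ 0<μ
    0<iz : 0ℚ < i * z
    0<iz = 0<* (ι-pos e 0<e) 0<z
    scaled : i * z + (1ℚ + i) * z ≤ i * z * (pr + ε) + (1ℚ + i) * z
    scaled = begin
      i * z + (1ℚ + i) * z                           ≡⟨ s₁ i z μ refl ⟩
      i * ((μ + μ) * μ) + z * 1ℚ                     ≤⟨ +-mono-≤ (*-monoˡ-≤-0≤ (0≤ι e) moment) (*-monoˡ-≤-0≤ (<⇒≤ 0<z) 1≤εe) ⟩
      i * (z * pr + E d (λ x → X x * X x)) + z * (ε * i)   ≡⟨ s₂ i z pr (E d (λ x → X x * X x)) ε ⟩
      i * z * (pr + ε) + i * E d (λ x → X x * X x)   ≤⟨ +-monoʳ-≤ (i * z * (pr + ε)) EXX ⟩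
      i * z * (pr + ε) + (1ℚ + i) * z                ∎
      where
      s : ∀ i m → i * (m * m) + (1ℚ + i) * (m * m) ≡ i * ((m + m) * m) + m * m * 1ℚ
      s = solve-∀ ℚ-ring
      s₁ : ∀ i z μ → z ≡ μ * μ → i * z + (1ℚ + i) * z ≡ i * ((μ + μ) * μ) + z * 1ℚ
      s₁ i z μ refl = s i μ
      s₂ : ∀ i z p x e → i * (z * p + x) + z * (e * i) ≡ i * z * (p + e) + i * x
      s₂ = solve-∀ ℚ-ring
    bound : 1ℚ ≤ pr + ε
    bound = *-cancelˡ-≤-pos (i * z) {{positive 0<iz}} (begin
      i * z * 1ℚ                                             ≡⟨ s₃ (i * z) ((1ℚ + i) * z) ⟩
      i * z + (1ℚ + i) * z - (1ℚ + i) * z                    ≤⟨ +-monoˡ-≤ (- ((1ℚ + i) * z)) scaled ⟩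
      i * z * (pr + ε) + (1ℚ + i) * z - (1ℚ + i) * z         ≡⟨ s₀ (i * z * (pr + ε)) ((1ℚ + i) * z) ⟩
      i * z * (pr + ε)                                       ∎)
      where
      s₃ : ∀ a b → a * 1ℚ ≡ a + b - b
      s₃ = solve-∀ ℚ-ring

  toℚᵘ-ι : ∀ n → toℚᵘ (ι n) ℚᵘ.≃ ℚᵘ.mkℚᵘ (ℤ.+ n) 0
  toℚᵘ-ι zero    = ℚᵘ.≃-refl
  toℚᵘ-ι (suc n) = ℚᵘ.≃-trans (toℚᵘ-homo-+ 1ℚ (ι n)) (ℚᵘ.≃-trans (ℚᵘ.+-cong (ℚᵘ.≃-refl {toℚᵘ 1ℚ}) (toℚᵘ-ι n))
    (ℚᵘ.*≡* (cong (ℤ._* ℤ.1ℤ) (cong (λ z → ℤ.1ℤ ℤ.+ z) (ℤ.*-identityʳ (ℤ.+ n))))))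

  1/*ι : ∀ n .{{_ : NonZero n}} → (ℤ.+ 1 / n) * ι n ≡ 1ℚ
  1/*ι (suc n) = toℚᵘ-injective (ℚᵘ.≃-trans (toℚᵘ-homo-* (ℤ.+ 1 / suc n) (ι (suc n)))
    (ℚᵘ.≃-trans (ℚᵘ.*-cong (toℚᵘ-fromℚᵘ (ℚᵘ.mkℚᵘ (ℤ.+ 1) n)) (toℚᵘ-ι (suc n)))
      (ℚᵘ.*≡* (trans (ℤ.*-identityʳ (ℤ.1ℤ ℤ.* (ℤ.+ suc n))) (cong (λ z → ℤ.1ℤ ℤ.* (ℤ.+ z)) (sym (ℕ.*-identityʳ (suc n))))))))

  0<1/ : ∀ n .{{_ : NonZero n}} → 0ℚ < ℤ.+ 1 / n
  0<1/ n = positive⁻¹ (ℤ.+ 1 / n) {{normalize-pos 1 n}}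

  -- The coloured binomial random set

  module Model {A : Set} (_≟_ : DecidableEquality A) (q : ℕ) .{{_ : NonZero q}} (p : ℚ) where

    Atom : Set
    Atom = A × Fin q

    _≟A_ : DecidableEquality Atom
    _≟A_ = ≡-dec _≟_ Fin._≟_

    open DecMembership _≟A_ using (_∈?_)

    1/q : ℚ
    1/q = ℤ.+ 1 / q

    r : ℚ
    r = p * 1/q

    model : List A → Dist (List Atom)
    model L = randomSubset p L >>= randomColouring q

    E-uniform : ∀ f → E (uniform q) f ≡ 1/q * ∑ℚ (allFin q) f
    E-uniform f = go (allFin q)
      where
      go : ∀ cs → E (map (λ c → (c , 1/q)) cs) f ≡ 1/q * ∑ℚ cs f
      go []       = sym (*-zeroʳ 1/q)
      go (c ∷ cs) = trans (cong (1/q * f c +_) (go cs)) (sym (*-distribˡ-+ 1/q (f c) (∑ℚ cs f)))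

    E-uniform-const : ∀ z → E (uniform q) (λ _ → z) ≡ z
    E-uniform-const z = trans (E-uniform (λ _ → z)) (trans (cong (1/q *_) (∑ℚ-const (allFin q) z))
      (trans (sym (*-assoc 1/q (ι (length (allFin q))) z)) (trans (cong (λ l → 1/q * ι l * z) (length-tabulate {n = q} (λ i → i)))
        (trans (cong (_* z) (1/*ι q)) (*-identityˡ z)))))

    E-uniform-single : ∀ f c → (∀ x → x ≢ c → f x ≡ 0ℚ) → E (uniform q) f ≡ 1/q * f c
    E-uniform-single f c e = trans (E-uniform f) (cong (1/q *_) (∑ℚ-single c (Uniqueₚ.allFin⁺ q) (∈-allFin c) e))

    E-model-[] : ∀ F → E (model []) F ≡ F []
    E-model-[] F = trans (E->>= (return []) (randomColouring q) F) (trans (E-return [] (λ ys → E (randomColouring q ys) F)) (E-return [] F))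

    -- In the model all colours are drawn after all edges. As finite sums commute, the first
    -- potential edge can nevertheless be exposed together with its colour, which permits induction
    -- on `L`.
    E-model-∷ : ∀ x L F → E (model (x ∷ L)) F ≡
      p * E (uniform q) (λ c → E (model L) (λ H → F ((x , c) ∷ H))) + (1ℚ - p) * E (model L) F
    E-model-∷ x L F = begin
      E (model (x ∷ L)) F
        ≡⟨ E->>= (randomSubset p (x ∷ L)) (randomColouring q) F ⟩
      E (randomSubset p (x ∷ L)) Φ
        ≡⟨ E->>= (bernoulli p) (λ b → randomSubset p L >>= λ ys → return (if b then x ∷ ys else ys)) Φ ⟩
      p * E (randomSubset p L >>= λ ys → return (x ∷ ys)) Φ + ((1ℚ - p) * E (randomSubset p L >>= return) Φ + 0ℚ)
        ≡⟨ cong₂ (λ y z → p * y + z) present (trans (+-identityʳ _) (cong ((1ℚ - p) *_) absent)) ⟩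
      p * E (uniform q) (λ c → E (model L) (λ H → F ((x , c) ∷ H))) + (1ℚ - p) * E (model L) F ∎
      where
      open ≡-Reasoning
      Φ : List A → ℚ
      Φ ys = E (randomColouring q ys) F
      absent : E (randomSubset p L >>= return) Φ ≡ E (model L) F
      absent = trans (E->>= (randomSubset p L) return Φ) (trans (E-cong (randomSubset p L) (λ ys → E-return ys Φ))
        (sym (E->>= (randomSubset p L) (randomColouring q) F)))
      colour : ∀ ys → Φ (x ∷ ys) ≡ E (uniform q) (λ c → E (randomColouring q ys) (λ H → F ((x , c) ∷ H)))
      colour ys = trans (E->>= (uniform q) (λ c → randomColouring q ys >>= λ zs → return ((x , c) ∷ zs)) F) (E-cong (uniform q) (λ c →
        trans (E->>= (randomColouring q ys) (λ zs → return ((x , c) ∷ zs)) F)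
          (E-cong (randomColouring q ys) (λ zs → E-return ((x , c) ∷ zs) F))))
      present : E (randomSubset p L >>= λ ys → return (x ∷ ys)) Φ ≡ E (uniform q) (λ c → E (model L) (λ H → F ((x , c) ∷ H)))
      present = trans (E->>= (randomSubset p L) (λ ys → return (x ∷ ys)) Φ)
        (trans (E-cong (randomSubset p L) (λ ys → trans (E-return (x ∷ ys) Φ) (colour ys)))
        (trans (E-swap (randomSubset p L) (uniform q) (λ ys c → E (randomColouring q ys) (λ H → F ((x , c) ∷ H))))
        (E-cong (uniform q) (λ c → sym (E->>= (randomSubset p L) (randomColouring q) (λ H → F ((x , c) ∷ H)))))))

    model-nonneg : 0ℚ ≤ p → p ≤ 1ℚ → ∀ L → Nonneg (model L)
    model-nonneg 0≤p p≤1 L = Nonneg->>= (subset L) colouring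
      where
      1≥0 : 0ℚ ≤ 1ℚ
      1≥0 = nonNegative⁻¹ 1ℚ
      subset : ∀ L → Nonneg (randomSubset p L)
      subset []      = 1≥0 ∷ []
      subset (x ∷ L) = Nonneg->>= (0≤p ∷ ≤-trans (≤-reflexive (sym (+-inverseʳ p))) (+-monoˡ-≤ (- p) p≤1) ∷ [])
        (λ b → Nonneg->>= {h = λ ys → return (if b then x ∷ ys else ys)} (subset L) (λ ys → 1≥0 ∷ []))
      colouring : ∀ ys → Nonneg (randomColouring q ys)
      colouring []       = 1≥0 ∷ []
      colouring (y ∷ ys) = Nonneg->>= (Allₚ.map⁺ (All.universal (λ _ → <⇒≤ (0<1/ q)) (allFin q)))
        (λ c → Nonneg->>= {h = λ zs → return ((y , c) ∷ zs)} (colouring ys) (λ zs → 1≥0 ∷ []))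

    infixl 5 _∖_

    _∖_ : List Atom → Atom → List Atom
    U ∖ h = filter (λ a → ¬? (a ≟A h)) U

    contains? : ∀ U H → Dec (All (_∈ H) U)
    contains? U H = all? (_∈? H) U

    ind : List Atom → List Atom → ℚ
    ind U H = 𝟙ℚ (contains? U H)

    -- Exposing `h` strikes it off the list of demanded atoms; this is the recursion behind
    -- `contained`.
    ind-∷ : ∀ U h H → ind U (h ∷ H) ≡ ind (U ∖ h) H
    ind-∷ U h H = 𝟙ℚ-cong (contains? U (h ∷ H)) (contains? (U ∖ h) H)
      (λ s → All.tabulate (λ a∈ → let a∈U , a≢h = ∈-filter⁻ (λ a → ¬? (a ≟A h)) {xs = U} a∈ in tail a≢h (All.lookup s a∈U)))
      (λ s → All.tabulate (λ a∈ → case-h s a∈))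
      where
      tail : ∀ {a} → a ≢ h → a ∈ h ∷ H → a ∈ H
      tail a≢h (here e)  = ⊥-elim (a≢h e)
      tail a≢h (there m) = m
      case-h : All (_∈ H) (U ∖ h) → ∀ {a} → a ∈ U → a ∈ h ∷ H
      case-h s {a} a∈ with a ≟A h
      ... | yes e   = here e
      ... | no  a≢h = there (All.lookup s (∈-filter⁺ (λ a → ¬? (a ≟A h)) a∈ a≢h))

    contained : List A → List Atom → ℚ
    contained L U = E (model L) (ind U)

    contained-∷ : ∀ x L U → contained (x ∷ L) U ≡ p * E (uniform q) (λ c → contained L (U ∖ (x , c))) + (1ℚ - p) * contained L U
    contained-∷ x L U = trans (E-model-∷ x L (ind U)) (cong (λ z → p * z + (1ℚ - p) * contained L U)
      (E-cong (uniform q) (λ c → E-cong (model L) (ind-∷ U (x , c)))))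

    contained-absent : ∀ L U a → a ∈ U → proj₁ a ∉ L → contained L U ≡ 0ℚ
    contained-absent []      U a a∈ a∉ = trans (E-model-[] (ind U)) (𝟙ℚ-no (contains? U []) (λ s → ¬∈[] (All.lookup s a∈)))
      where
      ¬∈[] : ¬ (a ∈ [])
      ¬∈[] ()
    contained-absent (x ∷ L) U a a∈ a∉ = trans (contained-∷ x L U) (trans
      (cong₂ (λ y z → p * y + (1ℚ - p) * z)
        (trans (E-cong (uniform q) (λ c → contained-absent L (U ∖ (x , c)) a (∈-filter⁺ _ a∈ (λ e → a∉ (here (cong proj₁ e)))) (a∉ ∘ there))) (E-0 (uniform q)))
        (contained-absent L U a a∈ (a∉ ∘ there)))
      (s p))
      where
      s : ∀ p → p * 0ℚ + (1ℚ - p) * 0ℚ ≡ 0ℚ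
      s = solve-∀ ℚ-ring

    contained-skip : ∀ x L U → All (λ a → proj₁ a ≢ x) U → contained (x ∷ L) U ≡ contained L U
    contained-skip x L U none = trans (contained-∷ x L U) (trans
      (cong (λ z → p * z + (1ℚ - p) * contained L U) (trans
        (E-cong (uniform q) (λ c → cong (contained L) (filter-all (λ a → ¬? (a ≟A (x , c))) (All.map (λ a≢ e → a≢ (cong proj₁ e)) none))))
        (E-uniform-const (contained L U))))
      (s p (contained L U)))
      where
      s : ∀ p y → p * y + (1ℚ - p) * y ≡ y
      s = solve-∀ ℚ-ring

    -- Since x does not recur in L, the demand for (x , c) has to be met at once: outcomes in which
    -- x is absent or gets another colour contribute 0.
    contained-hit : ∀ x c L U → (x , c) ∈ U → x ∉ L → contained (x ∷ L) U ≡ r * contained L (U ∖ (x , c))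
    contained-hit x c L U a∈ x∉ = trans (contained-∷ x L U) (trans
      (cong₂ (λ y z → p * y + (1ℚ - p) * z)
        (E-uniform-single (λ c → contained L (U ∖ (x , c))) c (λ c′ c′≢c → contained-absent L (U ∖ (x , c′)) (x , c)
          (∈-filter⁺ _ a∈ (λ e → c′≢c (sym (cong proj₂ e)))) x∉))
        (contained-absent L U (x , c) a∈ x∉))
      (s p 1/q (contained L (U ∖ (x , c)))))
      where
      s : ∀ p q y → p * (q * y) + (1ℚ - p) * 0ℚ ≡ p * q * y
      s = solve-∀ ℚ-ring

    length-∖ : ∀ {U h} → Unique U → h ∈ U → length U ≡ suc (length (U ∖ h))
    length-∖ {x ∷ U} {h} (x∉ ∷ u) (here refl) =
      cong (suc ∘ length) (sym (trans (filter-reject (λ a → ¬? (a ≟A h)) (λ ¬e → ¬e refl)) (filter-all (λ a → ¬? (a ≟A h)) (All.map (λ h≢ e → h≢ (sym e)) x∉))))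
    length-∖ {x ∷ U} {h} (x∉ ∷ u) (there h∈) =
      trans (cong suc (length-∖ u h∈)) (cong (suc ∘ length) (sym (filter-accept (λ a → ¬? (a ≟A h)) (All.lookup x∉ h∈))))

    search : ∀ x (U : List Atom) → (∃[ c ] (x , c) ∈ U) ⊎ All (λ (a : Atom) → proj₁ a ≢ x) U
    search x U with any? (λ (a : Atom) → proj₁ a ≟ x) U
    ... | no ¬any = inj₂ (Allₚ.¬Any⇒All¬ U ¬any)
    ... | yes any with (_ , c) , a∈ , refl ← find any = inj₁ (c , a∈)

    -- Only an inequality, because the union of two coloured cycles may demand one edge in two
    -- colours, an event of probability 0.
    contained-≤ : 0ℚ ≤ r → ∀ L U → Unique L → Unique U → contained L U ≤ r ^ᵣ length U
    contained-≤ 0≤r [] [] uL uU = ≤-reflexive (E-model-[] (ind []))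
    contained-≤ 0≤r [] (a ∷ U) uL uU = ≤-trans (≤-reflexive (contained-absent [] (a ∷ U) a (here refl) (λ ()))) (^ᵣ-nonneg (suc (length U)) 0≤r)
    contained-≤ 0≤r (x ∷ L) U (x∉ ∷ uL) uU with search x U
    ... | inj₂ none = ≤-trans (≤-reflexive (contained-skip x L U none)) (contained-≤ 0≤r L U uL uU)
    ... | inj₁ (c , a∈) = begin
      contained (x ∷ L) U                         ≡⟨ contained-hit x c L U a∈ (λ x∈ → All.lookup x∉ x∈ refl) ⟩
      r * contained L (U ∖ (x , c))               ≤⟨ *-monoˡ-≤-0≤ 0≤r (contained-≤ 0≤r L (U ∖ (x , c)) uL (Uniqueₚ.filter⁺ (λ a → ¬? (a ≟A (x , c))) uU)) ⟩
      r * r ^ᵣ length (U ∖ (x , c))       ≡⟨ cong (r ^ᵣ_) (sym (length-∖ uU a∈)) ⟩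
      r ^ᵣ length U                       ∎
      where open ≤-Reasoning

    DistinctEdges : List Atom → Set
    DistinctEdges = AllPairs (λ a b → proj₁ a ≢ proj₁ b)

    distinct⇒unique : ∀ {U} → DistinctEdges U → Unique U
    distinct⇒unique = AllPairs.map (λ a≢b e → a≢b (cong proj₁ e))

    distinct-injective : ∀ {U a b} → DistinctEdges U → a ∈ U → b ∈ U → proj₁ a ≡ proj₁ b → a ≡ b
    distinct-injective (_  ∷ _) (here refl) (here refl) e = refl
    distinct-injective (u∉ ∷ _) (here refl) (there b∈)  e = ⊥-elim (All.lookup u∉ b∈ e)
    distinct-injective (u∉ ∷ _) (there a∈)  (here refl) e = ⊥-elim (All.lookup u∉ a∈ (sym e))
    distinct-injective (_  ∷ d) (there a∈)  (there b∈)  e = distinct-injective d a∈ b∈ e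

    contained-≡ : ∀ L U → Unique L → DistinctEdges U → All (λ a → proj₁ a ∈ L) U → contained L U ≡ r ^ᵣ length U
    contained-≡ [] []      uL dU _        = E-model-[] (ind [])
    contained-≡ [] (a ∷ U) uL dU (() ∷ _)
    contained-≡ (x ∷ L) U (x∉ ∷ uL) dU U⊆ with search x U
    ... | inj₂ none = trans (contained-skip x L U none) (contained-≡ L U uL dU (All.zipWith (λ (a≢x , a∈) → tail a≢x a∈) (none , U⊆)))
      where
      tail : ∀ {y} → y ≢ x → y ∈ x ∷ L → y ∈ L
      tail y≢x (here e)  = ⊥-elim (y≢x e)
      tail y≢x (there m) = m
    ... | inj₁ (c , a∈) =
      trans (contained-hit x c L U a∈ (λ x∈ → All.lookup x∉ x∈ refl))
        (trans (cong (r *_) (contained-≡ L (U ∖ (x , c)) uL (AllPairsₚ.filter⁺ (λ a → ¬? (a ≟A (x , c))) dU) (All.tabulate rest)))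
          (cong (r ^ᵣ_) (sym (length-∖ (distinct⇒unique dU) a∈))))
      where
      rest : ∀ {b} → b ∈ U ∖ (x , c) → proj₁ b ∈ L
      rest b∈ with b∈U , b≢ ← ∈-filter⁻ (λ a → ¬? (a ≟A (x , c))) {xs = U} b∈ with All.lookup U⊆ b∈U
      ... | here e  = ⊥-elim (b≢ (distinct-injective dU b∈U a∈ e))
      ... | there m = m

    ∖-↭ : ∀ {U h} → Unique U → h ∈ U → h ∷ (U ∖ h) ↭ U
    ∖-↭ {x ∷ U} {h} (x∉ ∷ u) (here refl) = ↭-reflexive (cong (h ∷_) (trans (filter-reject (λ a → ¬? (a ≟A h)) (λ ¬e → ¬e refl))
      (filter-all (λ a → ¬? (a ≟A h)) (All.map (λ h≢ e → h≢ (sym e)) x∉))))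
    ∖-↭ {x ∷ U} {h} (x∉ ∷ u) (there h∈) = ↭-trans
      (↭-reflexive (cong (h ∷_) (filter-accept (λ a → ¬? (a ≟A h)) (All.lookup x∉ h∈))))
      (↭-trans (swap h x ↭-refl) (prep x (∖-↭ u h∈)))

    -- Walks along `H`, keeping each demanded atom when it first appears and striking it off. The
    -- copy inherits the order of `H`, so it is `U` up to a permutation.
    sublist-copy : ∀ H {U} → Unique U → All (_∈ H) U → ∃[ C ] C ⊑ H × C ↭ U
    sublist-copy []      {[]}    uU s        = [] , [] , ↭-refl
    sublist-copy []      {_ ∷ _} uU (() ∷ _)
    sublist-copy (h ∷ H) {U}     uU s with any? (_≟A h) U
    ... | yes any with _ , h∈ , refl ← find any =
      let C , C⊑H , C↭ = sublist-copy H (Uniqueₚ.filter⁺ (λ a → ¬? (a ≟A h)) uU) (All.tabulate rest)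
      in h ∷ C , refl ∷ C⊑H , ↭-trans (prep h C↭) (∖-↭ uU h∈)
      where
      rest : ∀ {b} → b ∈ U ∖ h → b ∈ H
      rest b∈ with b∈U , b≢ ← ∈-filter⁻ (λ a → ¬? (a ≟A h)) {xs = U} b∈ with All.lookup s b∈U
      ... | here e  = ⊥-elim (b≢ e)
      ... | there m = m
    ... | no ¬any =
      let C , C⊑H , C↭ = sublist-copy H uU (All.zipWith (λ (a≢h , a∈) → tail a≢h a∈) (Allₚ.¬Any⇒All¬ U ¬any , s))
      in C , h ∷ʳ C⊑H , C↭
      where
      tail : ∀ {a} → a ≢ h → a ∈ h ∷ H → a ∈ H
      tail a≢h (here e)  = ⊥-elim (a≢h e)
      tail a≢h (there m) = m

    union : List Atom → List Atom → List Atom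
    union U W = U ++ filter (λ a → ¬? (a ∈? U)) W

    union-unique : ∀ {U W} → Unique U → Unique W → Unique (union U W)
    union-unique {U} {W} uU uW = Uniqueₚ.++⁺ uU (Uniqueₚ.filter⁺ (λ a → ¬? (a ∈? U)) uW)
      (λ (a∈U , a∈W) → proj₂ (∈-filter⁻ (λ a → ¬? (a ∈? U)) {xs = W} a∈W) a∈U)

    ind-union : ∀ U W H → ind U H * ind W H ≡ ind (union U W) H
    ind-union U W H = trans (product (contains? U H) (contains? W H))
      (𝟙ℚ-cong (contains? U H ×-dec contains? W H) (contains? (union U W) H)
        (λ (s , s′) → Allₚ.++⁺ s (All.tabulate (λ a∈ → All.lookup s′ (proj₁ (∈-filter⁻ (λ a → ¬? (a ∈? U)) {xs = W} a∈)))))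
        (λ s → Allₚ.++⁻ˡ U s , All.tabulate (split s)))
      where
      product : ∀ {P Q : Set} (P? : Dec P) (Q? : Dec Q) → 𝟙ℚ P? * 𝟙ℚ Q? ≡ 𝟙ℚ (P? ×-dec Q?)
      product (yes _) (yes _) = *-identityʳ 1ℚ
      product (yes _) (no _)  = *-zeroʳ 1ℚ
      product (no _)  (yes _) = *-zeroˡ 1ℚ
      product (no _)  (no _)  = *-zeroʳ 0ℚ
      split : All (_∈ H) (union U W) → ∀ {a} → a ∈ W → a ∈ H
      split s {a} a∈ with a ∈? U
      ... | yes a∈U = All.lookup (Allₚ.++⁻ˡ U s) a∈U
      ... | no  a∉U = All.lookup (Allₚ.++⁻ʳ U s) (∈-filter⁺ (λ a → ¬? (a ∈? U)) a∈ a∉U)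

    cost : ℕ → ℕ → List Atom → List Atom → ℕ
    cost K D U []      = 1
    cost K D U (a ∷ W) with a ∈? U
    ... | yes _ = D ℕ.* cost K D U W
    ... | no  _ = K ℕ.* cost K D U W

    -- D^|W| clears the denominators of r = K / D: an atom shared with U keeps its factor D, and for
    -- a new atom the factors r and D combine to K.
    cost-length : ∀ K D U W → r * ι D ≡ ι K → r ^ᵣ length (filter (λ a → ¬? (a ∈? U)) W) * ι D ^ᵣ length W ≡ ι (cost K D U W)
    cost-length K D U []      e = sh
      where
      sh : 1ℚ * 1ℚ ≡ 1ℚ + 0ℚ
      sh = refl
    cost-length K D U (a ∷ W) e with a ∈? U
    ... | yes _ = trans (s (r ^ᵣ length (filter (λ a → ¬? (a ∈? U)) W)) (ι D) (ι D ^ᵣ length W))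
      (trans (cong (ι D *_) (cost-length K D U W e)) (sym (ι-* D (cost K D U W))))
      where
      s : ∀ a d w → a * (d * w) ≡ d * (a * w)
      s = solve-∀ ℚ-ring
    ... | no _ = trans (s r (r ^ᵣ length (filter (λ a → ¬? (a ∈? U)) W)) (ι D) (ι D ^ᵣ length W))
      (trans (cong₂ _*_ e (cost-length K D U W e)) (sym (ι-* K (cost K D U W))))
      where
      s : ∀ r a d w → r * a * (d * w) ≡ r * d * (a * w)
      s = solve-∀ ℚ-ring

  tabulate-toℕ : ∀ (f : ℕ → A) t → tabulate {n = t} (λ i → f (toℕ i)) ≡ applyUpTo f t
  tabulate-toℕ f zero    = refl
  tabulate-toℕ f (suc t) = cong (f 0 ∷_) (tabulate-toℕ (f ∘ suc) t)

  ι-∑ : ∀ (xs : List A) f → ∑ℚ xs (λ x → ι (f x)) ≡ ι (∑ xs f)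
  ι-∑ []       f = refl
  ι-∑ (x ∷ xs) f = trans (cong (_+_ (ι (f x))) (ι-∑ xs f)) (sym (ι-+ (f x) (∑ xs f)))

  ∑-cartesianProduct : ∀ (xs : List A) (ys : List B) f → ∑ (cartesianProduct xs ys) f ≡ ∑ xs (λ x → ∑ ys (λ y → f (x , y)))
  ∑-cartesianProduct []       ys f = refl
  ∑-cartesianProduct (x ∷ xs) ys f = trans (∑-++ (map (x ,_) ys) (cartesianProduct xs ys) f)
    (cong₂ ℕ._+_ (∑-map (x ,_) ys f) (∑-cartesianProduct xs ys f))

  length-cartesianProduct : ∀ (xs : List A) (ys : List B) → length (cartesianProduct xs ys) ≡ length xs ℕ.* length ys
  length-cartesianProduct []       ys = refl
  length-cartesianProduct (x ∷ xs) ys = trans (length-++ (map (x ,_) ys)) (cong₂ ℕ._+_ (length-map (x ,_) ys) (length-cartesianProduct xs ys))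

  -- The two moments of the number of coloured cycles.

  module Moments (k ℓ t q e : ℕ) .{{_ : NonZero t}} .{{_ : NonZero q}} .{{_ : NonZero (t ℕ.* (k ℕ.∸ ℓ))}}
    (2≤ℓ : 2 ℕ.≤ ℓ) (ℓ<k : ℓ ℕ.< k) (1≤e : 1 ℕ.≤ e) (1≤t : 1 ℕ.≤ t) (t≤q : t ℕ.≤ q)
    (16k≤n : 4 ℕ.* (4 ℕ.* k) ℕ.≤ t ℕ.* (k ℕ.∸ ℓ)) (t2^ℓ≤2^t : t ℕ.* 2 ℕ.^ ℓ ℕ.≤ 2 ℕ.^ t)
    (K≤n : 4 ℕ.* density k e ℕ.≤ t ℕ.* (k ℕ.∸ ℓ))
    where

    m n K D : ℕ
    m = k ℕ.∸ ℓ
    n = t ℕ.* m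
    K = 4 ℕ.* density k e
    D = n ℕ.^ m ℕ.* q

    m+ℓ≡k : m ℕ.+ ℓ ≡ k
    m+ℓ≡k = ℕ.m∸n+n≡m (ℕ.<⇒≤ ℓ<k)

    1≤m : 1 ℕ.≤ m
    1≤m = ℕ.m<n⇒0<n∸m ℓ<k

    1≤k : 1 ℕ.≤ k
    1≤k = ℕ.≤-trans (s≤s z≤n) ℓ<k

    t≤n : t ℕ.≤ n
    t≤n = ℕ.m≤m*n t m {{ℕ.>-nonZero 1≤m}}

    k+k≤n : k ℕ.+ k ℕ.≤ n
    k+k≤n = ℕ.≤-trans (ℕ.≤-trans (ℕ.+-monoʳ-≤ k (ℕ.m≤m+n k _)) (ℕ.m≤m+n (4 ℕ.* k) _)) 16k≤n

    p : ℚ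
    p = edgeProbability (ι K) k ℓ n

    open Model {A = Subset n} _≟S_ q p

    L : List (Subset n)
    L = kSubsets k n

    τs : List (Vec (Fin n) n)
    τs = arrangements n (allFin n)

    ds : List (Vec (Fin q) t)
    ds = arrangements t (allFin q)

    Pair : Set
    Pair = Vec (Fin n) n × Vec (Fin q) t

    pairs : List Pair
    pairs = cartesianProduct τs ds

    atom : Vec (Fin n) n → Vec (Fin q) t → ℕ → Atom
    atom τ d j = segment k τ (j ℕ.* m) , d ⟨ j ⟩

    U : Pair → List Atom
    U (τ , d) = applyUpTo (atom τ d) t

    length-U : ∀ b → length (U b) ≡ t
    length-U (τ , d) = length-applyUpTo (atom τ d) t

    module _ {τ : Vec (Fin n) n} {d : Vec (Fin q) t} (b∈ : (τ , d) ∈ pairs) where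

      τ∈ : τ ∈ τs
      τ∈ = proj₁ (∈-cartesianProduct⁻ τs ds b∈)

      τ-unique : Unique (toList τ)
      τ-unique = arrangements-unique n (Uniqueₚ.allFin⁺ n) τ∈

      d-unique : Unique (toList d)
      d-unique = arrangements-unique t (Uniqueₚ.allFin⁺ q) (proj₂ (∈-cartesianProduct⁻ τs ds b∈))

      open Segments {t} {m} 1≤m {n} k k+k≤n τ τ-unique

      distinct : DistinctEdges (U (τ , d))
      distinct = AllPairsₚ.applyUpTo⁺₁ (atom τ d) t (λ i<j j<t e →
        ℕ.<⇒≢ i<j (segment-injective 1≤k (ℕ.<-trans i<j j<t) j<t e))

      edges-in : All (λ a → proj₁ a ∈ L) (U (τ , d))
      edges-in = Allₚ.applyUpTo⁺₂ (atom τ d) t (λ j → ∈-kSubsets (segment-card (j ℕ.* m)))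

      colours-unique : Unique (applyUpTo (d ⟨_⟩) t)
      colours-unique = Uniqueₚ.applyUpTo⁺₁ (d ⟨_⟩) t (λ {i} {j} i<j j<t e → ℕ.<⇒≢ i<j
        (%≡-cancel-+ 0 (ℕ.<-trans i<j j<t) j<t (⟨⟩-injective d-unique {i} {j} e)))

      degree : ∀ u → ∑ (allFin t) (λ i → 𝟙 (u ∈ₛ? segment k τ (toℕ i ℕ.* m))) ℕ.≤ k
      degree = segment-degree

      rainbow : ∀ H → All (_∈ H) (U (τ , d)) → HasRainbowHamiltonCycle k ℓ H
      rainbow H s =
        let C , C⊑H , C↭U = sublist-copy H (distinct⇒unique distinct) s
            edges↭ : edges C ↭ cycleEdges k ℓ t τ
            edges↭ = subst (edges C ↭_) (trans (map-applyUpTo (atom τ d) proj₁ t) (sym (tabulate-toℕ (λ j → segment k τ (j ℕ.* m)) t)))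
              (↭ₚ.map⁺ proj₁ C↭U)
            colours↭ : colours C ↭ applyUpTo (d ⟨_⟩) t
            colours↭ = subst (colours C ↭_) (map-applyUpTo (atom τ d) proj₂ t) (↭ₚ.map⁺ proj₂ C↭U)
        in C , C⊑H
         , ( t
           , ↭ₚ.All-resp-↭ (↭-sym edges↭) (Allₚ.tabulate⁺ (λ i → segment-card (toℕ i ℕ.* m)))
           , Unique-resp-↭ (↭-sym edges↭) (Uniqueₚ.tabulate⁺ (λ {i} {j} e → Fin.toℕ-injective (segment-injective 1≤k (Fin.toℕ<n i) (Fin.toℕ<n j) e)))
           , trans (↭ₚ.↭-length edges↭) (length-tabulate (λ (i : Fin t) → segment k τ (toℕ i ℕ.* m)))
           , ℕ.>-nonZero (ℕ.≤-trans 1≤t t≤n)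
           , τ , τ-unique , vertexSet-full τ∈
           , ↭ₚ.∈-resp-↭ edges↭
           , ↭ₚ.∈-resp-↭ (↭-sym edges↭))
         , Unique-resp-↭ (↭-sym colours↭) colours-unique

    open DecMembership _≟A_ using (_∈?_)

    -- `O.prod` replaces the test whether an atom is shared by the number of indices i at which it
    -- occurs in the fixed cycle, which is at least 1 for a shared atom.
    cost-bound : ∀ {σ c} → (σ , c) ∈ pairs →
      e ℕ.* ∑ pairs (λ b → cost K D (U (σ , c)) (U b)) ℕ.≤ suc e ℕ.* (length pairs ℕ.* K ℕ.^ t)
    cost-bound {σ} {c} a∈ = ℕ.≤-trans (ℕ.*-monoʳ-≤ e (ℕ.≤-trans (ℕ.≤-reflexive (∑-cartesianProduct τs ds (λ b → cost K D (U (σ , c)) (U b))))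
        (O.∑∑-mono (λ τ d → cost-≤ (atom τ d) t))))
      (subst (λ z → e ℕ.* O.∑∑ (λ τ d → O.prod (atom τ d) t) ℕ.≤ suc e ℕ.* (z ℕ.* K ℕ.^ t)) (sym (length-cartesianProduct τs ds))
        (O.overlap-bound e (transfer-bound k ℓ m e t n m+ℓ≡k 1≤m 2≤ℓ 1≤e 1≤t t≤n 16k≤n t2^ℓ≤2^t)))
      where
      module O = Overlap k ℓ m t q K m+ℓ≡k 1≤m t≤q (λ i → segment k σ (toℕ i ℕ.* m)) (λ i → c ⟨ toℕ i ⟩)
        (λ i → segment-size k σ (toℕ i ℕ.* m)) (degree a∈)
      cost-≤ : ∀ f r → cost K D (U (σ , c)) (applyUpTo f r) ℕ.≤ O.prod f r
      cost-≤ f zero    = ℕ.≤-refl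
      cost-≤ f (suc r) with f 0 ∈? U (σ , c)
      ... | no  _   = ℕ.*-mono-≤ (ℕ.m≤m+n K _) (cost-≤ (f ∘ suc) r)
      ... | yes f0∈ = ℕ.*-mono-≤ (ℕ.≤-trans (ℕ.m≤m*n D (∑ (allFin t) hits) {{ℕ.>-nonZero one}}) (ℕ.m≤n+m _ K)) (cost-≤ (f ∘ suc) r)
        where
        hits : Fin t → ℕ
        hits i = 𝟙 (f 0 O.≟A O.atomOf i)
        one : 1 ℕ.≤ ∑ (allFin t) hits
        one with j , j<t , eq ← ∈-applyUpTo⁻ (atom σ c) f0∈ =
          ℕ.≤-trans (ℕ.≤-reflexive (sym (𝟙-yes (f 0 O.≟A O.atomOf (fromℕ< j<t)) (trans eq (cong (atom σ c) (sym (Fin.toℕ-fromℕ< j<t)))))))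
            (∑-∈-≤ hits (∈-allFin (fromℕ< j<t)))

    ιD ιK : ℚ
    ιD = ι D
    ιK = ι K

    1≤K : 1 ℕ.≤ K
    1≤K = ℕ.≤-trans (density-pos k e 1≤k 1≤e) (ℕ.m≤m+n _ _)

    private instance
      n^m≢0 : NonZero (n ℕ.^ m)
      n^m≢0 = ℕ.m^n≢0 n m

    D-pos : 0 ℕ.< D
    D-pos = ℕ.>-nonZero⁻¹ D {{ℕ.m*n≢0 (n ℕ.^ m) q}}

    rD≡K : r * ιD ≡ ιK
    rD≡K = trans (cong (r *_) (ι-* (n ℕ.^ m) q)) (trans (s ιK (ℤ.+ 1 / (n ℕ.^ m)) 1/q (ι (n ℕ.^ m)) (ι q))
      (trans (cong₂ (λ x y → ιK * x * y) (1/*ι (n ℕ.^ m)) (1/*ι q)) (s′ ιK)))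
      where
      s : ∀ K a b x y → K * a * b * (x * y) ≡ K * (a * x) * (b * y)
      s = solve-∀ ℚ-ring
      s′ : ∀ K → K * 1ℚ * 1ℚ ≡ K
      s′ = solve-∀ ℚ-ring

    0≤p : 0ℚ ≤ p
    0≤p = 0≤* (0≤ι K) (<⇒≤ (0<1/ (n ℕ.^ m)))

    -- Keeps the weight 1 - p non-negative, so that expectations over the model are monotone.
    p≤1 : p ≤ 1ℚ
    p≤1 = begin
      ιK * 1/N        ≡⟨ *-comm ιK 1/N ⟩
      1/N * ιK        ≤⟨ *-monoˡ-≤-0≤ (<⇒≤ (0<1/ (n ℕ.^ m))) (ι-mono (ℕ.≤-trans K≤n n≤n^m)) ⟩
      1/N * ι (n ℕ.^ m) ≡⟨ 1/*ι (n ℕ.^ m) ⟩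
      1ℚ              ∎
      where
      open ≤-Reasoning
      1/N : ℚ
      1/N = ℤ.+ 1 / (n ℕ.^ m)
      n≤n^m : n ℕ.≤ n ℕ.^ m
      n≤n^m = ℕ.≤-trans (ℕ.≤-reflexive (sym (ℕ.*-identityʳ n))) (ℕ.^-monoʳ-≤ n 1≤m)

    0≤r : 0ℚ ≤ r
    0≤r = 0≤* 0≤p (<⇒≤ (0<1/ q))

    0<r : 0ℚ < r
    0<r = 0<* (0<* (ι-pos K 1≤K) (0<1/ (n ℕ.^ m))) (0<1/ q)

    P μ : ℚ
    P = r ^ᵣ t
    μ = ι (length pairs) * P

    pairs-pos : 0 ℕ.< length pairs
    pairs-pos = subst (0 ℕ.<_) (sym (length-cartesianProduct τs ds)) (ℕ.*-mono-≤
      (subst (1 ℕ.≤_) (sym (length-arrangements n (allFin n))) (fall-pos _ n (ℕ.≤-reflexive (sym (length-tabulate {n = n} (λ i → i))))))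
      (subst (1 ℕ.≤_) (sym (length-arrangements t (allFin q))) (fall-pos _ t (ℕ.≤-trans t≤q (ℕ.≤-reflexive (sym (length-tabulate {n = q} (λ i → i))))))))

    0<μ : 0ℚ < μ
    0<μ = 0<* (ι-pos (length pairs) pairs-pos) (0<^ᵣ t 0<r)

    X : List Atom → ℚ
    X H = ∑ℚ pairs (λ b → ind (U b) H)

    EX : E (model L) X ≡ μ
    EX = trans (E-∑ℚ (model L) pairs (λ b → ind (U b)))
      (trans (∑ℚ-cong pairs (λ b b∈ → trans (contained-≡ L (U b) (kSubsets-unique k n) (distinct b∈) (edges-in b∈)) (cong (r ^ᵣ_) (length-U b))))
        (∑ℚ-const pairs P))

    X-square : ∀ H → X H * X H ≡ ∑ℚ pairs (λ a → ∑ℚ pairs (λ b → ind (union (U a) (U b)) H))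
    X-square H = trans (sym (∑ℚ-* pairs (X H) (λ a → ind (U a) H))) (∑ℚ-cong pairs (λ a _ →
      trans (*-comm (X H) (ind (U a) H)) (trans (sym (∑ℚ-* pairs (ind (U a) H) (λ b → ind (U b) H)))
        (∑ℚ-cong pairs (λ b _ → ind-union (U a) (U b) H)))))

    EXX-sum : E (model L) (λ H → X H * X H) ≡ ∑ℚ pairs (λ a → ∑ℚ pairs (λ b → contained L (union (U a) (U b))))
    EXX-sum = trans (E-cong (model L) X-square)
      (trans (E-∑ℚ (model L) pairs (λ a H → ∑ℚ pairs (λ b → ind (union (U a) (U b)) H)))
        (∑ℚ-cong pairs (λ a _ → E-∑ℚ (model L) pairs (λ b → ind (union (U a) (U b))))))

    W : ℚ
    W = ιD ^ᵣ t

    pair-bound : ∀ a b → a ∈ pairs → b ∈ pairs → W * contained L (union (U a) (U b)) ≤ P * ι (cost K D (U a) (U b))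
    pair-bound a b a∈ b∈ = begin
      W * contained L (union (U a) (U b))
        ≤⟨ *-monoˡ-≤-0≤ (^ᵣ-nonneg t (0≤ι D)) (contained-≤ 0≤r L (union (U a) (U b)) (kSubsets-unique k n)
             (union-unique (distinct⇒unique (distinct a∈)) (distinct⇒unique (distinct b∈)))) ⟩
      W * r ^ᵣ length (union (U a) (U b))
        ≡⟨ cong (λ z → W * r ^ᵣ z) (length-++ (U a)) ⟩
      W * r ^ᵣ (length (U a) ℕ.+ length new)
        ≡⟨ cong (W *_) (trans (^ᵣ-+ r (length (U a)) (length new)) (cong (λ z → r ^ᵣ z * r ^ᵣ length new) (length-U a))) ⟩
      W * (P * r ^ᵣ length new)
        ≡⟨ s W P (r ^ᵣ length new) ⟩
      P * (r ^ᵣ length new * W)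
        ≡⟨ cong (P *_) (trans (cong (λ z → r ^ᵣ length new * ιD ^ᵣ z) (sym (length-U b))) (cost-length K D (U a) (U b) rD≡K)) ⟩
      P * ι (cost K D (U a) (U b)) ∎
      where
      open ≤-Reasoning
      new : List Atom
      new = filter (λ x → ¬? (x ∈? U a)) (U b)
      s : ∀ w p x → w * (p * x) ≡ p * (x * w)
      s = solve-∀ ℚ-ring

    0≤P : 0ℚ ≤ P
    0≤P = ^ᵣ-nonneg t 0≤r

    row-bound : ∀ a → a ∈ pairs → ι e * (W * ∑ℚ pairs (λ b → contained L (union (U a) (U b)))) ≤ P * ι (suc e ℕ.* (length pairs ℕ.* K ℕ.^ t))
    row-bound a a∈ = begin
      ι e * (W * ∑ℚ pairs (λ b → contained L (union (U a) (U b))))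
        ≡⟨ cong (ι e *_) (sym (∑ℚ-* pairs W (λ b → contained L (union (U a) (U b))))) ⟩
      ι e * ∑ℚ pairs (λ b → W * contained L (union (U a) (U b)))
        ≤⟨ *-monoˡ-≤-0≤ (0≤ι e) (∑ℚ-mono pairs (λ b b∈ → pair-bound a b a∈ b∈)) ⟩
      ι e * ∑ℚ pairs (λ b → P * ι (cost K D (U a) (U b)))
        ≡⟨ cong (ι e *_) (trans (∑ℚ-* pairs P (λ b → ι (cost K D (U a) (U b)))) (cong (P *_) (ι-∑ pairs (λ b → cost K D (U a) (U b))))) ⟩
      ι e * (P * ι c)
        ≡⟨ trans (s (ι e) P (ι c)) (cong (P *_) (sym (ι-* e c))) ⟩
      P * ι (e ℕ.* c)
        ≤⟨ *-monoˡ-≤-0≤ 0≤P (ι-mono (cost-bound a∈)) ⟩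
      P * ι (suc e ℕ.* (length pairs ℕ.* K ℕ.^ t)) ∎
      where
      open ≤-Reasoning
      c : ℕ
      c = ∑ pairs (λ b → cost K D (U a) (U b))
      s : ∀ e p c → e * (p * c) ≡ p * (e * c)
      s = solve-∀ ℚ-ring

    EXX : ι e * E (model L) (λ H → X H * X H) ≤ ι (suc e) * (μ * μ)
    EXX = *-cancelˡ-≤-pos W {{positive (0<^ᵣ t (ι-pos D D-pos))}} (begin
      W * (ι e * E (model L) (λ H → X H * X H))
        ≡⟨ cong (λ z → W * (ι e * z)) EXX-sum ⟩
      W * (ι e * ∑ℚ pairs R)
        ≡⟨ s₁ W (ι e) (∑ℚ pairs R) ⟩
      ι e * W * ∑ℚ pairs R
        ≡⟨ sym (∑ℚ-* pairs (ι e * W) R) ⟩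
      ∑ℚ pairs (λ a → ι e * W * R a)
        ≤⟨ ∑ℚ-mono pairs (λ a a∈ → ≤-trans (≤-reflexive (*-assoc (ι e) W (R a))) (row-bound a a∈)) ⟩
      ∑ℚ pairs (λ _ → P * ι (suc e ℕ.* (length pairs ℕ.* K ℕ.^ t)))
        ≡⟨ ∑ℚ-const pairs _ ⟩
      ι (length pairs) * (P * ι (suc e ℕ.* (length pairs ℕ.* K ℕ.^ t)))
        ≡⟨ cong (λ z → ι (length pairs) * (P * z)) (trans (ι-* (suc e) (length pairs ℕ.* K ℕ.^ t))
             (cong (ι (suc e) *_) (trans (ι-* (length pairs) (K ℕ.^ t)) (cong (ι (length pairs) *_) K^t)))) ⟩
      ι (length pairs) * (P * (ι (suc e) * (ι (length pairs) * (P * W))))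
        ≡⟨ s₂ (ι (length pairs)) P (ι (suc e)) W ⟩
      W * (ι (suc e) * (μ * μ)) ∎)
      where
      open ≤-Reasoning
      R : Pair → ℚ
      R a = ∑ℚ pairs (λ b → contained L (union (U a) (U b)))
      K^t : ι (K ℕ.^ t) ≡ P * W
      K^t = trans (ι-^ K t) (trans (cong (_^ᵣ t) (sym rD≡K)) (^ᵣ-* r ιD t))
      s₁ : ∀ w e x → w * (e * x) ≡ e * w * x
      s₁ = solve-∀ ℚ-ring
      s₂ : ∀ l p e w → l * (p * (e * (l * (p * w)))) ≡ w * (e * (l * p * (l * p)))
      s₂ = solve-∀ ℚ-ring

    probability-bound : ∀ ε → 1ℚ ≤ ε * ι e → 1ℚ - ε ≤ Pr (hasRainbowHamiltonCycle? k ℓ) (randomColouredHypergraph k n q p)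
    probability-bound ε 1≤εe = second-moment (hasRainbowHamiltonCycle? k ℓ) (model-nonneg 0≤p p≤1 L) X μ ε e 0<μ 1≤e 1≤εe
      (λ H ¬h → ∑ℚ-0 pairs (λ b b∈ → 𝟙ℚ-no (contains? (U b) H) (λ s → ¬h (rainbow b∈ H s)))) EX EXX

  -- Choice of the accuracy and of the threshold for n.

  archimedean : ∀ ε → 0ℚ < ε → ∃[ e ] 1 ℕ.≤ e × 1ℚ ≤ ε * ι e
  archimedean ε@(mkℚ (ℤ.+ 0)      d _) 0<ε = ⊥-elim (<-irrefl refl (subst (0ℚ <_) (↥p≡0⇒p≡0 ε refl) 0<ε))
  archimedean ε@(mkℚ ℤ.-[1+ a ]   d _) 0<ε = ⊥-elim (<-asym 0<ε (negative⁻¹ ε))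
  -- The denominator of ε, stored as its predecessor d, serves as e, because the numerator is at
  -- least 1.
  archimedean ε@(mkℚ ℤ.+[1+ a ]   d c) 0<ε = suc d , s≤s z≤n , (begin
    1ℚ                        ≡⟨ sym (1/*ι (suc d)) ⟩
    (ℤ.+ 1 / suc d) * ι (suc d) ≤⟨ *-monoʳ-≤-nonNeg (ι (suc d)) {{nonNegative (0≤ι (suc d))}} 1/d≤ε ⟩
    ε * ι (suc d)             ∎)
    where
    open ≤-Reasoning
    1/d≤ε : ℤ.+ 1 / suc d ≤ ε
    1/d≤ε = toℚᵘ-cancel-≤ (ℚᵘ.≤-respˡ-≃ (ℚᵘ.≃-sym (toℚᵘ-fromℚᵘ (ℚᵘ.mkℚᵘ (ℤ.+ 1) d)))
      (ℚᵘ.*≤* (ℤ.*-monoʳ-≤-nonNeg (ℤ.+ suc d) (ℤ.+≤+ (s≤s (z≤n {a}))))))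

  square≤2^ : ∀ t → 4 ℕ.≤ t → t ℕ.* t ℕ.≤ 2 ℕ.^ t
  square≤2^ t 4≤t = subst (λ z → z ℕ.* z ℕ.≤ 2 ℕ.^ z) (ℕ.m+[n∸m]≡n 4≤t) (go (t ℕ.∸ 4))
    where
    go : ∀ j → (4 ℕ.+ j) ℕ.* (4 ℕ.+ j) ℕ.≤ 2 ℕ.^ (4 ℕ.+ j)
    go zero    = ℕ.≤-refl
    go (suc j) = begin
      (5 ℕ.+ j) ℕ.* (5 ℕ.+ j)                                  ≤⟨ ℕ.m≤m+n _ (7 ℕ.+ 6 ℕ.* j ℕ.+ j ℕ.* j) ⟩
      (5 ℕ.+ j) ℕ.* (5 ℕ.+ j) ℕ.+ (7 ℕ.+ 6 ℕ.* j ℕ.+ j ℕ.* j)  ≡⟨ s j ⟩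
      2 ℕ.* ((4 ℕ.+ j) ℕ.* (4 ℕ.+ j))                          ≤⟨ ℕ.*-monoʳ-≤ 2 (go j) ⟩
      2 ℕ.^ (5 ℕ.+ j)                                          ∎
      where
      open ℕ.≤-Reasoning
      s : ∀ j → (5 ℕ.+ j) ℕ.* (5 ℕ.+ j) ℕ.+ (7 ℕ.+ 6 ℕ.* j ℕ.+ j ℕ.* j) ≡ 2 ℕ.* ((4 ℕ.+ j) ℕ.* (4 ℕ.+ j))
      s = ℕ-solve-∀

open import Data.Nat using (_+_; _*_; _∸_; _^_; _≤_; _<_; >-nonZero)
open import Data.Nat.Divisibility using (_∣_; divides)
open import Data.Nat.Properties
open Counting using (density; density-pos)
open Probability using (ι; ι-pos; archimedean; square≤2^; module Moments)

theorem6 : (k : ℕ) → 3 ≤ k → (ε : ℚ) → 0ℚ ℚ.< ε →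
    ∃[ K′ ] (0ℚ ℚ.< K′ ×
    ((ℓ : ℕ) → 2 ≤ ℓ → ℓ < k →
    ∃[ n₀ ] ((n : ℕ) .{{_ : NonZero n}} → n₀ ≤ n → (k ∸ ℓ) ∣ n →
    (q : ℕ) .{{_ : NonZero q}} → n ≤ q * (k ∸ ℓ) →
    1ℚ ℚ.- ε ℚ.≤ Pr (hasRainbowHamiltonCycle? k ℓ) (randomColouredHypergraph k n q (edgeProbability K′ k ℓ n)))))
theorem6 k 3≤k ε 0<ε with e , 1≤e , 1≤εe ← archimedean ε 0<ε =
  ι (4 * density k e) , ι-pos _ (≤-trans (density-pos k e 1≤k 1≤e) (m≤m+n _ _)) , λ ℓ 2≤ℓ ℓ<k →
  -- The summand `a` makes the cycle long; the other two give 16 k ≤ n and K ≤ n.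
  a + (4 * (4 * k) + 4 * density k e) , bound e 1≤e 1≤εe ℓ 2≤ℓ ℓ<k
  where
  1≤k : 1 ≤ k
  1≤k = ≤-trans (s≤s z≤n) 3≤k
  T a : ℕ
  -- From 2^ℓ ≤ 2^k ≤ t and t ≥ 4 it follows that t 2^ℓ ≤ t² ≤ 2^t. Since n = t (k - ℓ) ≤ t k, the
  -- bound n ≥ T k ensures t ≥ T.
  T = 4 + 2 ^ k
  a = T * k
  bound : ∀ e → 1 ≤ e → 1ℚ ℚ.≤ ε ℚ.* ι e → ∀ ℓ → 2 ≤ ℓ → ℓ < k →
    (n : ℕ) .{{_ : NonZero n}} → a + (4 * (4 * k) + 4 * density k e) ≤ n → (k ∸ ℓ) ∣ n →
    (q : ℕ) .{{_ : NonZero q}} → n ≤ q * (k ∸ ℓ) →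
    1ℚ ℚ.- ε ℚ.≤ Pr (hasRainbowHamiltonCycle? k ℓ) (randomColouredHypergraph k n q (edgeProbability (ι (4 * density k e)) k ℓ n))
  bound e 1≤e 1≤εe ℓ 2≤ℓ ℓ<k _ n₀≤n (divides t refl) q n≤qm = probability-bound ε 1≤εe
    where
    m : ℕ
    m = k ∸ ℓ
    1≤m : 1 ≤ m
    1≤m = m<n⇒0<n∸m ℓ<k
    T≤t : T ≤ t
    T≤t = *-cancelʳ-≤ T t k {{>-nonZero 1≤k}} (≤-trans (m≤m+n a _) (≤-trans n₀≤n (*-monoʳ-≤ t (m∸n≤m k ℓ))))
    4≤t : 4 ≤ t
    4≤t = ≤-trans (m≤m+n 4 _) T≤t
    t≤q : t ≤ q
    t≤q = *-cancelʳ-≤ t q m {{>-nonZero 1≤m}} n≤qm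
    t2^ℓ≤2^t : t * 2 ^ ℓ ≤ 2 ^ t
    t2^ℓ≤2^t = ≤-trans (*-monoʳ-≤ t (≤-trans (^-monoʳ-≤ 2 (<⇒≤ ℓ<k)) (≤-trans (m≤n+m (2 ^ k) 4) T≤t))) (square≤2^ t 4≤t)
    instance
      t≢0 : NonZero t
      t≢0 = >-nonZero (≤-trans (s≤s z≤n) 4≤t)
    open Moments k ℓ t q e 2≤ℓ ℓ<k 1≤e (≤-trans (s≤s z≤n) 4≤t) t≤q
      (≤-trans (≤-trans (m≤m+n _ _) (m≤n+m _ a)) n₀≤n) t2^ℓ≤2^t
      (≤-trans (≤-trans (m≤n+m _ (4 * (4 * k))) (m≤n+m _ a)) n₀≤n) using (probability-bound)
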